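{- Let $m$ be a positive integer and let $G$ be a finite group. Then one of the following holds: (1) $G$ has an $m$-DRR; (2) $m=1$ and $G$ is isomorphic to $Q_8$, $\mathbb{Z}_2^2$, $\mathbb{Z}_2^3$, $\mathbb{Z}_2^4$ or $\mathbb{Z}_3^2$; (3) $m=2$ and $G$ is isomorphic to $\mathbb{Z}_1$ or $\mathbb{Z}_2$; (4) $3\le m\le 5$ and $G$ is isomorphic to $\mathbb{Z}_1$.
   Context: All groups and digraphs are finite. A digraph $(V,A)$ has arc set $A\subseteq V\times V$ with no loops; it is regular if there is an integer $d$ such that every vertex has in-valency and out-valency equal to $d$. For a finite group $G$ and positive integer $m$, an $m$-DRR of $G$ is a regular digraph whose automorphism group is isomorphic to $G$ and acts semiregularly (trivial vertex stabilizers) on the vertex set with exactly $m$ orbits. $Q_8$ is the quaternion group of order $8$ and $\mathbb{Z}_n$ the cyclic group of order $n$. -}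

module Defs where

open import Data.Nat using (ℕ; zero; suc; _+_; _≤_)
open import Data.Nat.DivMod using (_mod_)
open import Data.Fin using (Fin; toℕ)
open import Data.Fin.Permutation using (Permutation′; _⟨$⟩ʳ_)
open import Data.Bool using (Bool; true; false; _xor_)
open import Data.Product using (Σ; ∃; ∃-syntax; _×_; _,_)
open import Data.Sum using (_⊎_)
open import Function.Bundles using (_↔_; Inverse)
open import Algebra.Structures using (IsGroup)
open import Relation.Binary.PropositionalEquality using (_≡_)

record FinGroup : Set₁ where
  field
    Carrier : Set
    _∙_     : Carrier → Carrier → Carrier
    ε       : Carrier
    _⁻¹     : Carrier → Carrier
    isGroup : IsGroup _≡_ _∙_ ε _⁻¹
    order   : ℕ
    enum    : Carrier ↔ Fin order

record Table : Set₁ where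
  field
    Carrier : Set
    _·_     : Carrier → Carrier → Carrier

_≅_ : FinGroup → Table → Set
G ≅ T = Σ (FinGroup.Carrier G ↔ Table.Carrier T) λ φ →
  ∀ a b → Inverse.to φ (FinGroup._∙_ G a b)
          ≡ Table._·_ T (Inverse.to φ a) (Inverse.to φ b)

ℤ : (n : ℕ) → .{{_ : Data.Nat.NonZero n}} → Table
ℤ n = record { Carrier = Fin n ; _·_ = λ a b → (toℕ a + toℕ b) mod n }

_⊗_ : Table → Table → Table
S ⊗ T = record
  { Carrier = Table.Carrier S × Table.Carrier T
  ; _·_ = λ { (a , b) (c , d) → (Table._·_ S a c , Table._·_ T b d) } }

ℤ₁ ℤ₂ ℤ₃ ℤ₂² ℤ₂³ ℤ₂⁴ ℤ₃² : Table
ℤ₁ = ℤ 1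
ℤ₂ = ℤ 2
ℤ₃ = ℤ 3
ℤ₂² = ℤ₂ ⊗ ℤ₂
ℤ₂³ = ℤ₂ ⊗ ℤ₂²
ℤ₂⁴ = ℤ₂ ⊗ ℤ₂³
ℤ₃² = ℤ₃ ⊗ ℤ₃

-- Quaternion group Q₈ = {±1, ±i, ±j, ±k}; element (s , u) means (-1)^s · u
data Unit4 : Set where
  𝟏 𝐢 𝐣 𝐤 : Unit4

mulU : Unit4 → Unit4 → Bool × Unit4
mulU 𝟏 u = false , u
mulU 𝐢 𝟏 = false , 𝐢
mulU 𝐢 𝐢 = true , 𝟏
mulU 𝐢 𝐣 = false , 𝐤
mulU 𝐢 𝐤 = true , 𝐣
mulU 𝐣 𝟏 = false , 𝐣
mulU 𝐣 𝐢 = true , 𝐤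
mulU 𝐣 𝐣 = true , 𝟏
mulU 𝐣 𝐤 = false , 𝐢
mulU 𝐤 𝟏 = false , 𝐤
mulU 𝐤 𝐢 = false , 𝐣
mulU 𝐤 𝐣 = true , 𝐢
mulU 𝐤 𝐤 = true , 𝟏

mulQ : Bool × Unit4 → Bool × Unit4 → Bool × Unit4
mulQ (s , a) (t , b) with mulU a b
... | (f , c) = ((s xor t) xor f) , c

Q₈ : Table
Q₈ = record { Carrier = Bool × Unit4 ; _·_ = mulQ }

record Digraph (v : ℕ) : Set where
  field
    arc    : Fin v → Fin v → Bool
    noLoop : ∀ x → arc x x ≡ false

count : ∀ {n} → (Fin n → Bool) → ℕ
count {zero}  f = 0
count {suc n} f with f Fin.zero
... | true  = suc (count (λ i → f (Fin.suc i)))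
... | false = count (λ i → f (Fin.suc i))

outdeg indeg : ∀ {v} → Digraph v → Fin v → ℕ
outdeg Γ x = count (λ y → Digraph.arc Γ x y)
indeg  Γ x = count (λ y → Digraph.arc Γ y x)

IsRegular : ∀ {v} → Digraph v → Set
IsRegular Γ = ∃[ d ] (∀ x → outdeg Γ x ≡ d × indeg Γ x ≡ d)

IsAut : ∀ {v} → Digraph v → Permutation′ v → Set
IsAut Γ σ = ∀ x y → Digraph.arc Γ (σ ⟨$⟩ʳ x) (σ ⟨$⟩ʳ y) ≡ Digraph.arc Γ x y

-- m-DRR
-- Γ is an m-DRR of G, witnessed by ρ : G → Sym(V), which is an
-- isomorphism from G onto Aut(Γ); Aut(Γ) acts semiregularly with
-- exactly m orbits.

record IsDRR (m : ℕ) (G : FinGroup) {v : ℕ} (Γ : Digraph v)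
             (ρ : FinGroup.Carrier G → Fin v → Fin v) : Set where
  open FinGroup G
  field
    regular   : IsRegular Γ
    hom-∙     : ∀ g h x → ρ (g ∙ h) x ≡ ρ g (ρ h x)
    hom-ε     : ∀ x → ρ ε x ≡ x
    faithful  : ∀ g h → (∀ x → ρ g x ≡ ρ h x) → g ≡ h
    ρ-aut     : ∀ g x y → Digraph.arc Γ (ρ g x) (ρ g y) ≡ Digraph.arc Γ x y
    aut-ρ     : ∀ (σ : Permutation′ v) → IsAut Γ σ →
                ∃[ g ] (∀ x → σ ⟨$⟩ʳ x ≡ ρ g x)
    semiregular : ∀ g x → ρ g x ≡ x → g ≡ ε
    -- exactly m orbits: a transversal indexed by Fin m
    rep        : Fin m → Fin v
    rep-covers : ∀ x → ∃[ i ] ∃[ g ] (ρ g (rep i) ≡ x)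
    rep-distinct : ∀ i j g → ρ g (rep i) ≡ rep j → i ≡ j

HasDRR : ℕ → FinGroup → Set
HasDRR m G = ∃[ v ] Σ (Digraph v) λ Γ →
  Σ (FinGroup.Carrier G → Fin v → Fin v) λ ρ → IsDRR m G Γ ρ

{-# OPTIONS --safe #-}

-- Suppose that a subgroup H of G has an m-DRR in which any two vertices are joined by a path of length two,
-- and let a ∉ H. Copy it to all cosets of H in ⟨H, a⟩ and add the arcs u → u a. An added arc is never the long
-- side of a transitive triangle while every old arc is, so automorphisms preserve both kinds of arcs, and the
-- result is an m-DRR of ⟨H, a⟩. Its complement again joins any two vertices by a path of length two as soon as
-- every vertex of the given m-DRR has two non-neighbours. Hence one subgroup with such a "good" m-DRR
-- suffices for the whole group.
--
-- Good m-DRRs arise as complements of sparse digraphs: a digraph of valency d on more than 2 d + 2 vertices has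
-- the path property in its complement, by counting. For m ≥ 2 the sparse digraphs live on subgroups generated
-- by at most two elements. For m = 1 they are Cayley digraphs with connection sets {c, c², b}, {c, b} with b an
-- involution, or {c, b, c b}, and the groups without suitable elements are cyclic, Q₈, or elementary abelian of
-- exponent 2 or 3; explicit sets in ℤ₂⁵ and ℤ₃³ then settle the elementary abelian groups of larger rank.

module Submission where

open import Defs
open import Level using (0ℓ)
open import Data.Nat using (ℕ; zero; suc; _+_; _∸_; _*_; _<_; _≤_; z≤n; s≤s; _/_; _%_; _<?_)
import Data.Nat.Properties as ℕ
open import Data.Nat.DivMod using (_mod_; m≡m%n+[m/n]*n; m%n<n)
open import Data.Fin using (Fin; zero; suc; toℕ; inject₁; fromℕ; splitAt; join; remQuot; combine; #_)
open import Data.Fin.Patterns using (0F; 1F; 2F; 3F)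
import Data.Fin.Properties as Fin
open import Data.Fin.Permutation as Perm using (Permutation′; _⟨$⟩ʳ_; _⟨$⟩ˡ_)
open import Data.Fin.Subset.Properties using (anySubset?)
open import Data.Fin.Relation.Unary.Top using (view; ‵fromℕ; ‵inj₁; view-fromℕ; view-inject₁)
open import Data.Fin.Induction using (<-weakInduction)
open import Data.Bool using (Bool; true; false; T; if_then_else_; _∧_; _∨_; not; _xor_)
import Data.Bool.Properties as Bool
open import Data.Bool.ListAction using (all)
open import Data.Vec as Vec using (Vec; []; _∷_)
open import Data.Vec.Properties using (lookup∘tabulate)
open import Data.List as List using (List; []; _∷_; _++_; allFin; length)
open import Data.List.Properties using (length-++; length-tabulate)
open import Data.List.Membership.Propositional using (_∈_; _∉_)
open import Data.List.Membership.Propositional.Properties using (∈-allFin; ∈-map⁺; ∈-tabulate⁺; ∈-++⁺ˡ; ∈-++⁺ʳ)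
import Data.List.Membership.DecPropositional as DecMem
import Data.List.Relation.Unary.All as All
open import Data.List.Relation.Unary.All.Properties using (all⁺)
open import Data.List.Relation.Unary.Any using (here; there; index)
open import Data.List.Relation.Unary.Any.Properties using (lookup-index)
open import Data.Product using (∃; ∃-syntax; ∃₂; _×_; _,_; proj₁; proj₂)
open import Data.Product.Properties using (,-injectiveˡ; ,-injectiveʳ)
open import Data.Product.Function.NonDependent.Propositional using (_×-↔_)
open import Data.Sum as Sum using (_⊎_; inj₁; inj₂; [_,_]′)
open import Data.Empty using (⊥; ⊥-elim)
open import Data.Unit using (tt)
open import Function using (_∘_; id)
open import Function.Bundles using (_↔_; Inverse; mk↔ₛ′)
open import Function.Properties.Inverse using (↔-refl; ↔-sym; ↔-trans)
open import Function.Definitions using (Injective)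
open import Relation.Nullary using (¬_; Dec; yes; no; does; contradiction)
open import Relation.Nullary.Decidable using (¬?; _×-dec_; _⊎-dec_; _→-dec_; decidable-stable; map′; dec-true; dec-false; from-yes; True; toWitness)
open import Relation.Unary using (Pred; Decidable)
open import Relation.Binary.Definitions using (DecidableEquality)
open import Relation.Binary.Construct.Closure.ReflexiveTransitive using (Star; _◅_; _◅◅_; gmap) renaming (ε to [])
open import Relation.Binary.PropositionalEquality using (_≡_; _≢_; refl; sym; trans; cong; cong₂; subst; subst₂; module ≡-Reasoning)
open import Algebra.Bundles using (Group)
import Algebra.Properties.CommutativeMonoid.Sum ℕ.+-0-commutativeMonoid as Sum′

-- Counting and searching in a finite type

-- All digraphs live on `Carrier × Fin m` for the whole group from the start: a digraph on a
-- subgroup is represented by the disjoint union of its copies on all left cosets. Thus subgroups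
-- never become groups of their own, and adjoining an element only adds arcs to a fixed vertex set.
-- The price is that automorphisms may move the cosets independently of one another; they are
-- controlled only by how they commute with right multiplication by the subgroup. This control is
-- complete once the subgroup is the whole group. Complements are taken inside the cosets of the
-- larger subgroup after every adjunction, because the extension step needs a dense digraph and
-- itself produces the two non-neighbours that the next step consumes. The counting bound is 6
-- vertices for valency two and 8 for valency three. Many distinctions by element orders only serve
-- to exhibit one vertex more than that. Where a whole group is too small for it, the sparse digraph
-- is used on that group directly, without any extension.

if-bit : Bool → ℕ
if-bit b = if b then 1 else 0

count-sum : ∀ {n} (f : Fin n → Bool) → count f ≡ Sum′.sum (if-bit ∘ f)
count-sum {zero}  f = refl
count-sum {suc n} f with f zero
... | true  = cong suc (count-sum (f ∘ suc))
... | false = count-sum (f ∘ suc)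

count-cong : ∀ {n} {f g : Fin n → Bool} → (∀ i → f i ≡ g i) → count f ≡ count g
count-cong {f = f} {g} e =
  trans (count-sum f) (trans (Sum′.sum-cong-≗ (cong if-bit ∘ e)) (sym (count-sum g)))

count-false : ∀ n → count {n} (λ _ → false) ≡ 0
count-false zero    = refl
count-false (suc n) = count-false n

module Finite {A : Set} {N : ℕ} (enum : A ↔ Fin N) where
  open Inverse enum using (to; from; strictlyInverseˡ; strictlyInverseʳ)

  to-injective : ∀ {x y} → to x ≡ to y → x ≡ y
  to-injective e = trans (sym (strictlyInverseʳ _)) (trans (cong from e) (strictlyInverseʳ _))

  infix 4 _≟_
  _≟_ : DecidableEquality A
  x ≟ y = map′ to-injective (cong to) (to x Fin.≟ to y)

  search : ∀ {P : Pred A 0ℓ} → Decidable P → Dec (∃ P)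
  search {P} P? = map′ (λ (i , p) → from i , p)
                       (λ (x , p) → to x , subst P (sym (strictlyInverseʳ x)) p)
                       (Fin.any? (P? ∘ from))

  forall? : ∀ {P : Pred A 0ℓ} → Decidable P → Dec (∀ x → P x)
  forall? {P} P? = map′ (λ h x → subst P (strictlyInverseʳ x) (h (to x)))
                        (λ h i → h (from i))
                        (Fin.all? (P? ∘ from))

  size : ∀ {P : Pred A 0ℓ} → Decidable P → ℕ
  size P? = count (λ i → does (P? (from i)))

  does-⇔ : ∀ {P Q : Set} (p : Dec P) (q : Dec Q) → (P → Q) → (Q → P) → does p ≡ does q
  does-⇔ (yes p) q f g = sym (dec-true q (f p))
  does-⇔ (no ¬p) q f g = sym (dec-false q (¬p ∘ g))

  size-⇔ : ∀ {P Q : Pred A 0ℓ} (P? : Decidable P) (Q? : Decidable Q) →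
           (∀ x → P x → Q x) → (∀ x → Q x → P x) → size P? ≡ size Q?
  size-⇔ P? Q? f g = count-cong λ i → does-⇔ (P? (from i)) (Q? (from i)) (f _) (g _)

  size-⊎ : ∀ {P Q : Pred A 0ℓ} (P? : Decidable P) (Q? : Decidable Q) →
           (∀ x → P x → Q x → ⊥) → size (λ x → P? x ⊎-dec Q? x) ≡ size P? + size Q?
  size-⊎ P? Q? disj = trans (count-sum {N} _) (trans (Sum′.sum-cong-≗ bits)
    (trans (Sum′.∑-distrib-+ {N} _ _) (sym (cong₂ _+_ (count-sum {N} _) (count-sum {N} _)))))
    where
    bits : ∀ i → if-bit (does (P? (from i) ⊎-dec Q? (from i)))
               ≡ if-bit (does (P? (from i))) + if-bit (does (Q? (from i)))
    bits i with P? (from i) | Q? (from i)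
    ... | yes p | yes q = ⊥-elim (disj _ p q)
    ... | yes p | no _  = refl
    ... | no _  | yes _ = refl
    ... | no _  | no _  = refl

  size-∘ : ∀ {P : Pred A 0ℓ} (P? : Decidable P) (f g : A → A) →
           (∀ x → f (g x) ≡ x) → (∀ x → g (f x) ≡ x) → size (P? ∘ f) ≡ size P?
  size-∘ {P} P? f g fg gf = sym (trans (count-sum {N} _) (trans (Sum′.sum-permute _ π)
    (trans (Sum′.sum-cong-≗ λ i → cong if-bit (does-⇔ (P? (from (to (f (from i)))))
        (P? (f (from i))) (subst P (strictlyInverseʳ _)) (subst P (sym (strictlyInverseʳ _)))))
      (sym (count-sum {N} _)))))
    where
    π : Perm.Permutation N N
    π = Perm.permutation (to ∘ f ∘ from) (to ∘ g ∘ from)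
      (λ i → trans (cong (to ∘ f) (strictlyInverseʳ _)) (trans (cong to (fg _)) (strictlyInverseˡ i)))
      (λ i → trans (cong (to ∘ g) (strictlyInverseʳ _)) (trans (cong to (gf _)) (strictlyInverseˡ i)))

  size-∅ : ∀ {P : Pred A 0ℓ} (P? : Decidable P) → (∀ x → ¬ P x) → size P? ≡ 0
  size-∅ P? ¬p = trans (count-cong (λ i → dec-false (P? (from i)) (¬p _))) (count-false N)

  size-≟ : ∀ a → size (a ≟_) ≡ 1
  size-≟ a = trans (count-cong {N} λ i → does-⇔ (a ≟ from i) (to a Fin.≟ i)
      (λ e → trans (cong to e) (strictlyInverseˡ i)) (λ e → trans (sym (strictlyInverseʳ a)) (cong from e)))
    (point (to a))
    where
    point : ∀ {n} (k : Fin n) → count (λ i → does (k Fin.≟ i)) ≡ 1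
    point {suc n} zero    = cong suc (count-false n)
    point {suc n} (suc k) = trans (count-cong {n} (λ i → refl)) (point k)

  size-image : ∀ {d} (g : Fin d → A) → Injective _≡_ _≡_ g →
               size (λ x → Fin.any? (λ k → g k ≟ x)) ≡ d
  size-image {zero}  g inj = size-∅ (λ x → Fin.any? (λ k → g k ≟ x)) (λ _ ())
  size-image {suc d} g inj = trans
    (size-⇔ (λ x → Fin.any? (λ k → g k ≟ x)) (λ x → (g zero ≟ x) ⊎-dec Fin.any? (λ k → g (suc k) ≟ x))
      (λ { x (zero , e) → inj₁ e ; x (suc k , e) → inj₂ (k , e) })
      (λ { x (inj₁ e) → zero , e ; x (inj₂ (k , e)) → suc k , e }))
    (trans (size-⊎ (g zero ≟_) (λ x → Fin.any? (λ k → g (suc k) ≟ x))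
             (λ { x e (k , e') → contradiction (inj (trans e (sym e'))) λ () }))
           (cong₂ _+_ (size-≟ (g zero)) (size-image (g ∘ suc) (Fin.suc-injective ∘ inj))))

  -- Otherwise sending `i` to the position of `f i` in `ys` would inject `Fin n` into the positions
  -- of a shorter list.
  pigeonhole : ∀ {n} (f : Fin n → A) → Injective _≡_ _≡_ f → (ys : List A) → length ys < n →
               ∃ λ i → f i ∉ ys
  pigeonhole f inj ys lt with Fin.any? (λ i → ¬? (f i ∈? ys)) where open DecMem _≟_ using (_∈?_)
  ... | yes r = r
  ... | no ¬r = contradiction lt (ℕ.≤⇒≯ (Fin.injective⇒≤ {f = index ∘ mem} λ {i} {j} e →
          inj (trans (lookup-index (mem i)) (trans (cong (List.lookup ys) e) (sym (lookup-index (mem j)))))))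
    where
    open DecMem _≟_ using (_∈?_)
    mem : ∀ i → f i ∈ ys
    mem i = decidable-stable (f i ∈? ys) (λ ¬m → ¬r (i , ¬m))

-- Subgroups

module GroupTheory (G : FinGroup) where
  open FinGroup G renaming (_∙_ to infixl 7 _∙_; _⁻¹ to infix 8 _⁻¹) public

  group : Group 0ℓ 0ℓ
  group = record { isGroup = isGroup }

  open Group group using (monoid; assoc; identityˡ; identityʳ; inverseˡ; inverseʳ) public
  open import Algebra.Properties.Group group public
  open Finite enum public

  record Subgroup : Set₁ where
    field
      Mem  : Carrier → Set
      Mem? : Decidable Mem
      ε∈   : Mem ε
      ∙∈   : ∀ {x y} → Mem x → Mem y → Mem (x ∙ y)
      ⁻¹∈  : ∀ {x} → Mem x → Mem (x ⁻¹)

    ∙∈ʳ : ∀ {x y} → Mem x → Mem (x ∙ y) → Mem y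
    ∙∈ʳ {x} {y} p q = subst Mem (\\-leftDividesʳ x y) (∙∈ (⁻¹∈ p) q)

    ∙∈ˡ : ∀ {x y} → Mem y → Mem (x ∙ y) → Mem x
    ∙∈ˡ {x} {y} p q = subst Mem (//-rightDividesʳ y x) (∙∈ q (⁻¹∈ p))

  module Generated {X : Carrier → Set} (X? : Decidable X) where
    open Inverse enum using (to; from; strictlyInverseʳ)

    _∈ᵛ_ : Carrier → Vec Bool order → Set
    x ∈ᵛ p = Vec.lookup p (to x) ≡ true

    Closed : Vec Bool order → Set
    Closed p = ε ∈ᵛ p × (∀ x s → X s → x ∈ᵛ p → (x ∙ s) ∈ᵛ p × (x ∙ s ⁻¹) ∈ᵛ p)

    Separating : Carrier → Vec Bool order → Set
    Separating x p = Closed p × ¬ x ∈ᵛ p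

    _∈ᵛ?_ : ∀ x p → Dec (x ∈ᵛ p)
    x ∈ᵛ? p = Vec.lookup p (to x) Bool.≟ true

    separating? : ∀ x p → Dec (Separating x p)
    separating? x p = ((ε ∈ᵛ? p) ×-dec forall? λ x → forall? λ s → X? s →-dec ((x ∈ᵛ? p) →-dec
      (((x ∙ s) ∈ᵛ? p) ×-dec ((x ∙ s ⁻¹) ∈ᵛ? p)))) ×-dec ¬? (x ∈ᵛ? p)

    -- Intersecting all closed subsets, rather than collecting words, makes membership decidable at once.
    Gen : Carrier → Set
    Gen x = ¬ ∃ (Separating x)

    Gen? : Decidable Gen
    Gen? x = ¬? (anySubset? (separating? x))

    -- A decidable `P`, tabulated as a bit vector, is itself one of the closed subsets over which
    -- `Gen` quantifies; an element outside `P` would be separated by it.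
    gen-elim : ∀ {P : Pred Carrier 0ℓ} → Decidable P → P ε →
               (∀ x s → X s → P x → P (x ∙ s)) → (∀ x s → X s → P x → P (x ∙ s ⁻¹)) →
               ∀ {x} → Gen x → P x
    gen-elim {P} P? pε p∙ p⁻ {x} gx = decidable-stable (P? x) λ ¬px →
        gx (p , (mem⁺ pε , λ y s Xs yp → mem⁺ (p∙ y s Xs (mem⁻ yp)) , mem⁺ (p⁻ y s Xs (mem⁻ yp))) , ¬px ∘ mem⁻)
      where
      p : Vec Bool order
      p = Vec.tabulate (λ i → does (P? (from i)))
      look : ∀ y → Vec.lookup p (to y) ≡ does (P? y)
      look y = trans (lookup∘tabulate _ (to y)) (cong (does ∘ P?) (strictlyInverseʳ y))
      mem⁺ : ∀ {y} → P y → y ∈ᵛ p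
      mem⁺ {y} py = trans (look y) (dec-true (P? y) py)
      mem⁻ : ∀ {y} → y ∈ᵛ p → P y
      mem⁻ {y} e = decidable-stable (P? y) λ ¬py →
        contradiction (trans (sym e) (trans (look y) (dec-false (P? y) ¬py))) λ ()

    gen-ε : Gen ε
    gen-ε (p , (ε∈ , _) , ε∉) = ε∉ ε∈

    gen-∙ : ∀ {x s} → Gen x → X s → Gen (x ∙ s)
    gen-∙ {x} {s} gx Xs (p , cl , ∉p) =
      gx (p , cl , λ xp → ∉p (proj₁ (proj₂ cl x s Xs xp)))

    gen-∙⁻¹ : ∀ {x s} → Gen x → X s → Gen (x ∙ s ⁻¹)
    gen-∙⁻¹ {x} {s} gx Xs (p , cl , ∉p) =
      gx (p , cl , λ xp → ∉p (proj₂ (proj₂ cl x s Xs xp)))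

    gen-product : ∀ {x y} → Gen x → Gen y → Gen (x ∙ y)
    gen-product {x} gx = gen-elim (λ y → Gen? (x ∙ y)) (subst Gen (sym (identityʳ x)) gx)
      (λ y s Xs g → subst Gen (assoc x y s) (gen-∙ g Xs))
      (λ y s Xs g → subst Gen (assoc x y (s ⁻¹)) (gen-∙⁻¹ g Xs))

    gen-X : ∀ {s} → X s → Gen s
    gen-X {s} Xs = subst Gen (identityˡ s) (gen-∙ gen-ε Xs)

    gen-inverse : ∀ {x} → Gen x → Gen (x ⁻¹)
    gen-inverse = gen-elim (λ y → Gen? (y ⁻¹)) (subst Gen (sym ε⁻¹≈ε) gen-ε)
      (λ x s Xs g → subst Gen (sym (⁻¹-anti-homo-∙ x s))
        (gen-product (subst Gen (identityˡ (s ⁻¹)) (gen-∙⁻¹ gen-ε Xs)) g))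
      (λ x s Xs g → subst Gen (sym (trans (⁻¹-anti-homo-∙ x (s ⁻¹)) (cong (_∙ x ⁻¹) (⁻¹-involutive s))))
        (gen-product (gen-X Xs) g))

    ⟨X⟩ : Subgroup
    ⟨X⟩ = record { Mem = Gen ; Mem? = Gen? ; ε∈ = gen-ε ; ∙∈ = gen-product ; ⁻¹∈ = gen-inverse }

    -- Commuting with right multiplication by generators at every point passes to words; for the
    -- inverse of a generator the hypothesis is applied one step earlier and the generator
    -- cancelled. This turns statements about single arcs into the last clause of `rigid`.
    gen-homogeneous : ∀ (f : Carrier → Carrier) → (∀ x s → X s → f (x ∙ s) ≡ f x ∙ s) →
                      ∀ x {h} → Gen h → f (x ∙ h) ≡ f x ∙ h
    gen-homogeneous f fs x = gen-elim (λ h → f (x ∙ h) ≟ f x ∙ h)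
      (trans (cong f (identityʳ x)) (sym (identityʳ (f x))))
      (λ y s Xs e → trans (cong f (sym (assoc x y s))) (trans (fs (x ∙ y) s Xs)
        (trans (cong (_∙ s) e) (assoc (f x) y s))))
      (λ y s Xs e → ∙-cancelʳ s _ _ (trans (sym (fs (x ∙ (y ∙ s ⁻¹)) s Xs))
        (trans (cong f (trans (assoc x (y ∙ s ⁻¹) s) (cong (x ∙_) (//-rightDividesˡ s y))))
        (trans e (sym (trans (assoc (f x) (y ∙ s ⁻¹) s) (cong (f x ∙_) (//-rightDividesˡ s y))))))))

-- Invariant digraphs on cosets: complements, adjoining an element, passage to an m-DRR

module Representations (G : FinGroup) (m : ℕ) where
  open GroupTheory G

  V : Set
  V = Carrier × Fin m

  V↔Fin : V ↔ Fin (order * m)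
  V↔Fin = ↔-trans (enum ×-↔ ↔-refl) (↔-sym Fin.*↔×)

  module V = Finite V↔Fin

  infixr 7 _▷_
  _▷_ : Carrier → V → V
  g ▷ (x , i) = g ∙ x , i

  infixl 7 _◁_
  _◁_ : V → Carrier → V
  (x , i) ◁ a = x ∙ a , i

  ▷-▷ : ∀ g h u → g ▷ (h ▷ u) ≡ (g ∙ h) ▷ u
  ▷-▷ g h (x , i) = cong (_, i) (sym (assoc g h x))

  ε▷ : ∀ u → ε ▷ u ≡ u
  ε▷ (x , i) = cong (_, i) (identityˡ x)

  ◁-◁⁻¹ : ∀ u a → u ◁ a ◁ a ⁻¹ ≡ u
  ◁-◁⁻¹ (x , i) a = cong (_, i) (//-rightDividesʳ a x)

  ◁⁻¹-◁ : ∀ u a → u ◁ a ⁻¹ ◁ a ≡ u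
  ◁⁻¹-◁ (x , i) a = cong (_, i) (//-rightDividesˡ a x)

  record Aut (E : V → V → Set) : Set where
    field
      σ τ   : V → V
      σ-τ   : ∀ u → σ (τ u) ≡ u
      τ-σ   : ∀ u → τ (σ u) ≡ u
      σ-arc : ∀ {u w} → E u w → E (σ u) (σ w)
      τ-arc : ∀ {u w} → E u w → E (τ u) (τ w)

    σ-injective : ∀ {u w} → σ u ≡ σ w → u ≡ w
    σ-injective e = trans (sym (τ-σ _)) (trans (cong τ e) (τ-σ _))

    σ-reflects : ∀ {u w} → E (σ u) (σ w) → E u w
    σ-reflects e = subst₂ E (τ-σ _) (τ-σ _) (τ-arc e)

  inverse : ∀ {E} → Aut E → Aut E
  inverse A = record
    { σ = τ ; τ = σ ; σ-τ = τ-σ ; τ-σ = σ-τ ; σ-arc = τ-arc ; τ-arc = σ-arc }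
    where open Aut A

  -- A subgroup H together with a left-invariant regular digraph on G × Fin m, all of whose arcs stay
  -- inside left cosets of H, and which on each coset is an m-DRR of H.
  record Rep : Set₁ where
    field
      subgroup : Subgroup
    open Subgroup subgroup public
    field
      E       : V → V → Set
      E?      : ∀ u w → Dec (E u w)
      E-▷     : ∀ g {u w} → E u w → E (g ▷ u) (g ▷ w)
      E-irr   : ∀ {u} → ¬ E u u
      E-coset : ∀ {u w} → E u w → Mem (proj₁ u ⁻¹ ∙ proj₁ w)
      deg     : ℕ
      out-deg : ∀ u → V.size (E? u) ≡ deg
      in-deg  : ∀ w → V.size (λ u → E? u w) ≡ deg
      -- With no arcs between cosets, an automorphism may move each coset by its own left
      -- translation, so `f` is only required to commute with right multiplication by members of the
      -- subgroup. One `f` serves all `m` orbits.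
      rigid   : (A : Aut E) → ∃ λ (f : Carrier → Carrier) →
                (∀ x i → Aut.σ A (x , i) ≡ (f x , i)) × (∀ x {h} → Mem h → f (x ∙ h) ≡ f x ∙ h)

    infix 4 _~_
    _~_ : V → V → Set
    u ~ w = Mem (proj₁ u ⁻¹ ∙ proj₁ w)

    _~?_ : ∀ u w → Dec (u ~ w)
    u ~? w = Mem? (proj₁ u ⁻¹ ∙ proj₁ w)

    ~-refl : ∀ {u} → u ~ u
    ~-refl {x , _} = subst Mem (sym (inverseˡ x)) ε∈

    ~-sym : ∀ {u w} → u ~ w → w ~ u
    ~-sym {x , _} {y , _} p = subst Mem (trans (⁻¹-anti-homo-∙ (x ⁻¹) y) (cong (y ⁻¹ ∙_) (⁻¹-involutive x))) (⁻¹∈ p)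

    ~-trans : ∀ {u v w} → u ~ v → v ~ w → u ~ w
    ~-trans {x , _} {y , _} {z , _} p q = subst Mem
      (trans (assoc (x ⁻¹) y (y ⁻¹ ∙ z)) (cong (x ⁻¹ ∙_) (\\-leftDividesˡ y z))) (∙∈ p q)

    ~-▷ : ∀ g {u w} → u ~ w → (g ▷ u) ~ (g ▷ w)
    ~-▷ g {x , _} {y , _} = subst Mem (sym (trans (cong (_∙ (g ∙ y)) (⁻¹-anti-homo-∙ g x))
      (trans (assoc (x ⁻¹) (g ⁻¹) (g ∙ y)) (cong (x ⁻¹ ∙_) (\\-leftDividesʳ g y)))))

    ~-◁ : ∀ u {h} → Mem h → u ~ (u ◁ h)
    ~-◁ (x , _) {h} = subst Mem (sym (\\-leftDividesʳ x h))

    ◁-~ : ∀ u {h} → u ~ (u ◁ h) → Mem h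
    ◁-~ (x , _) {h} = subst Mem (\\-leftDividesʳ x h)

    Co : V → V → Set
    Co u w = u ~ w × u ≢ w × ¬ E u w

    Co? : ∀ u w → Dec (Co u w)
    Co? u w = (u ~? w) ×-dec (¬? (u V.≟ w) ×-dec ¬? (E? u w))

  record Good : Set₁ where
    field rep : Rep
    open Rep rep public
    field
      two-step : ∀ u w → u ~ w → ∃ λ v → E u v × E v w
      non-arcs : ∀ u → ∃₂ λ v v′ → v ≢ v′ × Co u v × Co u v′

  -- Since complements are taken inside cosets, an automorphism of `Co` must be shown to keep the
  -- ends of an arc of `E` in one coset. A path of length two in `Co` between them does this: its
  -- image stays in a coset, and the image of the arc then cannot be an arc of `Co`, because `σ`
  -- reflects these. The two out-neighbours in `E` become the two non-neighbours required by `Good`.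
  complement : (R : Rep) → let open Rep R in
    (∀ u w → u ~ w → ∃ λ v → Co u v × Co v w) →
    (∀ u → ∃₂ λ v v′ → v ≢ v′ × E u v × E u v′) → Good
  complement R co-two arcs = record
    { rep = record
      { subgroup = subgroup ; E = Co ; E? = Co?
      ; E-▷ = λ g {u} {w} (p , u≢w , ¬e) → ~-▷ g {u} {w} p , (u≢w ∘ ▷-cancel g) ,
          (λ e → ¬e (subst₂ E (back g u) (back g w) (E-▷ (g ⁻¹) e)))
      ; E-irr = λ (_ , u≢u , _) → u≢u refl
      ; E-coset = proj₁
      -- `κ` is the number of vertices in a coset, all `m` orbits together; the vertex itself and
      -- its `deg` neighbours are removed.
      ; deg = κ ∸ (1 + deg)
      ; out-deg = λ u → sym (trans (cong (_∸ (1 + deg)) (trans (sym (coset-out u)) (split-out u))) (ℕ.m+n∸m≡n (1 + deg) _))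
      ; in-deg = λ w → sym (trans (cong (_∸ (1 + deg)) (trans (sym (coset-in w)) (split-in w))) (ℕ.m+n∸m≡n (1 + deg) _))
      ; rigid = λ A → rigid (record { σ = Aut.σ A ; τ = Aut.τ A ; σ-τ = Aut.σ-τ A ; τ-σ = Aut.τ-σ A
                                    ; σ-arc = preserves A ; τ-arc = preserves (inverse A) })
      }
    ; two-step = co-two
    ; non-arcs = λ u → let v , v′ , v≢v′ , e , e′ = arcs u in v , v′ , v≢v′ , co-co e , co-co e′
    }
    where
    open Rep R
    back : ∀ g u → g ⁻¹ ▷ (g ▷ u) ≡ u
    back g u = trans (▷-▷ (g ⁻¹) g u) (trans (cong (_▷ u) (inverseˡ g)) (ε▷ u))
    forth : ∀ g u → g ▷ (g ⁻¹ ▷ u) ≡ u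
    forth g u = trans (▷-▷ g (g ⁻¹) u) (trans (cong (_▷ u) (inverseʳ g)) (ε▷ u))
    ▷-cancel : ∀ g {u w} → g ▷ u ≡ g ▷ w → u ≡ w
    ▷-cancel g e = trans (sym (back g _)) (trans (cong (g ⁻¹ ▷_) e) (back g _))
    E-≢ : ∀ {u w} → E u w → u ≢ w
    E-≢ e refl = E-irr e
    co-co : ∀ {u w} → E u w → u ~ w × u ≢ w × ¬ Co u w
    co-co e = E-coset e , E-≢ e , λ (_ , _ , ¬e) → ¬e e
    κ : ℕ
    κ = V.size (λ w → Mem? (proj₁ w))
    coset-out : ∀ u → V.size (u ~?_) ≡ κ
    coset-out (x , _) = V.size-∘ (λ w → Mem? (proj₁ w)) (x ⁻¹ ▷_) (x ▷_) (back x) (forth x)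
    coset-in : ∀ w → V.size (_~? w) ≡ κ
    coset-in w = trans (V.size-⇔ (_~? w) (w ~?_) (λ u → ~-sym {u} {w}) (λ u → ~-sym {w} {u})) (coset-out w)
    split-out : ∀ u → V.size (u ~?_) ≡ 1 + deg + V.size (Co? u)
    split-out u = trans (V.size-⇔ (u ~?_) (λ w → ((u V.≟ w) ⊎-dec E? u w) ⊎-dec Co? u w)
        (λ w p → cases w p) (λ { w (inj₁ (inj₁ refl)) → ~-refl {u} ; w (inj₁ (inj₂ e)) → E-coset e ; w (inj₂ (p , _)) → p }))
      (trans (V.size-⊎ (λ w → (u V.≟ w) ⊎-dec E? u w) (Co? u)
          λ { w (inj₁ u≡w) (_ , u≢w , _) → u≢w u≡w ; w (inj₂ e) (_ , _ , ¬e) → ¬e e })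
        (cong (_+ V.size (Co? u)) (trans (V.size-⊎ (u V.≟_) (E? u) (λ w u≡w e → E-≢ e u≡w))
          (cong₂ _+_ (V.size-≟ u) (out-deg u)))))
      where
      cases : ∀ w → u ~ w → (u ≡ w ⊎ E u w) ⊎ Co u w
      cases w p with u V.≟ w | E? u w
      ... | yes e | _     = inj₁ (inj₁ e)
      ... | no _  | yes e = inj₁ (inj₂ e)
      ... | no ¬e | no ¬f = inj₂ (p , ¬e , ¬f)
    split-in : ∀ w → V.size (_~? w) ≡ 1 + deg + V.size (λ u → Co? u w)
    split-in w = trans (V.size-⇔ (_~? w) (λ u → ((w V.≟ u) ⊎-dec E? u w) ⊎-dec Co? u w)
        (λ u p → cases u p) (λ { u (inj₁ (inj₁ refl)) → ~-refl {u} ; u (inj₁ (inj₂ e)) → E-coset e ; u (inj₂ (p , _)) → p }))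
      (trans (V.size-⊎ (λ u → (w V.≟ u) ⊎-dec E? u w) (λ u → Co? u w)
          λ { u (inj₁ w≡u) (_ , u≢w , _) → u≢w (sym w≡u) ; u (inj₂ e) (_ , _ , ¬e) → ¬e e })
        (cong (_+ V.size (λ u → Co? u w)) (trans (V.size-⊎ (w V.≟_) (λ u → E? u w) (λ u w≡u e → E-≢ e (sym w≡u)))
          (cong₂ _+_ (V.size-≟ w) (in-deg w)))))
      where
      cases : ∀ u → u ~ w → (w ≡ u ⊎ E u w) ⊎ Co u w
      cases u p with w V.≟ u | E? u w
      ... | yes e | _     = inj₁ (inj₁ e)
      ... | no _  | yes e = inj₁ (inj₂ e)
      ... | no ¬e | no ¬f = inj₂ (p , (¬e ∘ sym) , ¬f)
    preserves : ∀ (A : Aut Co) {u w} → E u w → E (Aut.σ A u) (Aut.σ A w)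
    preserves A {u} {w} e = decidable-stable (E? _ _) λ ¬e →
      let v , uv , vw = co-two u w (E-coset e) in
      proj₂ (proj₂ (σ-reflects (~-trans {σ u} {σ v} {σ w} (proj₁ (σ-arc uv)) (proj₁ (σ-arc vw)) ,
                                E-≢ e ∘ σ-injective , ¬e))) e
      where open Aut A

  module Extend (𝓖 : Good) {a : Carrier} (a∉ : ¬ Good.Mem 𝓖 a) (i₀ : Fin m) where
    open Good 𝓖

    X? : Decidable (λ x → Mem x ⊎ x ≡ a)
    X? x = Mem? x ⊎-dec (x ≟ a)

    open Generated X? using (⟨X⟩; gen-X; gen-homogeneous)

    E′ : V → V → Set
    E′ u w = E u w ⊎ (u ◁ a ≡ w)

    ◁a-apart : ∀ u → ¬ E u (u ◁ a)
    ◁a-apart u e = a∉ (◁-~ u (E-coset e))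

    irr : ∀ {u} → ¬ E′ u u
    irr (inj₁ e) = E-irr e
    irr {x , i} (inj₂ e) = a∉ (subst Mem (sym (identityʳ-unique x a (,-injectiveˡ e))) ε∈)

    in-arc : ∀ u w → u ◁ a ≡ w → w ◁ a ⁻¹ ≡ u
    in-arc u w refl = ◁-◁⁻¹ u a

    in-arc⁻ : ∀ u w → w ◁ a ⁻¹ ≡ u → u ◁ a ≡ w
    in-arc⁻ u w refl = ◁⁻¹-◁ w a

    -- The arcs of E are recognised inside E′ as those which can be completed to a path of length two.
    path⇒E : ∀ {u v w} → E′ u v → E′ v w → E′ u w → E u w
    path⇒E _ _ (inj₁ e) = e
    path⇒E {u} {v} {w} (inj₁ uv) (inj₁ vw) (inj₂ refl) =
      contradiction (◁-~ u (~-trans {u} {v} {w} (E-coset uv) (E-coset vw))) a∉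
    path⇒E {u} {v} (inj₁ uv) (inj₂ e) (inj₂ refl) =
      contradiction (subst (E u) (trans (sym (◁-◁⁻¹ v a)) (trans (cong (_◁ a ⁻¹) e) (◁-◁⁻¹ u a))) uv) E-irr
    path⇒E (inj₂ refl) vw (inj₂ refl) = contradiction vw irr

    preserves : ∀ (A : Aut E′) {u w} → E u w → E (Aut.σ A u) (Aut.σ A w)
    preserves A {u} {w} e = let v , uv , vw = two-step u w (E-coset e) in
      path⇒E (σ-arc (inj₁ uv)) (σ-arc (inj₁ vw)) (σ-arc (inj₁ e))
      where open Aut A

    -- If an added arc were sent to an arc of `E`, the inverse automorphism would pull it back to an
    -- arc of `E`, but `a` lies outside the subgroup.
    preserves-◁ : ∀ (A : Aut E′) u → Aut.σ A (u ◁ a) ≡ Aut.σ A u ◁ a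
    preserves-◁ A u with Aut.σ-arc A {u} {u ◁ a} (inj₂ refl)
    ... | inj₂ e = sym e
    ... | inj₁ e = contradiction
      (subst₂ E (Aut.τ-σ A u) (Aut.τ-σ A (u ◁ a)) (preserves (inverse A) e)) (◁a-apart u)

    rep′ : Rep
    rep′ = record
      { subgroup = ⟨X⟩
      ; E = E′
      ; E? = E′?
      ; E-▷ = λ { g (inj₁ e) → inj₁ (E-▷ g e)
                ; g {u} (inj₂ refl) → inj₂ (cong (_, proj₂ u) (assoc g (proj₁ u) a)) }
      ; E-irr = irr
      ; E-coset = λ { (inj₁ e) → gen-X (inj₁ (E-coset e))
                    ; {u} (inj₂ refl) → gen-X (inj₂ (\\-leftDividesʳ (proj₁ u) a)) }
      ; deg = deg + 1
      ; out-deg = λ u → trans (V.size-⊎ (E? u) (u ◁ a V.≟_) (λ { _ e refl → ◁a-apart u e }))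
          (cong₂ _+_ (out-deg u) (V.size-≟ (u ◁ a)))
      ; in-deg = λ w → trans (V.size-⊎ (λ u → E? u w) (λ u → u ◁ a V.≟ w) (λ { u e refl → ◁a-apart u e }))
          (cong₂ _+_ (in-deg w) (trans (V.size-⇔ (λ u → u ◁ a V.≟ w) (w ◁ a ⁻¹ V.≟_)
             (λ u → in-arc u w) (λ u → in-arc⁻ u w)) (V.size-≟ (w ◁ a ⁻¹))))
      ; rigid = rigid′
      }
      where
      E′? : ∀ u w → Dec (E′ u w)
      E′? u w = E? u w ⊎-dec (u ◁ a V.≟ w)
      rigid′ : (A : Aut E′) → ∃ λ (f : Carrier → Carrier) →
               (∀ x i → Aut.σ A (x , i) ≡ (f x , i)) ×
               (∀ x {h} → Subgroup.Mem ⟨X⟩ h → f (x ∙ h) ≡ f x ∙ h)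
      rigid′ A with rigid (record { σ = σ ; τ = τ ; σ-τ = σ-τ ; τ-σ = τ-σ
                                  ; σ-arc = preserves A ; τ-arc = preserves (inverse A) })
        where open Aut A
      ... | f , σ≡f , f-hom = f , σ≡f , gen-homogeneous f λ
        { x h (inj₁ h∈) → f-hom x h∈
        ; x _ (inj₂ refl) → ,-injectiveˡ (trans (sym (σ≡f (x ∙ a) i₀))
            (trans (preserves-◁ A (x , i₀)) (cong (_◁ a) (σ≡f x i₀)))) }

    module R′ = Rep rep′

    ~⇒~′ : ∀ u w → u ~ w → u R′.~ w
    ~⇒~′ u w p = gen-X (inj₁ p)

    ◁a-~′ : ∀ u → u R′.~ u ◁ a
    ◁a-~′ u = R′.~-◁ u (gen-X (inj₂ refl))

    co-inside : ∀ {u v} → Co u v → R′.Co u v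
    co-inside {u} {v} (p , u≢v , ¬e) = ~⇒~′ u v p , u≢v , λ
      { (inj₁ e) → ¬e e ; (inj₂ refl) → a∉ (◁-~ u p) }

    co-across : ∀ {u v} → u R′.~ v → ¬ u ~ v → u ◁ a ≢ v → R′.Co u v
    co-across {u} p ¬q ne = p , (λ { refl → ¬q (~-refl {u}) }) , λ
      { (inj₁ e) → ¬q (E-coset e) ; (inj₂ e) → ne e }

    -- This is the reason for two non-neighbours in `Good`: one of them survives when a single
    -- vertex is forbidden.
    choose : ∀ u (z : V) → ∃ λ v → Co u v × v ≢ z
    choose u z with non-arcs u
    ... | v , v′ , v≢v′ , c , c′ with v V.≟ z
    ...   | yes refl = v′ , c′ , v≢v′ ∘ sym
    ...   | no v≢z   = v , c , v≢z

    -- If `w` is outside the old coset of `u`, the midpoint is a non-neighbour of `u` inside that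
    -- coset, different from the one vertex whose added arc ends at `w`. If `w` is inside, the
    -- midpoint is `v ◁ a`, in another old coset: `u ≢ v` rules out the added arc from `u` to it,
    -- and `v ≢ w ◁ a ⁻¹ ◁ a ⁻¹` the one from it to `w`.
    co-two : ∀ u w → u R′.~ w → ∃ λ v → R′.Co u v × R′.Co v w
    co-two u w p with u ~? w
    ... | no ¬q = let v , c , v≢ = choose u (w ◁ a ⁻¹) in
      v , co-inside c ,
      co-across (R′.~-trans {v} {u} {w} (R′.~-sym {u} {v} (~⇒~′ u v (proj₁ c))) p)
        (λ q → ¬q (~-trans {u} {v} {w} (proj₁ c) q))
        (v≢ ∘ sym ∘ in-arc v w)
    ... | yes q = let v , (r , u≢v , _) , v≢ = choose u (w ◁ a ⁻¹ ◁ a ⁻¹)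
                      ~va = R′.~-trans {u} {v} {v ◁ a} (~⇒~′ u v r) (◁a-~′ v)
                      ≁va = λ s → a∉ (◁-~ v (~-trans {v} {u} {v ◁ a} (~-sym {u} {v} r) s)) in
      v ◁ a ,
      co-across ~va ≁va (λ e → u≢v (trans (sym (◁-◁⁻¹ u a)) (trans (cong (_◁ a ⁻¹) e) (◁-◁⁻¹ v a)))) ,
      co-across (R′.~-trans {v ◁ a} {u} {w} (R′.~-sym {u} {v ◁ a} ~va) p)
        (λ s → ≁va (~-trans {u} {w} {v ◁ a} q (~-sym {v ◁ a} {w} s)))
        (λ e → v≢ (sym (in-arc v _ (sym (in-arc (v ◁ a) w e)))))

    extended : Good
    extended = complement rep′ co-two λ u →
      -- A closed path of length two at `u` supplies an old out-neighbour, the added arc the second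
      -- one.
      let v , uv , _ = two-step u u (~-refl {u}) in
      v , u ◁ a , (λ e → ◁a-apart u (subst (E u) e uv)) , inj₁ uv , inj₂ refl

  adjoin : Fin m → (𝓖 : Good) (a : Carrier) →
           ∃ λ 𝓖′ → (∀ {x} → Good.Mem 𝓖 x → Good.Mem 𝓖′ x) × Good.Mem 𝓖′ a
  adjoin i₀ 𝓖 a with Good.Mem? 𝓖 a
  ... | yes a∈ = 𝓖 , id , a∈
  ... | no a∉  = extended , gen-X ∘ inj₁ , gen-X (inj₂ refl)
    where
    open Extend 𝓖 a∉ i₀
    open Generated X? using (gen-X)

  adjoin-all : Fin m → (𝓖 : Good) (xs : List Carrier) →
               ∃ λ 𝓖′ → (∀ {x} → Good.Mem 𝓖 x → Good.Mem 𝓖′ x) × (∀ {x} → x ∈ xs → Good.Mem 𝓖′ x)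
  adjoin-all i₀ 𝓖 []       = 𝓖 , id , λ ()
  adjoin-all i₀ 𝓖 (a ∷ xs) with adjoin i₀ 𝓖 a
  ... | 𝓖₁ , inc , a∈ with adjoin-all i₀ 𝓖₁ xs
  ...   | 𝓖₂ , inc′ , xs∈ = 𝓖₂ , inc′ ∘ inc , λ { (here refl) → inc′ a∈ ; (there p) → xs∈ p }

  -- For a full subgroup the last clause of `rigid` at `ε` reads `f x ≡ f ε ∙ x`, so each
  -- automorphism is left multiplication by `f ε`. The orbit `i₀` makes the action faithful.
  rep⇒DRR : Fin m → (R : Rep) → (∀ x → Rep.Mem R x) → HasDRR m G
  rep⇒DRR i₀ R full = order * m , Γ , ρ , record
    { regular = deg , λ i → out-deg (from i) , in-deg (from i)
    ; hom-∙ = λ g h i → cong to (sym (trans (cong (g ▷_) (strictlyInverseʳ _)) (▷-▷ g h (from i))))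
    ; hom-ε = λ i → trans (cong to (ε▷ (from i))) (strictlyInverseˡ i)
    ; faithful = λ g h e → ∙-cancelʳ ε g h (,-injectiveˡ (trans (sym (from-ρ g (ε , i₀)))
        (trans (cong from (e (to (ε , i₀)))) (from-ρ h (ε , i₀)))))
    ; ρ-aut = λ g i j → trans (cong₂ (λ u w → does (E? u w)) (strictlyInverseʳ _) (strictlyInverseʳ _))
        (V.does-⇔ (E? (g ▷ from i) (g ▷ from j)) (E? (from i) (from j))
           (λ e → subst₂ E (back g (from i)) (back g (from j)) (E-▷ (g ⁻¹) e)) (E-▷ g))
    ; aut-ρ = aut-ρ
    ; semiregular = λ g i e → identityˡ-unique g _
        (,-injectiveˡ (trans (sym (strictlyInverseʳ (g ▷ from i))) (cong from e)))
    ; rep = λ i → to (ε , i)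
    ; rep-covers = λ k → proj₂ (from k) , proj₁ (from k) ,
        trans (cong (λ u → to (proj₁ (from k) ▷ u)) (strictlyInverseʳ _))
          (trans (cong (λ x → to (x , proj₂ (from k))) (identityʳ _)) (strictlyInverseˡ k))
    ; rep-distinct = λ i j g e → ,-injectiveʳ (trans (sym (from-ρ g (ε , i)))
        (trans (cong from e) (strictlyInverseʳ (ε , j))))
    }
    where
    open Rep R
    open Inverse V↔Fin using (to; from; strictlyInverseˡ; strictlyInverseʳ)
    back : ∀ g u → g ⁻¹ ▷ (g ▷ u) ≡ u
    back g u = trans (▷-▷ (g ⁻¹) g u) (trans (cong (_▷ u) (inverseˡ g)) (ε▷ u))
    Γ : Digraph (order * m)
    Γ = record { arc = λ i j → does (E? (from i) (from j)) ; noLoop = λ i → dec-false (E? (from i) (from i)) E-irr }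
    ρ : Carrier → Fin (order * m) → Fin (order * m)
    ρ g i = to (g ▷ from i)
    from-ρ : ∀ g u → from (ρ g (to u)) ≡ g ▷ u
    from-ρ g u = trans (strictlyInverseʳ _) (cong (g ▷_) (strictlyInverseʳ u))
    does⇒ : ∀ {P Q : Set} (p : Dec P) (q : Dec Q) → does p ≡ does q → P → Q
    does⇒ (yes p) (yes q) _ _ = q
    does⇒ (no ¬p) _ _ p = contradiction p ¬p
    aut-ρ : ∀ (π : Permutation′ (order * m)) → IsAut Γ π → ∃[ g ] (∀ i → π ⟨$⟩ʳ i ≡ ρ g i)
    aut-ρ π π-aut with rigid (record
        { σ = σ ; τ = τ
        ; σ-τ = λ u → trans (cong (from ∘ (π ⟨$⟩ʳ_)) (strictlyInverseˡ _)) (trans (cong from (Perm.inverseʳ π)) (strictlyInverseʳ u))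
        ; τ-σ = λ u → trans (cong (from ∘ (π ⟨$⟩ˡ_)) (strictlyInverseˡ _)) (trans (cong from (Perm.inverseˡ π)) (strictlyInverseʳ u))
        ; σ-arc = λ {u} {w} e → does⇒ (E? _ _) (E? _ _) (sym (π-aut (to u) (to w)))
                    (subst₂ E (sym (strictlyInverseʳ u)) (sym (strictlyInverseʳ w)) e)
        ; τ-arc = λ {u} {w} e → does⇒ (E? _ _) (E? _ _) (π-aut (π ⟨$⟩ˡ to u) (π ⟨$⟩ˡ to w))
                    (subst₂ (λ i j → E (from i) (from j)) (sym (Perm.inverseʳ π)) (sym (Perm.inverseʳ π))
                      (subst₂ E (sym (strictlyInverseʳ u)) (sym (strictlyInverseʳ w)) e)) })
      where
      σ τ : V → V
      σ u = from (π ⟨$⟩ʳ to u)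
      τ u = from (π ⟨$⟩ˡ to u)
    ... | f , σ≡f , f-hom = f ε , λ i →
      let x = proj₁ (from i) ; k = proj₂ (from i) in
      trans (sym (strictlyInverseˡ _)) (cong to (trans (cong (from ∘ (π ⟨$⟩ʳ_)) (sym (strictlyInverseˡ i)))
        (trans (σ≡f x k) (cong (_, k) (trans (cong f (sym (identityˡ x))) (f-hom ε (full x)))))))

  good⇒DRR : Fin m → Good → HasDRR m G
  good⇒DRR i₀ 𝓖 =
    let 𝓖′ , _ , all∈ = adjoin-all i₀ 𝓖 (List.tabulate from) in
    rep⇒DRR i₀ (Good.rep 𝓖′) λ x →
      subst (Good.Mem 𝓖′) (strictlyInverseʳ x) (all∈ (∈-tabulate⁺ (to x)))
    where open Inverse enum using (to; from; strictlyInverseʳ)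

-- Voltage graphs: G-invariant digraphs which are unions of d permutations of G × Fin m

module VoltageGraphs (G : FinGroup) (m : ℕ) where
  open GroupTheory G
  open Representations G m

  record Voltage (d : ℕ) : Set where
    field
      π π⁻     : Fin d → Fin m → Fin m
      π-π⁻     : ∀ k i → π k (π⁻ k i) ≡ i
      π⁻-π     : ∀ k i → π⁻ k (π k i) ≡ i
      s        : Fin d → Fin m → Carrier
      loopless : ∀ k i → π k i ≡ i → s k i ≢ ε
      simple   : ∀ k l i → π k i ≡ π l i → s k i ≡ s l i → k ≡ l

    step step⁻ : Fin d → V → V
    step  k (x , i) = x ∙ s k i , π k i
    step⁻ k (y , j) = y ∙ s k (π⁻ k j) ⁻¹ , π⁻ k j

    step-step⁻ : ∀ k u → step k (step⁻ k u) ≡ u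
    step-step⁻ k (y , j) = cong₂ _,_ (//-rightDividesˡ (s k (π⁻ k j)) y) (π-π⁻ k j)

    step⁻-step : ∀ k u → step⁻ k (step k u) ≡ u
    step⁻-step k (x , i) = cong₂ _,_
      (trans (cong (λ j → x ∙ s k i ∙ s k j ⁻¹) (π⁻-π k i)) (//-rightDividesʳ (s k i) x)) (π⁻-π k i)

    step-injective : ∀ {k l u} → step k u ≡ step l u → k ≡ l
    step-injective {k} {l} {x , i} e = simple k l i (,-injectiveʳ e) (∙-cancelˡ x _ _ (,-injectiveˡ e))

    step⁻-injective : ∀ {k l w} → step⁻ k w ≡ step⁻ l w → k ≡ l
    step⁻-injective {k} {l} {w} e = step-injective {k} {l} {step⁻ k w}
      (trans (step-step⁻ k w) (trans (sym (step-step⁻ l w)) (cong (step l) (sym e))))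

    Arc : V → V → Set
    Arc u w = ∃ λ k → step k u ≡ w

    IsVoltage : Carrier → Set
    IsVoltage x = ∃₂ λ k i → s k i ≡ x

    isVoltage? : ∀ x → Dec (IsVoltage x)
    isVoltage? x = Fin.any? λ k → Fin.any? λ i → s k i ≟ x

    open Generated isVoltage? public

    -- A sufficient condition for rigidity: the second clause lets one map of the group serve every
    -- orbit, the third yields homogeneity under each voltage.
    LabelPreserving : Aut Arc → Set
    LabelPreserving A = (∀ u → proj₂ (σ u) ≡ proj₂ u) ×
                        (∀ x i j → proj₁ (σ (x , i)) ≡ proj₁ (σ (x , j))) ×
                        (∀ k u → σ (step k u) ≡ step k (σ u))
      where open Aut A

    voltageRep : Fin m → ((A : Aut Arc) → LabelPreserving A) → Rep
    voltageRep i₀ labels = record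
      { subgroup = ⟨X⟩
      ; E = Arc
      ; E? = λ u w → Fin.any? (λ k → step k u V.≟ w)
      ; E-▷ = λ { g {u} (k , refl) → k , cong (_, π k (proj₂ u)) (assoc g (proj₁ u) (s k (proj₂ u))) }
      ; E-irr = λ { {x , i} (k , e) → loopless k i (,-injectiveʳ e) (identityʳ-unique x _ (,-injectiveˡ e)) }
      ; E-coset = λ { {x , i} (k , refl) → subst Gen (sym (\\-leftDividesʳ x (s k i))) (gen-X (k , i , refl)) }
      ; deg = d
      ; out-deg = λ u → V.size-image (λ k → step k u) step-injective
      ; in-deg = λ w → trans (V.size-⇔ (λ u → Fin.any? (λ k → step k u V.≟ w)) (λ u → Fin.any? (λ k → step⁻ k w V.≟ u))
            (λ { u (k , refl) → k , step⁻-step k u }) (λ { u (k , refl) → k , step-step⁻ k w }))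
          (V.size-image (λ k → step⁻ k w) step⁻-injective)
      ; rigid = λ A → let open Aut A ; orbit , base , comm = labels A ; f = λ x → proj₁ (σ (x , i₀)) in
          f , (λ x i → cong₂ _,_ (base x i i₀) (orbit (x , i))) ,
          gen-homogeneous f λ { x _ (k , i , refl) →
            trans (base (x ∙ s k i) i₀ (π k i)) (trans (,-injectiveˡ (comm k (x , i)))
              (cong₂ (λ y j → y ∙ s k j) (base x i i₀) (orbit (x , i)))) }
      }

    OrbitPreserving : Set
    OrbitPreserving = (A : Aut Arc) → ∀ u → proj₂ (Aut.σ A u) ≡ proj₂ u

    -- At a given orbit the `π k` take distinct values, so the label of an arc can be read off from
    -- the orbits of its ends. The premise about `f` expresses, without mentioning paths, that arcs
    -- of voltage `ε` connect each `{x} × Fin m`: whatever is constant along them is constant there.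
    orbits⇒labels : (∀ k l i → π k i ≡ π l i → k ≡ l) → OrbitPreserving →
      (∀ (f : V → Carrier) → (∀ k x i → s k i ≡ ε → f (x , π k i) ≡ f (x , i)) → ∀ x i j → f (x , i) ≡ f (x , j)) →
      (A : Aut Arc) → LabelPreserving A
    orbits⇒labels π-distinct orbit connected A = orbit A , connected (proj₁ ∘ σ) flat , comm
      where
      open Aut A
      comm : ∀ k u → σ (step k u) ≡ step k (σ u)
      comm k u with σ-arc {u} {step k u} (k , refl)
      ... | l , e with π-distinct l k (proj₂ u) (trans (cong (π l) (sym (orbit A u))) (trans (,-injectiveʳ e) (orbit A (step k u))))
      ...   | refl = sym e
      flat : ∀ k x i → s k i ≡ ε → proj₁ (σ (x , π k i)) ≡ proj₁ (σ (x , i))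
      flat k x i e = trans (cong (λ y → proj₁ (σ (y , π k i))) (sym (trans (cong (x ∙_) e) (identityʳ x))))
        (trans (,-injectiveˡ (comm k (x , i))) (trans (cong (λ j → proj₁ (σ (x , i)) ∙ s k j) (orbit A (x , i)))
          (trans (cong (proj₁ (σ (x , i)) ∙_) e) (identityʳ _))))

    Two : V → V → Set
    Two u w = Arc u w × Arc w u

    two-σ : (A : Aut Arc) → ∀ {u w} → Two u w → Two (Aut.σ A u) (Aut.σ A w)
    two-σ A (p , q) = Aut.σ-arc A p , Aut.σ-arc A q

    -- `P` ranges over all automorphisms so that it applies to `inverse A`: an orbit preserved by
    -- all of them receives nothing from outside.
    excluded-orbit : (A : Aut Arc) {u : V} {j : Fin m} → (∀ (B : Aut Arc) x → proj₂ (Aut.σ B (x , j)) ≡ j) →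
                     proj₂ (Aut.σ A u) ≡ j → proj₂ u ≡ j
    excluded-orbit A {u} {j} P e = trans (cong proj₂ (sym (Aut.τ-σ A u)))
      (trans (cong (λ i → proj₂ (Aut.τ A (proj₁ (Aut.σ A u) , i))) e) (P (inverse A) _))

    -- A midpoint in the complement has to avoid `u`, `w`, the `d` out-neighbours of `u` and the `d`
    -- in-neighbours of `w`. The map `h` exhibits just `n` members of the subgroup, so the order of
    -- the subgroup is never computed.
    sparse-good : ∀ {n} (i₀ : Fin m) (labels : (A : Aut Arc) → LabelPreserving A) (k l : Fin d) → k ≢ l →
                  (h : Fin n → Carrier) → Injective _≡_ _≡_ h → (∀ i → Gen (h i)) →
                  2 + (d + d) < n * m → Good
    sparse-good {n} i₀ labels k l k≢l h h-inj h∈ lt = complement R two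
      λ u → step k u , step l u , k≢l ∘ step-injective , (k , refl) , (l , refl)
      where
      R : Rep
      R = voltageRep i₀ labels
      open Rep R using (_~_; ~-sym; ~-trans; ~-◁; Co)
      two : ∀ u w → u ~ w → ∃ λ v → Co u v × Co v w
      two u@(x , _) w p = v , (u~v , (λ e → avoid (here (sym e))) , λ (j , e) →
                                 avoid (there (there (∈-++⁺ˡ (subst (_∈ List.tabulate (λ k → step k u)) e (∈-tabulate⁺ j)))))) ,
          (~-trans {v} {u} {w} (~-sym {u} {v} u~v) p , (λ e → avoid (there (here e))) , λ { (j , e) →
             avoid (there (there (∈-++⁺ʳ (List.tabulate (λ k → step k u))
               (subst (_∈ List.tabulate (λ k → step⁻ k w)) (trans (cong (step⁻ j) (sym e)) (step⁻-step j v)) (∈-tabulate⁺ j))))) })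
        where
        excluded : List V
        excluded = u ∷ w ∷ List.tabulate (λ k → step k u) ++ List.tabulate (λ k → step⁻ k w)
        candidate : Fin (n * m) → V
        candidate c = x ∙ h (proj₁ (remQuot {n} m c)) , proj₂ (remQuot {n} m c)
        candidate-injective : Injective _≡_ _≡_ candidate
        candidate-injective {c} {c′} e = trans (sym (Fin.combine-remQuot {n} m c)) (trans
          (cong₂ combine (h-inj (∙-cancelˡ x _ _ (,-injectiveˡ e))) (,-injectiveʳ e))
          (Fin.combine-remQuot {n} m c′))
        len : length excluded ≡ 2 + (d + d)
        len = cong (2 +_) (trans (length-++ (List.tabulate (λ k → step k u)))
          (cong₂ _+_ (length-tabulate (λ k → step k u)) (length-tabulate (λ k → step⁻ k w))))
        found = V.pigeonhole candidate candidate-injective excluded (subst (_< n * m) (sym len) lt)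
        v : V
        v = candidate (proj₁ found)
        avoid = proj₂ found
        u~v : u ~ v
        u~v = subst Gen (sym (\\-leftDividesʳ x _)) (h∈ _)

-- Two orbits

module TwoOrbits (G : FinGroup) {a b : FinGroup.Carrier G}
    (a≢ε : a ≢ FinGroup.ε G) (b≢ε : b ≢ FinGroup.ε G) (a≢b : a ≢ b) where
  open GroupTheory G
  open Representations G 2
  open VoltageGraphs G 2

  flip : Fin 2 → Fin 2 → Fin 2
  flip 0F i  = i
  flip 1F 0F = 1F
  flip 1F 1F = 0F

  flip-flip : ∀ k i → flip k (flip k i) ≡ i
  flip-flip 0F i  = refl
  flip-flip 1F 0F = refl
  flip-flip 1F 1F = refl

  flip-distinct : ∀ k l i → flip k i ≡ flip l i → k ≡ l
  flip-distinct 0F 0F _  _ = refl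
  flip-distinct 1F 1F _  _ = refl
  flip-distinct 0F 1F 0F ()
  flip-distinct 0F 1F 1F ()
  flip-distinct 1F 0F 0F ()
  flip-distinct 1F 0F 1F ()

  voltage : Fin 2 → Fin 2 → Carrier
  voltage 0F 0F = a
  voltage 0F 1F = b
  voltage 1F 0F = ε
  voltage 1F 1F = a

  𝓥 : Voltage 2
  𝓥 = record
    { π = flip ; π⁻ = flip ; π-π⁻ = flip-flip ; π⁻-π = flip-flip ; s = voltage
    ; loopless = λ { 0F 0F _ → a≢ε ; 0F 1F _ → b≢ε ; 1F 0F () ; 1F 1F () }
    ; simple = λ k l i e _ → flip-distinct k l i e
    }

  open Voltage 𝓥

  -- A transitive triangle with source `u`. From `(x , 0F)` the path through `(x , 1F)` reaches
  -- `(x ∙ a , 0F)`, which the arc inside orbit 0 reaches directly; from orbit 1 any such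
  -- coincidence would force `a ≡ ε`, `b ≡ ε` or `a ≡ b`.
  Shortcut : V → Set
  Shortcut u = ∃₂ λ v w → Arc u v × Arc v w × Arc u w

  shortcut : ∀ x → Shortcut (x , 0F)
  shortcut x = (x ∙ ε , 1F) , (x ∙ a , 0F) , (1F , refl) , (1F , cong (λ y → y ∙ a , 0F) (identityʳ x)) , (0F , refl)

  no-shortcut : ∀ x → ¬ Shortcut (x , 1F)
  no-shortcut x (_ , _ , (0F , refl) , (0F , refl) , (0F , e)) =
    b≢ε (identityʳ-unique (x ∙ b) b (sym (,-injectiveˡ e)))
  no-shortcut x (_ , _ , (0F , refl) , (0F , refl) , (1F , ()))
  no-shortcut x (_ , _ , (0F , refl) , (1F , refl) , (0F , ()))
  no-shortcut x (_ , _ , (0F , refl) , (1F , refl) , (1F , e)) =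
    b≢ε (identityʳ-unique x b (sym (∙-cancelʳ a _ _ (,-injectiveˡ e))))
  no-shortcut x (_ , _ , (1F , refl) , (0F , refl) , (0F , ()))
  no-shortcut x (_ , _ , (1F , refl) , (0F , refl) , (1F , e)) =
    a≢ε (identityʳ-unique (x ∙ a) a (sym (,-injectiveˡ e)))
  no-shortcut x (_ , _ , (1F , refl) , (1F , refl) , (0F , e)) =
    a≢b (sym (∙-cancelˡ x b a (trans (,-injectiveˡ e) (identityʳ (x ∙ a)))))
  no-shortcut x (_ , _ , (1F , refl) , (1F , refl) , (1F , ()))

  shortcut-σ : (A : Aut Arc) → ∀ {u} → Shortcut u → Shortcut (Aut.σ A u)
  shortcut-σ A (v , w , p , q , r) = σ v , σ w , σ-arc p , σ-arc q , σ-arc r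
    where open Aut A

  orbit-0 : (A : Aut Arc) → ∀ x → proj₂ (Aut.σ A (x , 0F)) ≡ 0F
  orbit-0 A x with Aut.σ A (x , 0F) | shortcut-σ A (shortcut x)
  ... | y , 0F | _ = refl
  ... | y , 1F | p = contradiction p (no-shortcut y)

  orbits : OrbitPreserving
  orbits A (x , 0F) = orbit-0 A x
  orbits A (x , 1F) with proj₂ (Aut.σ A (x , 1F)) in eq
  ... | 0F = contradiction (excluded-orbit A {x , 1F} {0F} orbit-0 eq) λ ()
  ... | 1F = refl

  labels : (A : Aut Arc) → LabelPreserving A
  labels = orbits⇒labels flip-distinct orbits λ
    { f flat x 0F 0F → refl
    ; f flat x 0F 1F → sym (flat 1F x 0F refl)
    ; f flat x 1F 0F → flat 1F x 0F refl
    ; f flat x 1F 1F → refl }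

-- Three orbits

module ThreeOrbits (G : FinGroup) {a b : FinGroup.Carrier G}
    (a≢ε : a ≢ FinGroup.ε G) (b≢ε : b ≢ FinGroup.ε G) (a≢b : a ≢ b)
    (a²≡ε : FinGroup._∙_ G a a ≡ FinGroup.ε G) where
  open GroupTheory G
  open Representations G 3
  open VoltageGraphs G 3

  turn : Fin 2 → Fin 3 → Fin 3
  turn 0F 0F = 1F
  turn 0F 1F = 2F
  turn 0F 2F = 0F
  turn 1F 0F = 2F
  turn 1F 1F = 0F
  turn 1F 2F = 1F

  turn⁻ : Fin 2 → Fin 3 → Fin 3
  turn⁻ 0F = turn 1F
  turn⁻ 1F = turn 0F

  -- Chosen so that the only two-way arcs are those between `(x , 1F)` and `(x , 2F)`. The
  -- construction serves groups of exponent two, where a single involution on three orbits gives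
  -- only six vertices and so fails the counting bound.
  voltage : Fin 2 → Fin 3 → Carrier
  voltage 0F 2F = b
  voltage 1F 0F = a
  voltage 1F 1F = a
  voltage _  _  = ε

  turn-distinct : ∀ k l i → turn k i ≡ turn l i → k ≡ l
  turn-distinct 0F 0F _  _ = refl
  turn-distinct 1F 1F _  _ = refl
  turn-distinct 0F 1F 0F ()
  turn-distinct 0F 1F 1F ()
  turn-distinct 0F 1F 2F ()
  turn-distinct 1F 0F 0F ()
  turn-distinct 1F 0F 1F ()
  turn-distinct 1F 0F 2F ()

  𝓥 : Voltage 2
  𝓥 = record
    { π = turn ; π⁻ = turn⁻
    ; π-π⁻ = λ { 0F 0F → refl ; 0F 1F → refl ; 0F 2F → refl ; 1F 0F → refl ; 1F 1F → refl ; 1F 2F → refl }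
    ; π⁻-π = λ { 0F 0F → refl ; 0F 1F → refl ; 0F 2F → refl ; 1F 0F → refl ; 1F 1F → refl ; 1F 2F → refl }
    ; s = voltage
    ; loopless = λ { 0F 0F () ; 0F 1F () ; 0F 2F () ; 1F 0F () ; 1F 1F () ; 1F 2F () }
    ; simple = λ k l i e _ → turn-distinct k l i e
    }

  open Voltage 𝓥

  HasTwo : V → Set
  HasTwo u = ∃ λ v → Two u v

  ab≢ε : ∀ x → x ∙ a ∙ b ≢ x
  ab≢ε x e = a≢b (∙-cancelˡ a a b (trans a²≡ε (sym (identityʳ-unique x (a ∙ b) (trans (sym (assoc x a b)) e)))))

  no-two : ∀ x → ¬ HasTwo (x , 0F)
  no-two x (_ , (0F , refl) , (0F , ()))
  no-two x (_ , (0F , refl) , (1F , e)) = a≢ε (identityʳ-unique (x ∙ ε) a (trans (,-injectiveˡ e) (sym (identityʳ x))))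
  no-two x (_ , (1F , refl) , (0F , e)) = ab≢ε x (,-injectiveˡ e)
  no-two x (_ , (1F , refl) , (1F , ()))

  two-12 : ∀ x → Two (x , 1F) (x , 2F)
  two-12 x = (0F , cong (_, 2F) (identityʳ x)) , (1F , cong (_, 1F) (identityʳ x))

  orbit-≢0 : (A : Aut Arc) → ∀ u → HasTwo u → proj₂ (Aut.σ A u) ≢ 0F
  orbit-≢0 A u (v , t) e = no-two (proj₁ (σ u)) (σ v , subst (λ i → Two (proj₁ (σ u) , i) (σ v)) e (two-σ A t))
    where open Aut A

  orbit-0 : (A : Aut Arc) → ∀ x → proj₂ (Aut.σ A (x , 0F)) ≡ 0F
  orbit-0 A x with Aut.σ A (x , 0F) in eq
  ... | y , 0F = refl
  ... | y , 1F = contradiction (cong proj₂ (trans (cong τ (sym eq)) (τ-σ _))) (orbit-≢0 (inverse A) (y , 1F) (_ , two-12 y))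
    where open Aut A
  ... | y , 2F = contradiction (cong proj₂ (trans (cong τ (sym eq)) (τ-σ _)))
                   (orbit-≢0 (inverse A) (y , 2F) (_ , proj₂ (two-12 y) , proj₁ (two-12 y)))
    where open Aut A

  -- This separates the two ends of a two-way arc. Starting at `(x , 2F)`, the way back through
  -- orbit 0 carries voltage `a ∙ a`, which is trivial; starting at `(x , 1F)` it carries `b`.
  Triangle : V → Set
  Triangle u = ∃₂ λ v w → Two u v × Arc v w × Arc w u

  triangle : ∀ x → Triangle (x , 2F)
  triangle x = (x , 1F) , (x ∙ a , 0F) , (proj₂ (two-12 x) , proj₁ (two-12 x)) , (1F , refl) ,
    (1F , cong (_, 2F) (trans (assoc x a a) (trans (cong (x ∙_) a²≡ε) (identityʳ x))))

  no-triangle : ∀ x → ¬ Triangle (x , 1F)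
  no-triangle x (_ , _ , ((1F , refl) , t) , _) = no-two (x ∙ a) ((x , 1F) , t , (1F , refl))
  no-triangle x (_ , _ , ((0F , refl) , _) , (0F , refl) , (0F , e)) =
    b≢ε (identityʳ-unique x b (trans (cong (_∙ b) (sym (identityʳ x))) (trans (sym (identityʳ _)) (,-injectiveˡ e))))
  no-triangle x (_ , _ , ((0F , refl) , _) , (0F , refl) , (1F , ()))
  no-triangle x (_ , _ , ((0F , refl) , _) , (1F , refl) , (0F , ()))
  no-triangle x (_ , _ , ((0F , refl) , _) , (1F , refl) , (1F , ()))

  orbit-2 : (A : Aut Arc) → ∀ x → proj₂ (Aut.σ A (x , 2F)) ≡ 2F
  orbit-2 A x with proj₂ (Aut.σ A (x , 2F)) in eq
  ... | 0F = contradiction eq (orbit-≢0 A (x , 2F) (_ , proj₂ (two-12 x) , proj₁ (two-12 x)))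
  ... | 2F = refl
  ... | 1F = let v , w , t , p , q = triangle x in
    contradiction (subst (λ i → Triangle (proj₁ (σ (x , 2F)) , i)) eq
      (σ v , σ w , two-σ A {x , 2F} {v} t , σ-arc {v} {w} p , σ-arc {w} {x , 2F} q)) (no-triangle _)
    where open Aut A

  orbits : OrbitPreserving
  orbits A (x , 0F) = orbit-0 A x
  orbits A (x , 1F) with proj₂ (Aut.σ A (x , 1F)) in eq
  ... | 0F = contradiction (excluded-orbit A {x , 1F} orbit-0 eq) λ ()
  ... | 1F = refl
  ... | 2F = contradiction (excluded-orbit A {x , 1F} orbit-2 eq) λ ()
  orbits A (x , 2F) = orbit-2 A x

  labels : (A : Aut Arc) → LabelPreserving A
  labels = orbits⇒labels turn-distinct orbits λ f flat x i j → trans (base f flat x i) (sym (base f flat x j))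
    where
    base : ∀ (f : V → Carrier) → (∀ k x i → voltage k i ≡ ε → f (x , turn k i) ≡ f (x , i)) →
           ∀ x i → f (x , i) ≡ f (x , 0F)
    base f flat x 0F = refl
    base f flat x 1F = flat 0F x 0F refl
    base f flat x 2F = trans (flat 0F x 1F refl) (flat 0F x 0F refl)

-- Cyclic arrangements of orbits

next prev : ∀ {N} → Fin (suc N) → Fin (suc N)
next i with view i
... | ‵fromℕ         = zero
... | ‵inj₁ {i = j} _ = suc j
prev zero    = fromℕ _
prev (suc j) = inject₁ j

next-fromℕ : ∀ N → next (fromℕ N) ≡ zero
next-fromℕ N rewrite view-fromℕ N = refl

next-inject₁ : ∀ {N} (j : Fin N) → next (inject₁ j) ≡ suc j
next-inject₁ j rewrite view-inject₁ j = refl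

next-prev : ∀ {N} (i : Fin (suc N)) → next (prev i) ≡ i
next-prev zero    = next-fromℕ _
next-prev (suc j) = next-inject₁ j

prev-next : ∀ {N} (i : Fin (suc N)) → prev (next i) ≡ i
prev-next i with view i
... | ‵fromℕ  = refl
... | ‵inj₁ _ = refl

suc²≢inject₁² : ∀ {N} (j : Fin N) → suc (suc j) ≢ inject₁ (inject₁ j)
suc²≢inject₁² (suc j) e = suc²≢inject₁² j (Fin.suc-injective e)

suc≢inject₁ : ∀ {N} (j : Fin N) → suc j ≢ inject₁ j
suc≢inject₁ (suc j) e = suc≢inject₁ j (Fin.suc-injective e)

prev≢ : ∀ {N} (i : Fin (suc (suc N))) → prev i ≢ i
prev≢ zero    ()
prev≢ (suc j) e = suc≢inject₁ j (sym e)

prev²≢ : ∀ {N} (i : Fin (suc (suc (suc N)))) → prev (prev i) ≢ i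
prev²≢ zero          ()
prev²≢ (suc zero)    ()
prev²≢ (suc (suc j)) e = suc²≢inject₁² j (sym e)

next≢ : ∀ {N} (i : Fin (suc (suc N))) → next i ≢ i
next≢ i e = prev≢ i (trans (cong prev (sym e)) (prev-next i))

next≢prev : ∀ {N} (i : Fin (suc (suc (suc N)))) → next i ≢ prev i
next≢prev i e = prev²≢ i (trans (cong prev (sym e)) (prev-next i))

-- A nontrivial group with three or more orbits arranged in a cycle

module ManyOrbits (G : FinGroup) (N : ℕ) {a : FinGroup.Carrier G} (a≢ε : a ≢ FinGroup.ε G) where
  open GroupTheory G
  open Representations G (3 + N)
  open VoltageGraphs G (3 + N)

  shift shift⁻ : Fin 2 → Fin (3 + N) → Fin (3 + N)
  shift 0F = next
  shift 1F = prev
  shift⁻ 0F = prev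
  shift⁻ 1F = next

  voltage : Fin 2 → Fin (3 + N) → Carrier
  voltage 1F 0F = a
  voltage _  _  = ε

  shift-distinct : ∀ k l i → shift k i ≡ shift l i → k ≡ l
  shift-distinct 0F 0F _ _ = refl
  shift-distinct 1F 1F _ _ = refl
  shift-distinct 0F 1F i e = contradiction e (next≢prev i)
  shift-distinct 1F 0F i e = contradiction (sym e) (next≢prev i)

  𝓥 : Voltage 2
  𝓥 = record
    { π = shift ; π⁻ = shift⁻
    ; π-π⁻ = λ { 0F → next-prev ; 1F → prev-next }
    ; π⁻-π = λ { 0F → prev-next ; 1F → next-prev }
    ; s = voltage
    ; loopless = λ { 0F i e _ → next≢ i e ; 1F i e _ → prev≢ i e }
    ; simple = λ k l i e _ → shift-distinct k l i e
    }

  open Voltage 𝓥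

  two-next : ∀ x (j : Fin (2 + N)) → Two (x , inject₁ j) (x , suc j)
  two-next x j = (0F , cong₂ _,_ (identityʳ x) (next-inject₁ j)) , (1F , cong (_, inject₁ j) (identityʳ x))

  two-level : ∀ {u w} → Two u w → proj₁ u ≡ proj₁ w
  two-level {x , i} ((0F , refl) , _) = sym (identityʳ x)
  two-level {_} {y , j} (_ , (0F , refl)) = identityʳ y
  two-level {x , i} ((1F , refl) , (1F , e)) = contradiction (,-injectiveʳ e) (prev²≢ i)

  star-level : ∀ {u w} → Star Two u w → proj₁ u ≡ proj₁ w
  star-level []       = refl
  star-level (t ◅ ts) = trans (two-level t) (star-level ts)

  -- Two-way arcs form a path on {x} × Fin m; the one-way arc leaving its end returns to its beginning,
  -- while the one leaving its beginning ends on another path because a ≢ ε.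
  Return : V → Set
  Return u = ∃ λ w → Star Two u w × Arc w u × ¬ Arc u w

  return : ∀ x → Return (x , 0F)
  return x = (x , fromℕ _) , path (fromℕ _) , (0F , cong₂ _,_ (identityʳ x) (next-fromℕ _)) , λ
    { (0F , ()) ; (1F , e) → a≢ε (identityʳ-unique x a (,-injectiveˡ e)) }
    where
    path : ∀ i → Star Two (x , 0F) (x , i)
    path = <-weakInduction (λ i → Star Two (x , 0F) (x , i)) [] (λ j p → p ◅◅ (two-next x j ◅ []))

  no-return : ∀ x j → ¬ Return (x , suc j)
  no-return x j ((y , i) , p , (0F , e) , ¬q) with star-level p
  ... | refl = ¬q (1F , cong₂ _,_ (identityʳ x)
                  (sym (trans (sym (prev-next i)) (cong prev (,-injectiveʳ e)))))
  no-return x j ((y , 0F) , p , (1F , e) , ¬q) =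
    a≢ε (identityʳ-unique y a (trans (,-injectiveˡ e) (star-level p)))
  no-return x j ((y , suc i) , p , (1F , e) , ¬q) with star-level p
  ... | refl = ¬q (0F , cong₂ _,_ (identityʳ x) (trans (cong next (sym (,-injectiveʳ e))) (next-inject₁ i)))

  orbit-0 : (A : Aut Arc) → ∀ x → proj₂ (Aut.σ A (x , 0F)) ≡ 0F
  orbit-0 A x with Aut.σ A (x , 0F) in eq
  ... | y , 0F    = refl
  ... | y , suc j = let w , p , q , ¬r = return x in
    contradiction (subst Return eq (σ w , gmap σ (two-σ A) p , σ-arc {w} {x , 0F} q , ¬r ∘ σ-reflects)) (no-return y j)
    where open Aut A

  Stable : Fin (3 + N) → Set
  Stable i = (A : Aut Arc) → ∀ x → proj₂ (Aut.σ A (x , i)) ≡ i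

  -- Two-way arcs keep the group coordinate, whereas the other arc leaving orbit 0 has voltage `a`.
  stable-1 : Stable 1F
  stable-1 A x with two-σ A (two-next x 0F)
  ... | (0F , e) , _ = trans (sym (,-injectiveʳ e)) (cong next (orbit-0 A x))
  ... | (1F , e) , q = contradiction (trans (two-level (two-σ A (two-next x 0F))) (sym (,-injectiveˡ e)))
        (λ e′ → a≢ε (trans (cong (voltage 1F) (sym (orbit-0 A x))) (identityʳ-unique _ _ (sym e′))))

  -- Out of orbit `j + 1` arcs lead only to `j + 2` and `j`, and `j` is already known to receive
  -- nothing from other orbits.
  stable-step : ∀ (j : Fin (1 + N)) → Stable (inject₁ (inject₁ j)) → Stable (inject₁ (suc j)) → Stable (suc (suc j))
  stable-step j P Q A x with Aut.σ-arc A (proj₁ (two-next x (suc j)))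
  ... | 0F , e = trans (sym (,-injectiveʳ e)) (trans (cong next (Q A x)) (next-inject₁ (suc j)))
  ... | 1F , e = contradiction (excluded-orbit A {x , suc (suc j)} P (trans (sym (,-injectiveʳ e)) (cong prev (Q A x)))) (suc²≢inject₁² j)

  stable : ∀ i → Stable i
  stable zero    = orbit-0
  stable (suc j) = proj₂ (<-weakInduction (λ j → Stable (inject₁ j) × Stable (suc j)) (orbit-0 , stable-1)
                     (λ i (P , Q) → Q , stable-step i P Q) j)

  labels : (A : Aut Arc) → LabelPreserving A
  labels = orbits⇒labels shift-distinct (λ A (x , i) → stable i A x)
    λ f flat x i j → trans (base f flat x i) (sym (base f flat x j))
    where
    base : ∀ (f : V → Carrier) → (∀ k x i → voltage k i ≡ ε → f (x , shift k i) ≡ f (x , i)) →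
           ∀ x i → f (x , i) ≡ f (x , 0F)
    base f flat x = <-weakInduction (λ i → f (x , i) ≡ f (x , 0F)) refl λ j e →
      trans (cong (λ i → f (x , i)) (sym (next-inject₁ j))) (trans (flat 0F x (inject₁ j) refl) e)

-- The trivial group

module TrivialGroup (G : FinGroup) (N : ℕ) (trivial : ∀ x → x ≡ FinGroup.ε G) where
  open GroupTheory G
  open Representations G (6 + N)
  open VoltageGraphs G (6 + N)

  pattern 4+_ j = suc (suc (suc (suc j)))

  top : Fin (6 + N)
  top = fromℕ (5 + N)

  -- Together with the cycle `next` this makes 0 ↔ 2 and the path 3 ↔ 4 ↔ ... ↔ `top` the only
  -- two-way arcs, and leaves vertex 1 without any. Having at least six vertices gives the path at
  -- least two edges, which tells it from the single edge 0 ↔ 2.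
  back back⁻ : Fin (6 + N) → Fin (6 + N)
  back 0F     = 2F
  back 1F     = top
  back 2F     = 0F
  back 3F     = 1F
  back (4+ j) = prev (4+ j)

  back⁻ 0F = 2F
  back⁻ 1F = 3F
  back⁻ 2F = 0F
  back⁻ (suc (suc (suc j))) with view j
  ... | ‵fromℕ          = 1F
  ... | ‵inj₁ {i = i} _ = 4+ i

  back⁻-top : back⁻ top ≡ 1F
  back⁻-top rewrite view-fromℕ (2 + N) = refl

  back⁻-inject₁ : ∀ j → back⁻ (inject₁ (suc (suc (suc j)))) ≡ 4+ j
  back⁻-inject₁ j rewrite view-inject₁ j = refl

  back-back⁻ : ∀ i → back (back⁻ i) ≡ i
  back-back⁻ 0F = refl
  back-back⁻ 1F = refl
  back-back⁻ 2F = refl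
  back-back⁻ (suc (suc (suc j))) with view j
  ... | ‵fromℕ  = refl
  ... | ‵inj₁ _ = refl

  back⁻-back : ∀ i → back⁻ (back i) ≡ i
  back⁻-back 0F = refl
  back⁻-back 1F = back⁻-top
  back⁻-back 2F = refl
  back⁻-back 3F = refl
  back⁻-back (4+ j) = back⁻-inject₁ j

  next≢back : ∀ i → next i ≢ back i
  next≢back 0F ()
  next≢back 1F ()
  next≢back 2F ()
  next≢back 3F ()
  next≢back (4+ j) = next≢prev (4+ j)

  back≢ : ∀ i → back i ≢ i
  back≢ 0F ()
  back≢ 1F ()
  back≢ 2F ()
  back≢ 3F ()
  back≢ (4+ j) = prev≢ (4+ j)

  walk walk⁻ : Fin 2 → Fin (6 + N) → Fin (6 + N)
  walk 0F = next
  walk 1F = back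
  walk⁻ 0F = prev
  walk⁻ 1F = back⁻

  walk-distinct : ∀ k l i → walk k i ≡ walk l i → k ≡ l
  walk-distinct 0F 0F _ _ = refl
  walk-distinct 1F 1F _ _ = refl
  walk-distinct 0F 1F i e = contradiction e (next≢back i)
  walk-distinct 1F 0F i e = contradiction (sym e) (next≢back i)

  𝓥 : Voltage 2
  𝓥 = record
    { π = walk ; π⁻ = walk⁻
    ; π-π⁻ = λ { 0F → next-prev ; 1F → back-back⁻ }
    ; π⁻-π = λ { 0F → prev-next ; 1F → back⁻-back }
    ; s = λ _ _ → ε
    ; loopless = λ { 0F i e _ → next≢ i e ; 1F i e _ → back≢ i e }
    ; simple = λ k l i e _ → walk-distinct k l i e
    }

  open Voltage 𝓥

  arc : ∀ x k {i j} → walk k i ≡ j → Arc (x , i) (x , j)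
  arc x k e = k , cong₂ _,_ (identityʳ x) e

  two : ∀ x k l {i j} → walk k i ≡ j → walk l j ≡ i → Two (x , i) (x , j)
  two x k l e e′ = arc x k e , arc x l e′

  two-02 : ∀ x → Two (x , 0F) (x , 2F)
  two-02 x = two x 1F 1F refl refl

  two-20 : ∀ x → Two (x , 2F) (x , 0F)
  two-20 x = two x 1F 1F refl refl

  two-4+ : ∀ x (j : Fin (2 + N)) → Two (x , inject₁ (suc (suc (suc j)))) (x , 4+ j)
  two-4+ x j = two x 0F 1F (next-inject₁ (suc (suc (suc j)))) refl

  two-4+′ : ∀ x (j : Fin (2 + N)) → Two (x , 4+ j) (x , inject₁ (suc (suc (suc j))))
  two-4+′ x j = proj₂ (two-4+ x j) , proj₁ (two-4+ x j)

  HasTwo : V → Set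
  HasTwo u = ∃ λ v → Two u v

  no-two-1 : ∀ x → ¬ HasTwo (x , 1F)
  no-two-1 x (_ , (0F , refl) , (0F , ()))
  no-two-1 x (_ , (0F , refl) , (1F , ()))
  no-two-1 x (_ , (1F , refl) , (0F , e)) = contradiction (trans (sym (next-fromℕ (5 + N))) (,-injectiveʳ e)) λ ()
  no-two-1 x (_ , (1F , refl) , (1F , ()))

  has-two : ∀ x i → i ≢ 1F → HasTwo (x , i)
  has-two x 0F _ = _ , two-02 x
  has-two x 1F p = contradiction refl p
  has-two x 2F _ = _ , two-20 x
  has-two x 3F _ = _ , two-4+ x 0F
  has-two x (4+ j) _ = _ , two-4+′ x j

  Stable : Fin (6 + N) → Set
  Stable i = (A : Aut Arc) → ∀ x → proj₂ (Aut.σ A (x , i)) ≡ i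

  stable-1 : Stable 1F
  stable-1 A x with proj₂ (Aut.σ A (x , 1F)) Fin.≟ 1F
  ... | yes e = e
  ... | no ne = let v , t = has-two _ _ ne in contradiction
    (Aut.τ A v , subst (λ u → Two u (Aut.τ A v)) (Aut.τ-σ A (x , 1F)) (two-σ (inverse A) {Aut.σ A (x , 1F)} {v} t)) (no-two-1 x)

  -- Used to distinguish the out-neighbours 2 and `top` of vertex 1: only from `top` can two-way
  -- arcs be followed for two steps without returning.
  Longer : V → Set
  Longer u = ∃₂ λ v w → Two u v × Two v w × w ≢ u

  longer-top : ∀ x → Longer (x , top)
  longer-top x = _ , _ , two-4+′ x (fromℕ (1 + N)) , two-4+′ x (inject₁ (fromℕ N)) ,
    λ e → suc²≢inject₁² _ (sym (,-injectiveʳ e))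

  no-longer-2 : ∀ x → ¬ Longer (x , 2F)
  no-longer-2 x (_ , _ , ((0F , refl) , (0F , ())) , _)
  no-longer-2 x (_ , _ , ((0F , refl) , (1F , ())) , _)
  no-longer-2 x (_ , _ , ((1F , refl) , _) , ((0F , refl) , (0F , ())) , _)
  no-longer-2 x (_ , _ , ((1F , refl) , _) , ((0F , refl) , (1F , ())) , _)
  no-longer-2 x (_ , _ , ((1F , refl) , _) , ((1F , refl) , _) , ne) =
    ne (cong (_, 2F) (trans (identityʳ (x ∙ ε)) (identityʳ x)))

  stable-2 : Stable 2F
  stable-2 A x with Aut.σ-arc A (arc x 0F {1F} refl)
  ... | 0F , e = trans (sym (,-injectiveʳ e)) (cong next (stable-1 A x))
  ... | 1F , e = contradiction
    (let v , w , p , q , ne = longer-top (proj₁ (σ (x , 2F))) in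
     subst Longer (τ-σ (x , 2F)) (τ v , τ w , two-σ (inverse A) {σ (x , 2F)} {v} (subst (λ i → Two (proj₁ (σ (x , 2F)) , i) v) top≡ p) ,
       two-σ (inverse A) {v} {w} q , λ e′ → ne (trans (Aut.σ-injective (inverse A) e′) (cong (proj₁ (σ (x , 2F)) ,_) (sym top≡)))))
    (no-longer-2 x)
    where
    open Aut A
    top≡ : top ≡ proj₂ (σ (x , 2F))
    top≡ = trans (cong back (sym (stable-1 A x))) (,-injectiveʳ e)

  stable-0 : Stable 0F
  stable-0 A x with two-σ A (two-20 x)
  ... | (1F , e) , _ = trans (sym (,-injectiveʳ e)) (cong back (stable-2 A x))
  ... | (0F , e) , (0F , e′) = contradiction (trans (sym (stable-2 A x)) (trans (sym (,-injectiveʳ e′)) (cong next (trans (sym (,-injectiveʳ e)) (cong next (stable-2 A x)))))) λ ()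
  ... | (0F , e) , (1F , e′) = contradiction (trans (sym (stable-2 A x)) (trans (sym (,-injectiveʳ e′)) (cong back (trans (sym (,-injectiveʳ e)) (cong next (stable-2 A x)))))) λ ()

  -- The image of `next i` is again an out-neighbour of `i`, and `back i` is excluded as it is
  -- stable itself. From 1, 2 and 0 this settles the remaining vertices in increasing order.
  stable-next : ∀ {i j} → next i ≡ j → back i ≢ j → Stable i → Stable (back i) → Stable j
  stable-next {i} {j} e ne P Q A x with Aut.σ-arc A (arc x 0F e)
  ... | 0F , e′ = trans (sym (,-injectiveʳ e′)) (trans (cong next (P A x)) e)
  ... | 1F , e′ = contradiction (sym (excluded-orbit A {x , j} Q (trans (sym (,-injectiveʳ e′)) (cong back (P A x))))) ne

  stable-3 : Stable 3F
  stable-3 = stable-next {2F} refl (λ ()) stable-2 stable-0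

  stable-4 : Stable (4+ zero)
  stable-4 = stable-next {3F} refl (λ ()) stable-3 stable-1

  stable-4+ : ∀ (j : Fin (2 + N)) → Stable (4+ j)
  stable-4+ zero    = stable-4
  stable-4+ (suc j) = proj₂ (<-weakInduction
    (λ j → Stable (inject₁ (4+ j)) × Stable (4+ (suc j)))
    (stable-4 , advance zero stable-3 stable-4)
    (λ i (P , Q) → Q , advance (suc i) P Q) j)
    where
    advance : ∀ (j : Fin (1 + N)) → Stable (inject₁ (inject₁ (suc (suc (suc j))))) → Stable (inject₁ (4+ j)) → Stable (4+ (suc j))
    advance j P Q = stable-next (next-inject₁ (4+ j)) (λ e → suc²≢inject₁² _ (sym e)) Q P

  stable : ∀ i → Stable i
  stable 0F     = stable-0
  stable 1F     = stable-1
  stable 2F     = stable-2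
  stable 3F     = stable-3
  stable (4+ j) = stable-4+ j

  trivial-DRR : HasDRR (6 + N) G
  trivial-DRR = rep⇒DRR 0F (voltageRep 0F (orbits⇒labels walk-distinct (λ A (x , i) → stable i A x)
      λ f _ x i j → trans (trivial _) (sym (trivial _))))
    λ x → subst Gen (sym (trivial x)) gen-ε

-- Cyclic subgroups

module Cyclic (G : FinGroup) where
  open GroupTheory G
  -- With this version `2 ⋆ c` and `3 ⋆ c` reduce to `c ∙ c` and `c ∙ c ∙ c`, so both notations can
  -- be mixed freely below.
  open import Algebra.Properties.Monoid.Mult.TCOptimised monoid public
    using (1+×; ×-homo-+; ×-assocˡ) renaming (_×_ to infixr 8 _⋆_)

  module ⟨_⟩ (c : Carrier) where
    open Generated {λ x → x ≡ c} (_≟ c) public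
    open Subgroup ⟨X⟩ public using (∙∈ʳ; ∙∈ˡ)

    c∈ : Gen c
    c∈ = gen-X refl

    powers∈ : ∀ n → Gen (n ⋆ c)
    powers∈ zero          = gen-ε
    powers∈ (suc zero)    = c∈
    powers∈ (suc (suc n)) = gen-∙ (powers∈ (suc n)) refl

    commutes : ∀ {x} → Gen x → x ∙ c ≡ c ∙ x
    commutes = gen-elim (λ x → x ∙ c ≟ c ∙ x) (trans (identityˡ c) (sym (identityʳ c)))
      (λ { x _ refl e → trans (cong (_∙ c) e) (assoc c x c) })
      (λ { x _ refl e → trans (//-rightDividesˡ c x) (trans (sym (//-rightDividesʳ c x))
             (trans (cong (_∙ c ⁻¹) e) (assoc c x (c ⁻¹)))) })

  ε-power : ∀ n → n ⋆ ε ≡ ε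
  ε-power zero          = refl
  ε-power (suc zero)    = refl
  ε-power (suc (suc n)) = trans (identityʳ _) (ε-power (suc n))

  ⋆-mod : ∀ {k x} → suc k ⋆ x ≡ ε → ∀ n → toℕ (n mod suc k) ⋆ x ≡ n ⋆ x
  ⋆-mod {k} {x} xᵖ≡ε n = sym (trans (cong (_⋆ x) (m≡m%n+[m/n]*n n p)) (trans (×-homo-+ x (n % p) (n / p * p))
    (trans (cong₂ (λ k y → k ⋆ x ∙ y) (sym (Fin.toℕ-fromℕ< (m%n<n n p)))
      (trans (sym (×-assocˡ x (n / p) p)) (trans (cong ((n / p) ⋆_) xᵖ≡ε) (ε-power (n / p)))))
      (identityʳ _))))
    where
    p : ℕ
    p = suc k

  -- The inverse of `c` is `k ⋆ c`, so both kinds of generator step add to the exponent modulo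
  -- `suc k`.
  finite-powers : ∀ {k c} → suc k ⋆ c ≡ ε → ∀ {x} → ⟨_⟩.Gen c x → ∃ λ (i : Fin (suc k)) → toℕ i ⋆ c ≡ x
  finite-powers {k} {c} cᵖ≡ε = ⟨_⟩.gen-elim c (λ x → Fin.any? λ i → toℕ i ⋆ c ≟ x) (zero , refl)
    (λ { x _ refl (i , e) → (toℕ i + 1) mod suc k , trans (⋆-mod cᵖ≡ε (toℕ i + 1)) (trans (×-homo-+ c (toℕ i) 1) (cong (_∙ c) e)) })
    (λ { x _ refl (i , e) → (toℕ i + k) mod suc k , trans (⋆-mod cᵖ≡ε (toℕ i + k)) (trans (×-homo-+ c (toℕ i) k) (cong₂ _∙_ e c⁻¹)) })
    where
    c⁻¹ : k ⋆ c ≡ c ⁻¹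
    c⁻¹ = inverseʳ-unique c (k ⋆ c) (trans (sym (1+× k c)) cᵖ≡ε)

  -- Common factors are cancelled until one exponent is zero; only a lower bound for the order of
  -- `c` enters.
  powers-injective : ∀ {k} c → (∀ n → n < k → suc n ⋆ c ≢ ε) →
                     Injective _≡_ _≡_ (λ (i : Fin (suc k)) → toℕ i ⋆ c)
  powers-injective {k} c ne {i} {j} e = Fin.toℕ-injective (go (toℕ i) (toℕ j) (Fin.toℕ<n i) (Fin.toℕ<n j) e)
    where
    go : ∀ i j → i < suc k → j < suc k → i ⋆ c ≡ j ⋆ c → i ≡ j
    go zero    zero    _ _ _ = refl
    go zero    (suc j) _ (s≤s lt) e = contradiction (sym e) (ne j lt)
    go (suc i) zero    (s≤s lt) _ e = contradiction e (ne i lt)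
    go (suc i) (suc j) lt lt′ e = cong suc (go i j (ℕ.<⇒≤ lt) (ℕ.<⇒≤ lt′)
      (∙-cancelˡ c _ _ (trans (sym (1+× i c)) (trans e (1+× j c)))))

  module _ {k l : ℕ} (p : Fin k → Carrier) (q : Fin l → Carrier) where
    append : Fin (k + l) → Carrier
    append i = [ p , q ]′ (splitAt k i)

    append-injective : Injective _≡_ _≡_ p → Injective _≡_ _≡_ q → (∀ i j → p i ≢ q j) → Injective _≡_ _≡_ append
    append-injective p-inj q-inj p≢q {i} {j} e = trans (sym (Fin.join-splitAt k l i))
      (trans (cong (join k l) (go (splitAt k i) (splitAt k j) e)) (Fin.join-splitAt k l j))
      where
      go : ∀ s t → [ p , q ]′ s ≡ [ p , q ]′ t → s ≡ t
      go (inj₁ x) (inj₁ y) e = cong inj₁ (p-inj e)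
      go (inj₁ x) (inj₂ y) e = contradiction e (p≢q x y)
      go (inj₂ x) (inj₁ y) e = contradiction (sym e) (p≢q y x)
      go (inj₂ x) (inj₂ y) e = cong inj₂ (q-inj e)

    append-∈ : {P : Carrier → Set} → (∀ i → P (p i)) → (∀ i → P (q i)) → ∀ i → P (append i)
    append-∈ {P} p∈ q∈ i = go (splitAt k i)
      where
      go : ∀ s → P ([ p , q ]′ s)
      go (inj₁ x) = p∈ x
      go (inj₂ y) = q∈ y

  power∈ : ∀ (K : Subgroup) {c} → Subgroup.Mem K c → ∀ n → Subgroup.Mem K (n ⋆ c)
  power∈ K c∈ zero          = Subgroup.ε∈ K
  power∈ K c∈ (suc zero)    = c∈
  power∈ K c∈ (suc (suc n)) = Subgroup.∙∈ K (power∈ K c∈ (suc n)) c∈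

  below₂ : ∀ {c} → c ≢ ε → 2 ⋆ c ≢ ε → ∀ n → n < 2 → suc n ⋆ c ≢ ε
  below₂ c≢ε c²≢ε 0 _ = c≢ε
  below₂ c≢ε c²≢ε 1 _ = c²≢ε
  below₂ _ _ (suc (suc _)) (s≤s (s≤s ()))

  below₃ : ∀ {c} → c ≢ ε → 2 ⋆ c ≢ ε → 3 ⋆ c ≢ ε → ∀ n → n < 3 → suc n ⋆ c ≢ ε
  below₃ c≢ε c²≢ε c³≢ε 0 _ = c≢ε
  below₃ c≢ε c²≢ε c³≢ε 1 _ = c²≢ε
  below₃ c≢ε c²≢ε c³≢ε 2 _ = c³≢ε
  below₃ _ _ _ (suc (suc (suc _))) (s≤s (s≤s (s≤s ())))

  below₄ : ∀ {c} → c ≢ ε → 2 ⋆ c ≢ ε → 3 ⋆ c ≢ ε → 4 ⋆ c ≢ ε → ∀ n → n < 4 → suc n ⋆ c ≢ ε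
  below₄ c≢ε c²≢ε c³≢ε c⁴≢ε 0 _ = c≢ε
  below₄ c≢ε c²≢ε c³≢ε c⁴≢ε 1 _ = c²≢ε
  below₄ c≢ε c²≢ε c³≢ε c⁴≢ε 2 _ = c³≢ε
  below₄ c≢ε c²≢ε c³≢ε c⁴≢ε 3 _ = c⁴≢ε
  below₄ _ _ _ _ (suc (suc (suc (suc _)))) (s≤s (s≤s (s≤s (s≤s ()))))

  module Cosets {k : ℕ} {c b : Carrier} (b∉ : ¬ ⟨_⟩.Gen c b) (ne : ∀ n → n < k → suc n ⋆ c ≢ ε) where
    private module C = ⟨_⟩ c

    powers coset : Fin (suc k) → Carrier
    powers i = toℕ i ⋆ c
    coset i = b ∙ powers i

    powers-inj : Injective _≡_ _≡_ powers
    powers-inj = powers-injective c ne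

    powers≢coset : ∀ i j → powers i ≢ coset j
    powers≢coset i j e = b∉ (C.∙∈ˡ (C.powers∈ (toℕ j)) (subst C.Gen e (C.powers∈ (toℕ i))))

    -- These elements of any subgroup containing `b` and `c` feed the counting in `sparse-good`; `c`
    -- may well have larger order than `suc k`.
    cosets : Fin (suc k + suc k) → Carrier
    cosets = append powers coset

    cosets-inj : Injective _≡_ _≡_ cosets
    cosets-inj = append-injective powers coset powers-inj (powers-inj ∘ ∙-cancelˡ b _ _) powers≢coset

    cosets∈ : ∀ (K : Subgroup) → Subgroup.Mem K c → Subgroup.Mem K b → ∀ i → Subgroup.Mem K (cosets i)
    cosets∈ K c∈ b∈ = append-∈ powers coset {Subgroup.Mem K} (λ i → power∈ K c∈ (toℕ i))
      (λ i → Subgroup.∙∈ K b∈ (power∈ K c∈ (toℕ i)))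

    module Extra {x : Carrier} (x≢powers : ∀ i → powers i ≢ x) (x≢coset : ∀ i → coset i ≢ x) where
      -- Needed where two cosets just meet the bound: one further element turns 8 into 9 for valency
      -- three and 6 into 7 for valency two.
      cosets⁺ : Fin (suc k + suc k + 1) → Carrier
      cosets⁺ = append cosets (λ _ → x)

      cosets⁺-inj : Injective _≡_ _≡_ cosets⁺
      cosets⁺-inj = append-injective cosets (λ _ → x) cosets-inj (λ { {zero} {zero} _ → refl })
        (λ i _ → append-∈ powers coset {_≢ x} x≢powers x≢coset i)

      cosets⁺∈ : ∀ (K : Subgroup) → Subgroup.Mem K c → Subgroup.Mem K b → Subgroup.Mem K x → ∀ i → Subgroup.Mem K (cosets⁺ i)
      cosets⁺∈ K c∈ b∈ x∈ = append-∈ cosets (λ _ → x) {Subgroup.Mem K} (cosets∈ K c∈ b∈) (λ _ → x∈)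

-- Cayley digraphs

module CayleyDigraphs (G : FinGroup) where
  open GroupTheory G
  open Representations G 1
  open VoltageGraphs G 1

  module Cayley {d : ℕ} (S : Fin d → Carrier) (S≢ε : ∀ k → S k ≢ ε) (S-inj : Injective _≡_ _≡_ S) where
    𝓥 : Voltage d
    𝓥 = record
      { π = λ _ i → i ; π⁻ = λ _ i → i ; π-π⁻ = λ _ _ → refl ; π⁻-π = λ _ _ → refl
      ; s = λ k _ → S k ; loopless = λ k _ _ → S≢ε k ; simple = λ k l _ _ → S-inj }

    open Voltage 𝓥 public

    S∈ : ∀ k → Gen (S k)
    S∈ k = gen-X (k , 0F , refl)

    LocalArc : Fin d → Fin d → Set
    LocalArc k l = ∃ λ j → S k ∙ S j ≡ S l

    -- An automorphism induces at every vertex u an automorphism of the digraph on the out-neighbours of u,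
    -- which is a copy of LocalArc.
    Asymmetric : Set
    Asymmetric = ∀ (p : Fin d → Fin d) → Injective _≡_ _≡_ p → (∀ {k l} → LocalArc k l → LocalArc (p k) (p l)) →
                 (∀ {k l} → LocalArc (p k) (p l) → LocalArc k l) → ∀ k → p k ≡ k

    label-preserving : (A : Aut Arc) → (∀ k u → Aut.σ A (step k u) ≡ step k (Aut.σ A u)) → LabelPreserving A
    label-preserving A comm = (λ u → only _ _) , (λ x i j → cong (λ i → proj₁ (Aut.σ A (x , i))) (only i j)) , comm
      where
      only : (i j : Fin 1) → i ≡ j
      only 0F 0F = refl

    asymmetric⇒labels : Asymmetric → (A : Aut Arc) → LabelPreserving A
    asymmetric⇒labels asym A = label-preserving A comm
      where
      open Aut A
      arc⁺ : ∀ u {k l} → LocalArc k l → Arc (step k u) (step l u)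
      arc⁺ (x , i) {k} (j , e) = j , cong (_, i) (trans (assoc x (S k) (S j)) (cong (x ∙_) e))
      arc⁻ : ∀ u {k l} → Arc (step k u) (step l u) → LocalArc k l
      arc⁻ (x , i) {k} (j , e) = j , ∙-cancelˡ x _ _ (trans (sym (assoc x (S k) (S j))) (,-injectiveˡ e))
      module _ (u : V) where
        p : Fin d → Fin d
        p k = proj₁ (σ-arc {u} {step k u} (k , refl))
        p-σ : ∀ k → step (p k) (σ u) ≡ σ (step k u)
        p-σ k = proj₂ (σ-arc {u} {step k u} (k , refl))
        fixed : ∀ k → p k ≡ k
        fixed = asym p
          (λ {k} {l} e → step-injective (σ-injective (trans (sym (p-σ k)) (trans (cong (λ i → step i (σ u)) e) (p-σ l)))))
          (λ {k} {l} a → arc⁻ (σ u) (subst₂ Arc (sym (p-σ k)) (sym (p-σ l)) (σ-arc (arc⁺ u a))))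
          (λ {k} {l} a → arc⁻ u (σ-reflects (subst₂ Arc (p-σ k) (p-σ l) (arc⁺ (σ u) a))))
      comm : ∀ k u → σ (step k u) ≡ step k (σ u)
      comm k u = trans (sym (p-σ u k)) (cong (λ i → step i (σ u)) (fixed u k))

  -- A directed cycle: with out-valency one there is nothing to permute among the out-neighbours, so
  -- no counting is required.
  cyclic-DRR : ∀ {c} → c ≢ ε → (∀ x → Cyclic.⟨_⟩.Gen G c x) → HasDRR 1 G
  cyclic-DRR {c} c≢ε full = rep⇒DRR 0F (voltageRep 0F (asymmetric⇒labels λ { p _ _ _ 0F → only (p 0F) }))
    λ x → C.gen-elim Gen? gen-ε (λ { y _ refl y∈ → gen-∙ y∈ (0F , 0F , refl) }) (λ { y _ refl y∈ → gen-∙⁻¹ y∈ (0F , 0F , refl) }) (full x)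
    where
    module C = Cyclic.⟨_⟩ G c
    only : (k : Fin 1) → k ≡ 0F
    only 0F = refl
    single-inj : Injective _≡_ _≡_ (λ (_ : Fin 1) → c)
    single-inj {0F} {0F} _ = refl
    open Cayley {1} (λ _ → c) (λ _ → c≢ε) single-inj

  trivial-DRR₁ : (∀ x → x ≡ ε) → HasDRR 1 G
  trivial-DRR₁ trivial = rep⇒DRR 0F (voltageRep 0F (asymmetric⇒labels λ { _ _ _ _ () }))
    λ x → subst Gen (sym (trivial x)) gen-ε
    where
    none : Fin 0 → Carrier
    none ()
    none≢ε : ∀ k → none k ≢ ε
    none≢ε ()
    none-inj : Injective _≡_ _≡_ none
    none-inj {()}
    open Cayley none none≢ε none-inj

  open Cyclic G

  triple : Carrier → Carrier → Carrier → Fin 3 → Carrier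
  triple x y z 0F = x
  triple x y z 1F = y
  triple x y z 2F = z

  triple-injective : ∀ {x y z} → x ≢ y → x ≢ z → y ≢ z → Injective _≡_ _≡_ (triple x y z)
  triple-injective xy xz yz {0F} {0F} _ = refl
  triple-injective xy xz yz {0F} {1F} e = contradiction e xy
  triple-injective xy xz yz {0F} {2F} e = contradiction e xz
  triple-injective xy xz yz {1F} {0F} e = contradiction (sym e) xy
  triple-injective xy xz yz {1F} {1F} _ = refl
  triple-injective xy xz yz {1F} {2F} e = contradiction e yz
  triple-injective xy xz yz {2F} {0F} e = contradiction (sym e) xz
  triple-injective xy xz yz {2F} {1F} e = contradiction (sym e) yz
  triple-injective xy xz yz {2F} {2F} _ = refl

  module Square {c b : Carrier} (c≢ε : c ≢ ε) (c²≢ε : 2 ⋆ c ≢ ε) (c³≢ε : 3 ⋆ c ≢ ε)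
      (b∉ : ¬ ⟨_⟩.Gen c b) (b²≢c : b ∙ b ≢ c) (b²≢c² : b ∙ b ≢ c ∙ c) where
    private module C = ⟨_⟩ c

    b≢ε : b ≢ ε
    b≢ε e = b∉ (subst C.Gen (sym e) C.gen-ε)

    S≢ε : ∀ k → triple c (c ∙ c) b k ≢ ε
    S≢ε 0F = c≢ε
    S≢ε 1F = c²≢ε
    S≢ε 2F = b≢ε

    S-inj : Injective _≡_ _≡_ (triple c (c ∙ c) b)
    S-inj = triple-injective (λ e → c≢ε (identityʳ-unique c c (sym e))) (λ { refl → b∉ C.c∈ }) (λ { refl → b∉ (C.powers∈ 2) })

    open Cayley (triple c (c ∙ c) b) S≢ε S-inj public

    -- Comparing membership in `⟨ c ⟩` and cancelling leaves only equations between powers of `c`,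
    -- excluded by its order being at least 4, and the two equations for `b ∙ b` that are assumed
    -- away. The single arc from `c` to `c ∙ c` pins both its ends, and injectivity the third
    -- out-neighbour.
    only-arc : ∀ {k l} → LocalArc k l → k ≡ 0F × l ≡ 1F
    only-arc {0F} {0F} (0F , e) = contradiction (identityʳ-unique c c e) c≢ε
    only-arc {0F} {0F} (1F , e) = contradiction (identityʳ-unique c (c ∙ c) e) c²≢ε
    only-arc {0F} {0F} (2F , e) = contradiction (identityʳ-unique c b e) b≢ε
    only-arc {0F} {1F} _ = refl , refl
    only-arc {0F} {2F} (0F , e) = contradiction (subst C.Gen e (C.powers∈ 2)) b∉
    only-arc {0F} {2F} (1F , e) = contradiction (subst C.Gen e (C.gen-product C.c∈ (C.powers∈ 2))) b∉
    only-arc {0F} {2F} (2F , e) = contradiction (identityˡ-unique c b e) c≢ε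
    only-arc {1F} {0F} (0F , e) = contradiction (identityˡ-unique (c ∙ c) c e) c²≢ε
    only-arc {1F} {0F} (1F , e) = contradiction (identityˡ-unique _ c (trans (assoc (c ∙ c) c c) e)) c³≢ε
    only-arc {1F} {0F} (2F , e) = contradiction (C.∙∈ʳ (C.powers∈ 2) (subst C.Gen (sym e) C.c∈)) b∉
    only-arc {1F} {1F} (0F , e) = contradiction (identityʳ-unique (c ∙ c) c e) c≢ε
    only-arc {1F} {1F} (1F , e) = contradiction (identityʳ-unique (c ∙ c) (c ∙ c) e) c²≢ε
    only-arc {1F} {1F} (2F , e) = contradiction (identityʳ-unique (c ∙ c) b e) b≢ε
    only-arc {1F} {2F} (0F , e) = contradiction (subst C.Gen e (C.powers∈ 3)) b∉
    only-arc {1F} {2F} (1F , e) = contradiction (subst C.Gen e (C.gen-product (C.powers∈ 2) (C.powers∈ 2))) b∉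
    only-arc {1F} {2F} (2F , e) = contradiction (identityˡ-unique (c ∙ c) b e) c²≢ε
    only-arc {2F} {0F} (0F , e) = contradiction (identityˡ-unique b c e) b≢ε
    only-arc {2F} {0F} (1F , e) = contradiction (C.∙∈ˡ (C.powers∈ 2) (subst C.Gen (sym e) C.c∈)) b∉
    only-arc {2F} {0F} (2F , e) = contradiction e b²≢c
    only-arc {2F} {1F} (0F , e) = contradiction (C.∙∈ˡ C.c∈ (subst C.Gen (sym e) (C.powers∈ 2))) b∉
    only-arc {2F} {1F} (1F , e) = contradiction (identityˡ-unique b (c ∙ c) e) b≢ε
    only-arc {2F} {1F} (2F , e) = contradiction e b²≢c²
    only-arc {2F} {2F} (0F , e) = contradiction (identityʳ-unique b c e) c≢ε
    only-arc {2F} {2F} (1F , e) = contradiction (identityʳ-unique b (c ∙ c) e) c²≢ε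
    only-arc {2F} {2F} (2F , e) = contradiction (identityʳ-unique b b e) b≢ε

    asymmetric : Asymmetric
    asymmetric p p-inj p⁺ p⁻ = fixed
      where
      image : p 0F ≡ 0F × p 1F ≡ 1F
      image = only-arc (p⁺ {0F} {1F} (0F , refl))
      fixed : ∀ k → p k ≡ k
      fixed 0F = proj₁ image
      fixed 1F = proj₂ image
      fixed 2F with p 2F in e
      ... | 0F = contradiction (p-inj (trans e (sym (proj₁ image)))) λ ()
      ... | 1F = contradiction (p-inj (trans e (sym (proj₂ image)))) λ ()
      ... | 2F = refl

    good : ∀ {n} (h : Fin n → Carrier) → Injective _≡_ _≡_ h → (∀ i → Gen (h i)) → 8 < n → Good
    good {n} h h-inj h∈ lt = sparse-good 0F (asymmetric⇒labels asymmetric) 0F 1F (λ ()) h h-inj h∈ (subst (8 <_) (sym (ℕ.*-identityʳ n)) lt)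

  module Twisted {c b : Carrier} (c³≡ε : 3 ⋆ c ≡ ε) (b³≡ε : 3 ⋆ b ≡ ε) (cb≢bc : c ∙ b ≢ b ∙ c) where
    module C = ⟨_⟩ c

    b∉ : ¬ C.Gen b
    b∉ p = cb≢bc (sym (C.commutes p))

    c≢ε : c ≢ ε
    c≢ε refl = cb≢bc (trans (identityˡ b) (sym (identityʳ b)))

    b≢ε : b ≢ ε
    b≢ε refl = cb≢bc (trans (identityʳ c) (sym (identityˡ c)))

    b≢c : b ≢ c
    b≢c refl = cb≢bc refl

    c²≢ε : c ∙ c ≢ ε
    c²≢ε e = c≢ε (trans (sym (identityˡ c)) (trans (cong (_∙ c) (sym e)) c³≡ε))

    b²≢ε : b ∙ b ≢ ε
    b²≢ε e = b≢ε (trans (sym (identityˡ b)) (trans (cong (_∙ b) (sym e)) b³≡ε))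

    cb≢ε : c ∙ b ≢ ε
    cb≢ε e = b∉ (C.∙∈ʳ C.c∈ (subst C.Gen (sym e) C.gen-ε))

    b²∉ : ¬ C.Gen (b ∙ b)
    b²∉ p = b∉ (subst C.Gen (trans (sym (assoc (b ∙ b) b b)) (trans (cong (_∙ b) b³≡ε) (identityˡ b))) (C.gen-product p p))

    -- The equation says that conjugation by `b` inverts `c`. Then `b ∙ b` commutes with `c`, and so
    -- does its square, which is `b` because `b` has order three.
    cbc≢b : c ∙ b ∙ c ≢ b
    cbc≢b e = cb≢bc (begin
      c ∙ b                   ≡⟨ cong (c ∙_) (sym b²b²) ⟩
      c ∙ (b ∙ b ∙ (b ∙ b))   ≡⟨ assoc c (b ∙ b) (b ∙ b) ⟨
      c ∙ (b ∙ b) ∙ (b ∙ b)   ≡⟨ cong (_∙ (b ∙ b)) cb² ⟩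
      b ∙ b ∙ c ∙ (b ∙ b)     ≡⟨ assoc (b ∙ b) c (b ∙ b) ⟩
      b ∙ b ∙ (c ∙ (b ∙ b))   ≡⟨ cong (b ∙ b ∙_) cb² ⟩
      b ∙ b ∙ (b ∙ b ∙ c)     ≡⟨ assoc (b ∙ b) (b ∙ b) c ⟨
      b ∙ b ∙ (b ∙ b) ∙ c     ≡⟨ cong (_∙ c) b²b² ⟩
      b ∙ c                   ∎)
      where
      open ≡-Reasoning
      b²b² : b ∙ b ∙ (b ∙ b) ≡ b
      b²b² = trans (sym (assoc (b ∙ b) b b)) (trans (cong (_∙ b) b³≡ε) (identityˡ b))
      bc : b ∙ c ≡ c ⁻¹ ∙ b
      bc = trans (sym (\\-leftDividesʳ c (b ∙ c))) (cong (c ⁻¹ ∙_) (trans (sym (assoc c b c)) e))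
      cb : c ∙ b ≡ b ∙ c ⁻¹
      cb = trans (sym (//-rightDividesʳ c (c ∙ b))) (cong (_∙ c ⁻¹) e)
      cb² : c ∙ (b ∙ b) ≡ b ∙ b ∙ c
      cb² = begin
        c ∙ (b ∙ b)      ≡⟨ assoc c b b ⟨
        c ∙ b ∙ b        ≡⟨ cong (_∙ b) cb ⟩
        b ∙ c ⁻¹ ∙ b     ≡⟨ assoc b (c ⁻¹) b ⟩
        b ∙ (c ⁻¹ ∙ b)   ≡⟨ cong (b ∙_) bc ⟨
        b ∙ (b ∙ c)      ≡⟨ assoc b b c ⟨
        b ∙ b ∙ c        ∎

    S≢ε : ∀ k → triple c b (c ∙ b) k ≢ ε
    S≢ε 0F = c≢ε
    S≢ε 1F = b≢ε
    S≢ε 2F = cb≢ε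

    S-inj : Injective _≡_ _≡_ (triple c b (c ∙ b))
    S-inj = triple-injective (b≢c ∘ sym) (λ e → b≢ε (identityʳ-unique c b (sym e))) (λ e → c≢ε (identityˡ-unique c b (sym e)))

    open Cayley (triple c b (c ∙ b)) S≢ε S-inj public

    -- The arc from `c` to `c ∙ b` is always present. An arc from `b` to `c` is left open, since
    -- `asymmetric` copes with it either way.
    two-arcs : ∀ {k l} → LocalArc k l → (k ≡ 0F × l ≡ 2F) ⊎ (k ≡ 1F × l ≡ 0F)
    two-arcs {0F} {0F} (0F , e) = contradiction (identityʳ-unique c c e) c≢ε
    two-arcs {0F} {0F} (1F , e) = contradiction (identityʳ-unique c b e) b≢ε
    two-arcs {0F} {0F} (2F , e) = contradiction (identityʳ-unique c (c ∙ b) e) cb≢ε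
    two-arcs {0F} {1F} (0F , e) = contradiction (subst C.Gen e (C.powers∈ 2)) b∉
    two-arcs {0F} {1F} (1F , e) = contradiction (identityˡ-unique c b e) c≢ε
    two-arcs {0F} {1F} (2F , e) = contradiction (identityˡ-unique (c ∙ c) b (trans (assoc c c b) e)) c²≢ε
    two-arcs {0F} {2F} _ = inj₁ (refl , refl)
    two-arcs {1F} {0F} _ = inj₂ (refl , refl)
    two-arcs {1F} {1F} (0F , e) = contradiction (identityʳ-unique b c e) c≢ε
    two-arcs {1F} {1F} (1F , e) = contradiction (identityʳ-unique b b e) b≢ε
    two-arcs {1F} {1F} (2F , e) = contradiction (identityʳ-unique b (c ∙ b) e) cb≢ε
    two-arcs {1F} {2F} (0F , e) = contradiction (sym e) cb≢bc
    two-arcs {1F} {2F} (1F , e) = contradiction (∙-cancelʳ b b c e) b≢c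
    two-arcs {1F} {2F} (2F , e) = contradiction (identityˡ-unique b (c ∙ b) e) b≢ε
    two-arcs {2F} {0F} (0F , e) = contradiction (identityˡ-unique (c ∙ b) c e) cb≢ε
    two-arcs {2F} {0F} (1F , e) = contradiction (identityʳ-unique c (b ∙ b) (trans (sym (assoc c b b)) e)) b²≢ε
    two-arcs {2F} {0F} (2F , e) = contradiction (∙-cancelˡ c _ _ (trans (sym (assoc c b (c ∙ b))) (trans e (sym (identityʳ c))))) λ e′ →
      b²∉ (subst C.Gen (sym (inverseʳ-unique c (b ∙ b) (trans (sym (assoc c b b)) (conj e′)))) (C.gen-inverse C.c∈))
      where
      conj : b ∙ (c ∙ b) ≡ ε → c ∙ b ∙ b ≡ ε
      conj p = trans (cong (_∙ b) (inverseʳ-unique b (c ∙ b) p)) (inverseˡ b)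
    two-arcs {2F} {1F} (0F , e) = contradiction e cbc≢b
    two-arcs {2F} {1F} (1F , e) = contradiction (identityˡ-unique (c ∙ b) b e) cb≢ε
    two-arcs {2F} {1F} (2F , e) = contradiction (identityˡ-unique (c ∙ b ∙ c) b (trans (assoc (c ∙ b) c b) e)) λ p →
      b∉ (C.∙∈ʳ C.c∈ (C.∙∈ˡ C.c∈ (subst C.Gen (sym p) C.gen-ε)))
    two-arcs {2F} {2F} (0F , e) = contradiction (identityʳ-unique (c ∙ b) c e) c≢ε
    two-arcs {2F} {2F} (1F , e) = contradiction (identityʳ-unique (c ∙ b) b e) b≢ε
    two-arcs {2F} {2F} (2F , e) = contradiction (identityʳ-unique (c ∙ b) (c ∙ b) e) cb≢ε

    asymmetric : Asymmetric
    asymmetric p p-inj p⁺ p⁻ with two-arcs (p⁺ {0F} {2F} (1F , refl))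
    -- If the arc from `c` to `c ∙ b` went to one from `b` to `c`, a second application of `p` would
    -- give an arc ending in `b`, and there is none.
    ... | inj₂ (p0 , p2) = contradiction (two-arcs (p⁺ (subst₂ LocalArc p0 p2 (p⁺ {0F} {2F} (1F , refl)))))
      λ { (inj₁ (_ , p0′)) → contradiction (trans (sym p0) p0′) λ ()
        ; (inj₂ (_ , p0′)) → contradiction (trans (sym p0) p0′) λ () }
    ... | inj₁ (p0 , p2) = fixed
      where
      fixed : ∀ k → p k ≡ k
      fixed 0F = p0
      fixed 2F = p2
      fixed 1F with p 1F in e
      ... | 0F = contradiction (p-inj (trans e (sym p0))) λ ()
      ... | 1F = refl
      ... | 2F = contradiction (p-inj (trans e (sym p2))) λ ()

    open Cosets {2} b∉ (below₂ c≢ε c²≢ε)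

    -- The cosets of `⟨ c ⟩` represented by `ε`, `b` and `b ∙ b` are distinct: nine elements against
    -- the bound eight.
    good : Good
    good = sparse-good 0F (asymmetric⇒labels asymmetric) 0F 1F (λ ())
      (append cosets (λ i → b ∙ coset i))
      (append-injective cosets _ cosets-inj (powers-inj ∘ ∙-cancelˡ b _ _ ∘ ∙-cancelˡ b _ _)
        (λ i j → append-∈ powers coset {λ x → x ≢ b ∙ coset j}
          (λ i e → b²∉ (C.∙∈ˡ (C.powers∈ (toℕ j)) (subst C.Gen (trans e (sym (assoc b b _))) (C.powers∈ (toℕ i)))))
          (λ i e → powers≢coset i j (∙-cancelˡ b _ _ e)) i))
      (append-∈ cosets _ {Gen} (cosets∈ ⟨X⟩ (S∈ 0F) (S∈ 1F))
        (λ i → gen-product (S∈ 1F) (gen-product (S∈ 1F) (power∈ ⟨X⟩ (S∈ 0F) (toℕ i)))))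
      (from-yes (8 ℕ.<? 9))

  module Involution {c b : Carrier} (c²≢ε : c ∙ c ≢ ε) (b²≡ε : b ∙ b ≡ ε) (b∉ : ¬ ⟨_⟩.Gen c b) where
    private module C = ⟨_⟩ c

    b≢ε : b ≢ ε
    b≢ε e = b∉ (subst C.Gen (sym e) C.gen-ε)

    c≢ε : c ≢ ε
    c≢ε e = c²≢ε (trans (cong (_∙ c) e) (trans (identityˡ c) e))

    pair : Fin 2 → Carrier
    pair 0F = c
    pair 1F = b

    b≢c : b ≢ c
    b≢c e = b∉ (subst C.Gen (sym e) C.c∈)

    pair≢ε : ∀ k → pair k ≢ ε
    pair≢ε 0F = c≢ε
    pair≢ε 1F = b≢ε

    pair-inj : Injective _≡_ _≡_ pair
    pair-inj {0F} {0F} _ = refl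
    pair-inj {0F} {1F} e = contradiction (sym e) b≢c
    pair-inj {1F} {0F} e = contradiction e b≢c
    pair-inj {1F} {1F} _ = refl

    open Cayley pair pair≢ε pair-inj public

    -- Arcs labelled `b` are two-way, while an arc labelled `c` could be reversed only if `c ∙ c` or
    -- `c ∙ b` were trivial. Once the `b` arcs are known to be preserved, injectivity leaves only
    -- `c` for the others.
    labels : (A : Aut Arc) → LabelPreserving A
    labels A = label-preserving A λ { 0F u → comm-c u ; 1F u → comm-b u }
      where
      open Aut A
      one-way : ∀ u → ¬ Arc (step 0F u) u
      one-way (x , _) (0F , e) = c²≢ε (identityʳ-unique x (c ∙ c) (trans (sym (assoc x c c)) (,-injectiveˡ e)))
      one-way (x , _) (1F , e) = b∉ (C.∙∈ʳ C.c∈ (subst C.Gen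
        (sym (identityʳ-unique x (c ∙ b) (trans (sym (assoc x c b)) (,-injectiveˡ e)))) C.gen-ε))
      two-way : ∀ u → Arc (step 1F u) u
      two-way (x , i) = 1F , cong (_, i) (trans (assoc x b b) (trans (cong (x ∙_) b²≡ε) (identityʳ x)))
      comm-b : ∀ u → σ (step 1F u) ≡ step 1F (σ u)
      comm-b u with σ-arc {u} {step 1F u} (1F , refl)
      ... | 1F , e = sym e
      ... | 0F , e = contradiction (subst (λ w → Arc w (σ u)) (sym e) (σ-arc (two-way u))) (one-way (σ u))
      comm-c : ∀ u → σ (step 0F u) ≡ step 0F (σ u)
      comm-c u with σ-arc {u} {step 0F u} (0F , refl)
      ... | 0F , e = sym e
      ... | 1F , e = contradiction (step-injective {0F} {1F} {u} (σ-injective (trans (sym e) (sym (comm-b u))))) λ ()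

    good : ∀ {n} (h : Fin n → Carrier) → Injective _≡_ _≡_ h → (∀ i → Gen (h i)) → 6 < n → Good
    good {n} h h-inj h∈ lt = sparse-good 0F labels 0F 1F (λ ()) h h-inj h∈ (subst (6 <_) (sym (ℕ.*-identityʳ n)) lt)

    -- The symmetric group of degree 3 is too small for the counting argument.
    module Dihedral (c³≡ε : 3 ⋆ c ≡ ε) (cb≡bc² : c ∙ b ≡ b ∙ (c ∙ c)) where
      open Cosets {2} b∉ (below₂ c≢ε c²≢ε)
      open Rep (voltageRep 0F labels) using (_~_; Co; ~-◁; ~-trans; ~-sym)

      c²c²≡c : c ∙ c ∙ (c ∙ c) ≡ c
      c²c²≡c = trans (sym (assoc (c ∙ c) c c)) (trans (cong (_∙ c) c³≡ε) (identityˡ c))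

      c²b≡bc : c ∙ c ∙ b ≡ b ∙ c
      c²b≡bc = begin
        c ∙ c ∙ b             ≡⟨ assoc c c b ⟩
        c ∙ (c ∙ b)           ≡⟨ cong (c ∙_) cb≡bc² ⟩
        c ∙ (b ∙ (c ∙ c))     ≡⟨ assoc c b (c ∙ c) ⟨
        c ∙ b ∙ (c ∙ c)       ≡⟨ cong (_∙ (c ∙ c)) cb≡bc² ⟩
        b ∙ (c ∙ c) ∙ (c ∙ c) ≡⟨ assoc b (c ∙ c) (c ∙ c) ⟩
        b ∙ (c ∙ c ∙ (c ∙ c)) ≡⟨ cong (b ∙_) c²c²≡c ⟩
        b ∙ c                 ∎
        where open ≡-Reasoning

      bc²b≡c : b ∙ (c ∙ c) ∙ b ≡ c
      bc²b≡c = trans (cong (_∙ b) (sym cb≡bc²)) (trans (assoc c b b) (trans (cong (c ∙_) b²≡ε) (identityʳ c)))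

      bc³≡b : b ∙ (c ∙ c) ∙ c ≡ b
      bc³≡b = trans (assoc b (c ∙ c) c) (trans (cong (b ∙_) c³≡ε) (identityʳ b))

      ∉⇒≢ : ∀ {x y} → ¬ C.Gen x → C.Gen y → x ≢ y
      ∉⇒≢ ∉ ∈ e = ∉ (subst C.Gen (sym e) ∈)

      b-coset : ∀ {x} → C.Gen x → ¬ C.Gen (b ∙ x)
      b-coset x∈ = b∉ ∘ C.∙∈ˡ x∈

      Middle : Carrier → Carrier → Set
      Middle z v = (ε ≢ v × v ≢ z) × (∀ k → pair k ≢ v) × (∀ k → v ∙ pair k ≢ z)

      candidates : Fin 3 → Carrier
      candidates 0F = c ∙ c
      candidates 1F = b ∙ c
      candidates 2F = b ∙ (c ∙ c)

      c≢c² : c ≢ c ∙ c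
      c≢c² e = c≢ε (identityʳ-unique c c (sym e))

      b≢bc : ∀ {x} → x ≢ ε → b ≢ b ∙ x
      b≢bc x≢ε e = x≢ε (identityʳ-unique b _ (sym e))

      candidate-apart : ∀ i → ε ≢ candidates i × (∀ k → pair k ≢ candidates i)
      candidate-apart 0F = c²≢ε ∘ sym , λ { 0F → c≢c² ; 1F → ∉⇒≢ b∉ (C.powers∈ 2) }
      candidate-apart 1F = ∉⇒≢ (b-coset C.c∈) C.gen-ε ∘ sym , λ { 0F → ∉⇒≢ (b-coset C.c∈) C.c∈ ∘ sym ; 1F → b≢bc c≢ε }
      candidate-apart 2F = ∉⇒≢ (b-coset (C.powers∈ 2)) C.gen-ε ∘ sym , λ { 0F → ∉⇒≢ (b-coset (C.powers∈ 2)) C.c∈ ∘ sym ; 1F → b≢bc c²≢ε }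

      candidates-inj : Injective _≡_ _≡_ candidates
      candidates-inj {0F} {0F} _ = refl
      candidates-inj {0F} {1F} e = contradiction (sym e) (∉⇒≢ (b-coset C.c∈) (C.powers∈ 2))
      candidates-inj {0F} {2F} e = contradiction (sym e) (∉⇒≢ (b-coset (C.powers∈ 2)) (C.powers∈ 2))
      candidates-inj {1F} {0F} e = contradiction e (∉⇒≢ (b-coset C.c∈) (C.powers∈ 2))
      candidates-inj {1F} {1F} _ = refl
      candidates-inj {1F} {2F} e = contradiction (∙-cancelˡ b _ _ e) c≢c²
      candidates-inj {2F} {0F} e = contradiction e (∉⇒≢ (b-coset (C.powers∈ 2)) (C.powers∈ 2))
      candidates-inj {2F} {1F} e = contradiction (sym (∙-cancelˡ b _ _ e)) c≢c²
      candidates-inj {2F} {2F} _ = refl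

      -- The candidates are the elements of the group of order six other than `ε`, `c` and `b`. If
      -- `z` is not among them, only `z ∙ c ⁻¹` and `z ∙ b ⁻¹` remain to be avoided and three
      -- candidates suffice; otherwise `z` is to be avoided too, and an explicit choice is made.
      middle : ∀ z → ∃ λ i → Middle z (candidates i)
      middle z with Fin.any? (λ i → candidates i ≟ z)
      ... | yes (0F , refl) = 2F , (proj₁ (candidate-apart 2F) , ∉⇒≢ (b-coset (C.powers∈ 2)) (C.powers∈ 2)) , proj₂ (candidate-apart 2F) ,
        λ { 0F e → ∉⇒≢ b∉ (C.powers∈ 2) (trans (sym bc³≡b) e) ; 1F e → c≢c² (trans (sym bc²b≡c) e) }
      ... | yes (1F , refl) = 2F , (proj₁ (candidate-apart 2F) , λ e → c≢c² (sym (∙-cancelˡ b _ _ e))) , proj₂ (candidate-apart 2F) ,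
        λ { 0F e → b≢bc c≢ε (trans (sym bc³≡b) e) ; 1F e → ∉⇒≢ (b-coset C.c∈) C.c∈ (trans (sym e) bc²b≡c) }
      ... | yes (2F , refl) = 0F , (proj₁ (candidate-apart 0F) , ∉⇒≢ (b-coset (C.powers∈ 2)) (C.powers∈ 2) ∘ sym) , proj₂ (candidate-apart 0F) ,
        λ { 0F e → ∉⇒≢ (b-coset (C.powers∈ 2)) C.gen-ε (trans (sym e) c³≡ε) ; 1F e → c≢c² (∙-cancelˡ b _ _ (trans (sym c²b≡bc) e)) }
      ... | no z∉ with pigeonhole candidates candidates-inj (z ∙ c ⁻¹ ∷ z ∙ b ⁻¹ ∷ []) (from-yes (2 ℕ.<? 3))
      ...   | i , v∉ = i , (proj₁ (candidate-apart i) , λ e → z∉ (i , e)) , proj₂ (candidate-apart i) ,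
        λ { 0F e → v∉ (here (trans (sym (//-rightDividesʳ c _)) (cong (_∙ c ⁻¹) e)))
          ; 1F e → v∉ (there (here (trans (sym (//-rightDividesʳ b _)) (cong (_∙ b ⁻¹) e)))) }

      candidates∈ : ∀ i → Gen (candidates i)
      candidates∈ 0F = gen-∙ (S∈ 0F) (0F , 0F , refl)
      candidates∈ 1F = gen-∙ (S∈ 1F) (0F , 0F , refl)
      candidates∈ 2F = gen-product (S∈ 1F) (candidates∈ 0F)

      co-two : ∀ u w → u ~ w → ∃ λ v → Co u v × Co v w
      co-two u@(x , i) w@(y , j) p with middle (x ⁻¹ ∙ y)
      ... | k , (ε≢v , v≢z) , ≢v , v≢ = (x ∙ v , j) , (u~v , (λ e → ε≢v (sym (identityʳ-unique x v (sym (,-injectiveˡ e))))) ,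
              (λ { (l , e) → ≢v l (∙-cancelˡ x _ _ (,-injectiveˡ e)) })) ,
          (~-trans {x ∙ v , j} {u} {w} (~-sym {u} {x ∙ v , j} u~v) p , (λ e → v≢z (shift (,-injectiveˡ e))) ,
            λ { (l , e) → v≢ l (shift (trans (sym (assoc x v (pair l))) (,-injectiveˡ e))) })
        where
        v : Carrier
        v = candidates k
        u~v : u ~ (x ∙ v , j)
        u~v = ~-◁ u (candidates∈ k)
        shift : ∀ {t} → x ∙ t ≡ y → t ≡ x ⁻¹ ∙ y
        shift e = trans (sym (\\-leftDividesʳ x _)) (cong (x ⁻¹ ∙_) e)

      dihedral-good : Good
      dihedral-good = complement (voltageRep 0F labels) co-two
        λ u → step 0F u , step 1F u , (λ e → b≢c (sym (∙-cancelˡ (proj₁ u) _ _ (,-injectiveˡ e)))) , (0F , refl) , (1F , refl)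

-- A verified backtracking test for the absence of non-trivial automorphisms

module Backtracking {d : ℕ} (M : Vec (Vec Bool d) d) where
  edge : Fin d → Fin d → Bool
  edge k l = Vec.lookup (Vec.lookup M k) l

  compatible : Fin d × Fin d → Fin d × Fin d → Bool
  compatible (k , k′) (l , l′) = not (edge k l xor edge k′ l′) ∧
    (not (edge l k xor edge l′ k′) ∧ not (does (k Fin.≟ l) xor does (k′ Fin.≟ l′)))

  -- The first list contains the points without an image so far, the second one the partial map.
  rigid : List (Fin d) → List (Fin d × Fin d) → Bool
  rigid []       as = all (λ (k , k′) → does (k′ Fin.≟ k)) as
  rigid (k ∷ ks) as = all (λ k′ → not (all (compatible (k , k′)) as) ∨ rigid ks ((k , k′) ∷ as)) (allFin d)

  module _ (p : Fin d → Fin d) (p-inj : Injective _≡_ _≡_ p) (p-edge : ∀ k l → edge k l ≡ edge (p k) (p l)) where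
    private
      graph : List (Fin d) → List (Fin d × Fin d)
      graph = List.map (λ k → k , p k)

      same : ∀ {x y} → x ≡ y → T (not (x xor y))
      same {true}  refl = tt
      same {false} refl = tt

      _and_ : ∀ {x y} → T x → T y → T (x ∧ y)
      _and_ {true} _ y = y

      modus-ponens : ∀ {x y} → T x → T (not x ∨ y) → T y
      modus-ponens {true} _ y = y

      injective⇒does : ∀ k l → does (k Fin.≟ l) ≡ does (p k Fin.≟ p l)
      injective⇒does k l with k Fin.≟ l
      ... | yes e = sym (dec-true (p k Fin.≟ p l) (cong p e))
      ... | no ne = sym (dec-false (p k Fin.≟ p l) (ne ∘ p-inj))

      witness : ∀ {P : Set} (P? : Dec P) → T (does P?) → P
      witness (yes x) _ = x

      compatible-p : ∀ k l → T (compatible (k , p k) (l , p l))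
      compatible-p k l = same (p-edge k l) and (same (p-edge l k) and same (injective⇒does k l))

      compatible-graph : ∀ k js → T (all (compatible (k , p k)) (graph js))
      compatible-graph k []       = tt
      compatible-graph k (j ∷ js) = compatible-p k j and compatible-graph k js

    -- The branch assigning `p k` to each `k` is never pruned, since any two pairs in the graph of
    -- `p` are compatible. A successful run therefore reaches its leaf, where the assignment is
    -- compared with the identity.
    rigid-sound : ∀ ks js → T (rigid ks (graph js)) → ∀ {k} → k ∈ ks ⊎ k ∈ js → p k ≡ k
    rigid-sound [] js r {k} (inj₂ k∈) = witness (p k Fin.≟ k) (All.lookup (all⁺ _ (graph js) r) (∈-map⁺ (λ k → k , p k) k∈))
    rigid-sound (k ∷ ks) js r m = rigid-sound ks (k ∷ js)
      (modus-ponens (compatible-graph k js) (All.lookup (all⁺ _ (allFin d) r) (∈-allFin (p k)))) (moved m)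
      where
      moved : ∀ {l} → l ∈ k ∷ ks ⊎ l ∈ js → l ∈ ks ⊎ l ∈ k ∷ js
      moved (inj₁ (here e))  = inj₂ (here e)
      moved (inj₁ (there m)) = inj₁ m
      moved (inj₂ m)         = inj₂ (there m)

-- Embeddings of tables

module Embeddings (G : FinGroup) where
  open GroupTheory G
  open Cyclic G
  open Table using () renaming (Carrier to ∣_∣)

  record Embedding (A : Table) : Set where
    open Table A using () renaming (_·_ to infixl 7 _·_)
    field
      φ         : ∣ A ∣ → Carrier
      φ-·       : ∀ a b → φ (a · b) ≡ φ a ∙ φ b
      φ-inj     : ∀ {a b} → φ a ≡ φ b → a ≡ b
      cardinal  : ℕ
      numbering : ∣ A ∣ ↔ Fin cardinal

    module A = Finite numbering

    Image : Carrier → Set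
    Image x = ∃ λ a → φ a ≡ x

    image? : ∀ x → Dec (Image x)
    image? x = A.search (λ a → φ a ≟ x)

    surjective⇒≅ : (∀ x → Image x) → G ≅ A
    surjective⇒≅ onto = mk↔ₛ′ (proj₁ ∘ onto) φ (λ a → φ-inj (proj₂ (onto (φ a)))) (proj₂ ∘ onto) ,
      λ x y → φ-inj (trans (proj₂ (onto (x ∙ y)))
        (trans (sym (cong₂ _∙_ (proj₂ (onto x)) (proj₂ (onto y)))) (sym (φ-· _ _))))

  module Elementary (p-1 : ℕ) (exponent : ∀ x → suc p-1 ⋆ x ≡ ε) (comm : ∀ x y → x ∙ y ≡ y ∙ x)
      (prime : ∀ (K : Subgroup) x n → n < p-1 → Subgroup.Mem K (suc n ⋆ x) → Subgroup.Mem K x) where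

    p : ℕ
    p = suc p-1

    trivialˢ : Subgroup
    trivialˢ = record { Mem = _≡ ε ; Mem? = _≟ ε ; ε∈ = refl
      ; ∙∈ = λ { refl refl → identityˡ ε } ; ⁻¹∈ = λ { refl → ε⁻¹≈ε } }

    -- `prime` stands in for the primality of `p`: a power of `x` with exponent strictly between 0
    -- and `p` lies in `K` only if `x` does. Hence the cosets of `K` by these powers of `x` are
    -- distinct.
    powers-cancel : ∀ (K : Subgroup) {x} → ¬ Subgroup.Mem K x → ∀ i j → i < p → j < p →
                    ∀ {y z} → Subgroup.Mem K y → Subgroup.Mem K z → i ⋆ x ∙ y ≡ j ⋆ x ∙ z → i ≡ j
    powers-cancel K x∉ zero    zero    _ _ _ _ _ = refl
    powers-cancel K {x} x∉ zero (suc j) _ (s≤s lt) y∈ z∈ e =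
      contradiction (prime K x j lt (Subgroup.∙∈ˡ K z∈ (subst (Subgroup.Mem K) (trans (sym (identityˡ _)) e) y∈))) x∉
    powers-cancel K {x} x∉ (suc i) zero (s≤s lt) _ y∈ z∈ e =
      contradiction (prime K x i lt (Subgroup.∙∈ˡ K y∈ (subst (Subgroup.Mem K) (trans (sym (identityˡ _)) (sym e)) z∈))) x∉
    powers-cancel K {x} x∉ (suc i) (suc j) lt lt′ y∈ z∈ e = cong suc (powers-cancel K x∉ i j (ℕ.<⇒≤ lt) (ℕ.<⇒≤ lt′) y∈ z∈
      (∙-cancelˡ x _ _ (trans (shift i) (trans e (sym (shift j))))))
      where
      shift : ∀ i {y} → x ∙ (i ⋆ x ∙ y) ≡ suc i ⋆ x ∙ y
      shift i {y} = trans (sym (assoc x (i ⋆ x) y)) (cong (_∙ y) (sym (1+× i x)))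

    cyclic : ∀ {x} → x ≢ ε → Embedding (ℤ p)
    cyclic {x} x≢ε = record
      { φ = λ i → toℕ i ⋆ x
      ; φ-· = λ i j → trans (⋆-mod (exponent x) (toℕ i + toℕ j)) (×-homo-+ x (toℕ i) (toℕ j))
      ; φ-inj = λ {i} {j} e → Fin.toℕ-injective (powers-cancel trivialˢ x≢ε (toℕ i) (toℕ j) (Fin.toℕ<n i) (Fin.toℕ<n j)
          refl refl (cong (_∙ ε) e))
      ; cardinal = p
      ; numbering = ↔-refl
      }

    module _ {A : Table} (emb : Embedding A) where
      open Embedding emb
      open Table A using () renaming (_·_ to infixl 7 _·_)

      -- A `Table` names no identity, so one element `a₀` is needed to obtain `ε` as the power
      -- `p ⋆ φ a₀`; inverses are found among the powers as well.
      imageˢ : ∣ A ∣ → Subgroup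
      imageˢ a₀ = record { Mem = Image ; Mem? = image? ; ε∈ = subst Image (exponent (φ a₀)) (image-⋆ p-1 a₀)
          ; ∙∈ = ∙∈ ; ⁻¹∈ = λ { {x} (a , refl) → inv a p-1 (exponent (φ a)) } }
        where
        ∙∈ : ∀ {x y} → Image x → Image y → Image (x ∙ y)
        ∙∈ (a , refl) (b , refl) = a · b , φ-· a b
        image-⋆ : ∀ n a → Image (suc n ⋆ φ a)
        image-⋆ zero    a = a , refl
        image-⋆ (suc n) a = ∙∈ (image-⋆ n a) (a , refl)
        inv : ∀ a n → suc n ⋆ φ a ≡ ε → Image (φ a ⁻¹)
        inv a zero    e = a , trans e (trans (sym ε⁻¹≈ε) (cong _⁻¹ (sym e)))
        inv a (suc n) e = subst Image (inverseˡ-unique _ (φ a) e) (image-⋆ n a)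

      -- The new factor stands on the left, as in `ℤ₂³` and `ℤ₂⁴`, so that repeated extension
      -- produces these tables literally.
      extend : ∀ {x} → ¬ Image x → Embedding (ℤ p ⊗ A)
      extend {x} x∉ = record
        { φ = λ (i , a) → toℕ i ⋆ x ∙ φ a
        ; φ-· = λ (i , a) (j , b) → trans (cong₂ _∙_ (trans (⋆-mod (exponent x) (toℕ i + toℕ j)) (×-homo-+ x (toℕ i) (toℕ j))) (φ-· a b))
            (middle (toℕ i ⋆ x) (toℕ j ⋆ x) (φ a) (φ b))
        ; φ-inj = inj
        ; cardinal = p * cardinal
        ; numbering = ↔-trans (↔-refl ×-↔ numbering) (↔-sym Fin.*↔×)
        }
        where
        middle : ∀ s t y z → s ∙ t ∙ (y ∙ z) ≡ s ∙ y ∙ (t ∙ z)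
        middle s t y z = trans (assoc s t (y ∙ z)) (trans (cong (s ∙_) (trans (sym (assoc t y z))
          (trans (cong (_∙ z) (comm t y)) (assoc y t z)))) (sym (assoc s y (t ∙ z))))
        inj : ∀ {u v : Fin p × ∣ A ∣} → toℕ (proj₁ u) ⋆ x ∙ φ (proj₂ u) ≡ toℕ (proj₁ v) ⋆ x ∙ φ (proj₂ v) → u ≡ v
        inj {i , a} {j , b} e with Fin.toℕ-injective (powers-cancel (imageˢ a) x∉ (toℕ i) (toℕ j) (Fin.toℕ<n i) (Fin.toℕ<n j)
                                     (a , refl) (b , refl) e)
        ... | refl = cong (i ,_) (φ-inj (∙-cancelˡ (toℕ i ⋆ x) _ _ e))

-- Connection sets given by explicit tables

module ConnectionSet (A : Table) {N d : ℕ} (numbering : Table.Carrier A ↔ Fin N) (S : Fin d → Table.Carrier A) where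
  open Table A using () renaming (_·_ to infixl 7 _·_; Carrier to ∣A∣) public
  open Finite numbering using (_≟_) public

  localArc? : ∀ k l → Dec (∃ λ j → S k · S j ≡ S l)
  localArc? k l = Fin.any? λ j → S k · S j ≟ S l

  matrix : Vec (Vec Bool d) d
  matrix = Vec.tabulate λ k → Vec.tabulate λ l → does (localArc? k l)

  IsTriple : ∣A∣ → Set
  IsTriple a = ∃ λ j → ∃ λ k → ∃ λ l → S j · S k · S l ≡ a

  -- Statements about the table alone, settled by evaluation. `nontrivial` says that `S k` is not
  -- the identity, the only idempotent of a group; `triples` implies that `S` generates; `large` is
  -- the bound of `sparse-good`.
  record Certificate : Set where
    field
      distinct   : ∀ k l → S k ≡ S l → k ≡ l
      nontrivial : ∀ k → S k · S k ≢ S k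
      rigid      : T (Backtracking.rigid matrix (allFin d) [])
      triples    : ∀ i → IsTriple (Inverse.from numbering i)
      large      : 2 + (d + d) < N
      first second : Fin d
      first≢second : first ≢ second

  module _ (G : FinGroup) (emb : Embeddings.Embedding G A) (certificate : Certificate) where
    open GroupTheory G hiding (_≟_)
    open Representations G 1
    open VoltageGraphs G 1
    open CayleyDigraphs G
    open Embeddings.Embedding emb using (φ; φ-·; φ-inj)
    open Certificate certificate

    S≢ε : ∀ k → φ (S k) ≢ ε
    S≢ε k e = nontrivial k (φ-inj (trans (φ-· _ _) (trans (cong (_∙ φ (S k)) e) (identityˡ _))))

    S-inj : Injective _≡_ _≡_ (φ ∘ S)
    S-inj {k} {l} e = distinct k l (φ-inj e)

    open Cayley (φ ∘ S) S≢ε S-inj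

    φ-local : ∀ {k l} → LocalArc k l → ∃ λ j → S k · S j ≡ S l
    φ-local (j , e) = j , φ-inj (trans (φ-· _ _) e)

    local-φ : ∀ {k l} → (∃ λ j → S k · S j ≡ S l) → LocalArc k l
    local-φ (j , e) = j , trans (sym (φ-· _ _)) (cong φ e)

    asymmetric : Asymmetric
    asymmetric p p-inj p⁺ p⁻ k = Backtracking.rigid-sound matrix p p-inj edges (allFin d) [] rigid (inj₁ (∈-allFin k))
      where
      open Backtracking matrix using (edge)
      edge≡ : ∀ k l → edge k l ≡ does (localArc? k l)
      edge≡ k l = trans (cong (λ row → Vec.lookup row l) (lookup∘tabulate (λ k → Vec.tabulate λ l → does (localArc? k l)) k))
        (lookup∘tabulate (λ l → does (localArc? k l)) l)
      edges : ∀ k l → edge k l ≡ edge (p k) (p l)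
      edges k l = trans (edge≡ k l) (trans (V.does-⇔ (localArc? k l) (localArc? (p k) (p l))
        (φ-local ∘ p⁺ ∘ local-φ) (φ-local ∘ p⁻ ∘ local-φ)) (sym (edge≡ (p k) (p l))))

    explicit-good : Good
    explicit-good = sparse-good zero (asymmetric⇒labels asymmetric) first second first≢second
      (φ ∘ from) (λ e → trans (sym (strictlyInverseˡ _)) (trans (cong to (φ-inj e)) (strictlyInverseˡ _)))
      (λ i → member (triples i)) (subst (2 + (d + d) <_) (sym (ℕ.*-identityʳ N)) large)
      where
      open Inverse numbering
      member : ∀ {a} → IsTriple a → Gen (φ a)
      member (j , k , l , refl) = subst Gen (sym (trans (φ-· _ _) (cong (_∙ φ (S l)) (φ-· _ _))))
        (gen-product (gen-product (S∈ j) (S∈ k)) (S∈ l))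

  -- The types of the first five arguments evaluate to the unit type, so underscores are enough
  -- where this is applied.
  certify : (distinct : True (Fin.all? λ k → Fin.all? λ l → (S k ≟ S l) →-dec (k Fin.≟ l)))
            (nontrivial : True (Fin.all? λ k → ¬? (S k · S k ≟ S k)))
            (rigid : T (Backtracking.rigid matrix (allFin d) []))
            (triples : True (Fin.all? λ i → Fin.any? λ j → Fin.any? λ k → Fin.any? λ l → S j · S k · S l ≟ Inverse.from numbering i))
            (large : True (2 + (d + d) <? N)) (first second : Fin d) → first ≢ second → Certificate
  certify distinct nontrivial rigid triples large first second first≢second = record
    { distinct = toWitness distinct ; nontrivial = toWitness nontrivial ; rigid = rigid
    ; triples = toWitness triples ; large = toWitness large
    ; first = first ; second = second ; first≢second = first≢second }

-- Explicit connection sets in ℤ₃³ and ℤ₂⁵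

_⊗ⁿ_ : ∀ {A B : Table} {M N} → Table.Carrier A ↔ Fin M → Table.Carrier B ↔ Fin N → Table.Carrier (A ⊗ B) ↔ Fin (M * N)
f ⊗ⁿ g = ↔-trans (f ×-↔ g) (↔-sym Fin.*↔×)

ℤ₃³ ℤ₂⁵ : Table
ℤ₃³ = ℤ₃ ⊗ ℤ₃²
ℤ₂⁵ = ℤ₂ ⊗ ℤ₂⁴

ℤ₃³-numbering : Table.Carrier ℤ₃³ ↔ Fin 27
ℤ₃³-numbering = _⊗ⁿ_ {ℤ₃} {ℤ₃²} ↔-refl (_⊗ⁿ_ {ℤ₃} {ℤ₃} ↔-refl ↔-refl)

ℤ₂⁵-numbering : Table.Carrier ℤ₂⁵ ↔ Fin 32
ℤ₂⁵-numbering = _⊗ⁿ_ {ℤ₂} {ℤ₂⁴} ↔-refl (_⊗ⁿ_ {ℤ₂} {ℤ₂³} ↔-refl (_⊗ⁿ_ {ℤ₂} {ℤ₂²} ↔-refl (_⊗ⁿ_ {ℤ₂} {ℤ₂} ↔-refl ↔-refl)))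

-- The elements (1,0,0), (0,1,0), (0,0,1), (2,1,1), (2,2,1), (2,2,2), found by computer search.
module Cube = ConnectionSet ℤ₃³ ℤ₃³-numbering
  (Vec.lookup (Vec.map (Inverse.from ℤ₃³-numbering) (# 9 ∷ # 3 ∷ # 1 ∷ # 22 ∷ # 25 ∷ # 26 ∷ [])))

cube-certificate : Cube.Certificate
cube-certificate = Cube.certify _ _ _ _ _ (# 0) (# 1) λ ()

-- Elements are numbered by their binary digits. The set was found by computer search, in an order which
-- keeps the backtracking short.
module Penteract = ConnectionSet ℤ₂⁵ ℤ₂⁵-numbering
  (Vec.lookup (Vec.map (Inverse.from ℤ₂⁵-numbering)
    (# 31 ∷ # 21 ∷ # 10 ∷ # 16 ∷ # 2 ∷ # 4 ∷ # 20 ∷ # 6 ∷ # 18 ∷ # 1 ∷ # 5 ∷ # 27 ∷ # 8 ∷ [])))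

penteract-certificate : Penteract.Certificate
penteract-certificate = Penteract.certify _ _ _ _ _ (# 0) (# 1) λ ()

-- Searching for elements, and groups of exponent two or three

module Elements (G : FinGroup) where
  open GroupTheory G
  open Cyclic G

  ∃-or-∀¬ : ∀ {P : Carrier → Set} → (∀ x → Dec (P x)) → ∃ P ⊎ (∀ x → ¬ P x)
  ∃-or-∀¬ P? with search P?
  ... | yes p = inj₁ p
  ... | no ¬p = inj₂ λ x px → ¬p (x , px)

  nontrivial-or-trivial : (∃ λ a → a ≢ ε) ⊎ (∀ x → x ≡ ε)
  nontrivial-or-trivial = Sum.map₂ (λ h x → decidable-stable (x ≟ ε) (h x)) (∃-or-∀¬ λ x → ¬? (x ≟ ε))

  trivial⇒≅ℤ₁ : (∀ x → x ≡ ε) → G ≅ ℤ₁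
  trivial⇒≅ℤ₁ trivial = mk↔ₛ′ (λ _ → zero) (λ _ → ε) (λ { zero → refl }) (λ x → sym (trivial x)) , λ _ _ → refl

  squares⇒comm : (∀ x → x ∙ x ≡ ε) → ∀ x y → x ∙ y ≡ y ∙ x
  squares⇒comm x²≡ε x y = trans (inverseˡ-unique (x ∙ y) (x ∙ y) (x²≡ε (x ∙ y)))
    (trans (⁻¹-anti-homo-∙ x y) (sym (cong₂ _∙_ (inverseˡ-unique y y (x²≡ε y)) (inverseˡ-unique x x (x²≡ε x)))))

  root-of-power₂ : ∀ (K : Subgroup) x n → n < 1 → Subgroup.Mem K (suc n ⋆ x) → Subgroup.Mem K x
  root-of-power₂ K x 0 _ x∈ = x∈
  root-of-power₂ K x (suc _) (s≤s ()) _

  module Squares (x²≡ε : ∀ x → x ∙ x ≡ ε) = Embeddings.Elementary G 1 x²≡ε (squares⇒comm x²≡ε) root-of-power₂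

  cube-square : ∀ {x} → 3 ⋆ x ≡ ε → x ∙ x ∙ (x ∙ x) ≡ x
  cube-square {x} x³≡ε = trans (sym (assoc (x ∙ x) x x)) (trans (cong (_∙ x) x³≡ε) (identityˡ x))

  root-of-power₃ : (∀ x → 3 ⋆ x ≡ ε) → ∀ (K : Subgroup) x n → n < 2 → Subgroup.Mem K (suc n ⋆ x) → Subgroup.Mem K x
  root-of-power₃ x³≡ε K x 0 _ x∈ = x∈
  root-of-power₃ x³≡ε K x 1 _ x∈ = subst (Subgroup.Mem K) (cube-square (x³≡ε x)) (Subgroup.∙∈ K x∈ x∈)
  root-of-power₃ x³≡ε K x (suc (suc _)) (s≤s (s≤s ())) _

  module Cubes (x³≡ε : ∀ x → 3 ⋆ x ≡ ε) (comm : ∀ x y → x ∙ y ≡ y ∙ x) =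
    Embeddings.Elementary G 2 x³≡ε comm (root-of-power₃ x³≡ε)

-- At least two orbits

module SeveralOrbits (G : FinGroup) where
  open GroupTheory G
  open Cyclic G
  open CayleyDigraphs G using (triple; triple-injective)
  open Elements G

  -- The elements `ε`, `a`, `b`, `a ∙ b` on two orbits give eight vertices, more than six. Without
  -- such a `b` every element is `ε`, `a` or `a ⁻¹`. The group is then ℤ₂, or it has order three:
  -- six vertices are too few for the counting, but the digraph with voltages `a` and `a ⁻¹` already
  -- covers the whole group.
  two-orbits : HasDRR 2 G ⊎ (G ≅ ℤ₁ ⊎ G ≅ ℤ₂)
  two-orbits with nontrivial-or-trivial
  ... | inj₂ trivial = inj₂ (inj₁ (trivial⇒≅ℤ₁ trivial))
  ... | inj₁ (a , a≢ε) with ∃-or-∀¬ (λ b → ¬? (b ≟ ε) ×-dec ¬? (a ≟ b) ×-dec ¬? (a ∙ b ≟ ε))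
  ...   | inj₁ (b , b≢ε , a≢b , ab≢ε) = inj₁ (good⇒DRR zero (sparse-good zero labels zero (suc zero) (λ ())
          elements elements-inj elements∈ (from-yes (6 ℕ.<? 8))))
    where
    open Representations G 2
    open VoltageGraphs G 2
    open TwoOrbits G a≢ε b≢ε a≢b
    open Voltage 𝓥
    elements : Fin 4 → Carrier
    elements = append (triple ε a b) (λ (_ : Fin 1) → a ∙ b)
    elements-inj : Injective _≡_ _≡_ elements
    elements-inj = append-injective (triple ε a b) (λ _ → a ∙ b) (triple-injective (a≢ε ∘ sym) (b≢ε ∘ sym) a≢b)
      (λ { {zero} {zero} _ → refl })
      λ { zero _ e → ab≢ε (sym e)
        ; (suc zero) _ e → b≢ε (identityʳ-unique a b (sym e))
        ; (suc (suc zero)) _ e → a≢ε (identityˡ-unique a b (sym e)) }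
    a∈ : Gen a
    a∈ = gen-X (zero , zero , refl)
    b∈ : Gen b
    b∈ = gen-X (zero , suc zero , refl)
    elements∈ : ∀ i → Gen (elements i)
    elements∈ = append-∈ (triple ε a b) (λ _ → a ∙ b) {Gen}
      (λ { zero → gen-ε ; (suc zero) → a∈ ; (suc (suc zero)) → b∈ }) (λ _ → gen-product a∈ b∈)
  ...   | inj₂ few with a ∙ a ≟ ε
  ...     | yes a²≡ε = inj₂ (inj₂ (Embeddings.Embedding.surjective⇒≅ (Squares.cyclic squares a≢ε) onto))
    where
    either : ∀ x → x ≡ ε ⊎ x ≡ a
    either x with x ≟ ε | a ≟ x
    ... | yes e | _     = inj₁ e
    ... | no _  | yes e = inj₂ (sym e)
    ... | no ne | no nf = inj₂ (∙-cancelˡ a x a (trans (decidable-stable (a ∙ x ≟ ε) (λ ng → few x (ne , nf , ng))) (sym a²≡ε)))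
    squares : ∀ x → x ∙ x ≡ ε
    squares x with either x
    ... | inj₁ refl = identityˡ ε
    ... | inj₂ refl = a²≡ε
    onto : ∀ x → ∃ λ (i : Fin 2) → toℕ i ⋆ a ≡ x
    onto x with either x
    ... | inj₁ e = zero , sym e
    ... | inj₂ e = suc zero , sym e
  ...     | no a²≢ε = inj₁ (rep⇒DRR zero (voltageRep zero labels) full)
    where
    open Representations G 2
    open VoltageGraphs G 2
    a⁻¹≢ε : a ⁻¹ ≢ ε
    a⁻¹≢ε e = a≢ε (trans (sym (identityʳ a)) (trans (cong (a ∙_) (sym e)) (inverseʳ a)))
    a≢a⁻¹ : a ≢ a ⁻¹
    a≢a⁻¹ e = a²≢ε (trans (cong (a ∙_) e) (inverseʳ a))
    open TwoOrbits G a≢ε a⁻¹≢ε a≢a⁻¹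
    open Voltage 𝓥
    full : ∀ x → Gen x
    full x with x ≟ ε | a ≟ x
    ... | yes refl | _     = gen-ε
    ... | no _  | yes refl = gen-X (zero , zero , refl)
    ... | no ne | no nf = gen-X (zero , suc zero , sym (inverseʳ-unique a x
                            (decidable-stable (a ∙ x ≟ ε) (λ ng → few x (ne , nf , ng)))))

  module _ (N : ℕ) {a : Carrier} (a≢ε : a ≢ ε) where
    open Representations G (3 + N)
    open VoltageGraphs G (3 + N)
    open ManyOrbits G N a≢ε
    open Voltage 𝓥

    a∈ : Gen a
    a∈ = gen-X (suc zero , zero , refl)

    many-orbits : (k : ℕ) → (∀ n → n < k → suc n ⋆ a ≢ ε) → 6 < suc k * (3 + N) → HasDRR (3 + N) G
    many-orbits k ne lt = good⇒DRR zero (sparse-good zero labels zero (suc zero) (λ ()) (λ i → toℕ i ⋆ a)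
      (powers-injective a ne) (λ i → power∈ ⟨X⟩ a∈ (toℕ i)) lt)

    many-orbits-cyclic : (∀ x → Gen x) → HasDRR (3 + N) G
    many-orbits-cyclic = rep⇒DRR zero (voltageRep zero labels)

  -- For four or more orbits `ε` and `a` already give eight vertices. On three orbits nine are
  -- obtained from an element with nontrivial square, or else from `ε`, `a` and a second involution;
  -- the group of order two carries the digraph on six vertices itself.
  at-least-three-orbits : ∀ N → HasDRR (3 + N) G ⊎ (3 + N ≤ 5 × G ≅ ℤ₁)
  at-least-three-orbits N with nontrivial-or-trivial
  at-least-three-orbits 0 | inj₂ trivial = inj₂ (from-yes (3 ℕ.≤? 5) , trivial⇒≅ℤ₁ trivial)
  at-least-three-orbits 1 | inj₂ trivial = inj₂ (from-yes (4 ℕ.≤? 5) , trivial⇒≅ℤ₁ trivial)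
  at-least-three-orbits 2 | inj₂ trivial = inj₂ (from-yes (5 ℕ.≤? 5) , trivial⇒≅ℤ₁ trivial)
  at-least-three-orbits (suc (suc (suc N))) | inj₂ trivial = inj₁ (TrivialGroup.trivial-DRR G N trivial)
  at-least-three-orbits (suc N) | inj₁ (a , a≢ε) = inj₁ (many-orbits (suc N) a≢ε 1 (λ { 0 _ → a≢ε ; (suc _) (s≤s ()) })
    (ℕ.≤-trans (from-yes (7 ℕ.≤? 8)) (ℕ.*-monoʳ-≤ 2 (ℕ.m≤m+n 4 N))))
  at-least-three-orbits 0 | inj₁ (a , a≢ε) with ∃-or-∀¬ (λ c → ¬? (c ∙ c ≟ ε))
  ... | inj₁ (c , c²≢ε) = inj₁ (many-orbits 0 c≢ε 2 (below₂ c≢ε c²≢ε) (from-yes (6 ℕ.<? 9)))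
    where
    c≢ε : c ≢ ε
    c≢ε refl = c²≢ε (identityˡ ε)
  ... | inj₂ squares with ∃-or-∀¬ (λ b → ¬? (b ≟ ε) ×-dec ¬? (a ≟ b))
  ...   | inj₁ (b , b≢ε , a≢b) = inj₁ (good⇒DRR zero (sparse-good zero labels zero (suc zero) (λ ())
          (triple ε a b) (triple-injective (a≢ε ∘ sym) (b≢ε ∘ sym) a≢b)
          (λ { zero → gen-ε ; (suc zero) → gen-X (suc zero , zero , refl) ; (suc (suc zero)) → gen-X (zero , suc (suc zero) , refl) })
          (from-yes (6 ℕ.<? 9))))
    where
    open Representations G 3
    open VoltageGraphs G 3
    a²≡ε : a ∙ a ≡ ε
    a²≡ε = decidable-stable (a ∙ a ≟ ε) (squares a)
    open ThreeOrbits G a≢ε b≢ε a≢b a²≡ε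
    open Voltage 𝓥
  ...   | inj₂ few = inj₁ (many-orbits-cyclic 0 a≢ε full)
    where
    open VoltageGraphs G 3
    open ManyOrbits G 0 a≢ε
    open Voltage 𝓥
    full : ∀ x → Gen x
    full x with x ≟ ε | a ≟ x
    ... | yes refl | _        = gen-ε
    ... | no _     | yes refl = gen-X (suc zero , zero , refl)
    ... | no ne    | no nf    = contradiction (ne , nf) (few x)

-- The quaternion group

module Quaternion (G : FinGroup) where
  open GroupTheory G
  open Cyclic G

  module _ {c b : Carrier} (c²≢ε : c ∙ c ≢ ε) (c⁴≡ε : 4 ⋆ c ≡ ε) (b∉ : ¬ ⟨_⟩.Gen c b)
      (outside : ∀ x → ¬ ⟨_⟩.Gen c x → x ∙ x ≡ c ∙ c) where
    private module C = ⟨_⟩ c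

    z : Carrier
    z = c ∙ c

    z²≡ε : z ∙ z ≡ ε
    z²≡ε = trans (sym (assoc z c c)) c⁴≡ε

    c≢ε : c ≢ ε
    c≢ε e = c²≢ε (trans (cong (_∙ c) e) (trans (identityˡ c) e))

    zc≢ε : z ∙ c ≢ ε
    zc≢ε e = c≢ε (trans (sym (identityˡ c)) (trans (cong (_∙ c) (sym e)) c⁴≡ε))

    -- With `x` also `x ∙ c` lies outside `⟨ c ⟩`, so both have the square `c ∙ c`; cancelling `x`
    -- shows that `x` inverts `c`.
    conjugate : ∀ {x} → ¬ C.Gen x → c ∙ x ∙ c ≡ x
    conjugate {x} x∉ = ∙-cancelˡ x _ _ (begin
      x ∙ (c ∙ x ∙ c)   ≡⟨ cong (x ∙_) (assoc c x c) ⟩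
      x ∙ (c ∙ (x ∙ c)) ≡⟨ assoc x c (x ∙ c) ⟨
      x ∙ c ∙ (x ∙ c)   ≡⟨ outside (x ∙ c) (x∉ ∘ C.∙∈ˡ C.c∈) ⟩
      c ∙ c             ≡⟨ outside x x∉ ⟨
      x ∙ x             ∎)
      where open ≡-Reasoning

    xc≡zcx : ∀ {x} → ¬ C.Gen x → x ∙ c ≡ z ∙ (c ∙ x)
    xc≡zcx {x} x∉ = ∙-cancelˡ c _ _ (begin
      c ∙ (x ∙ c)       ≡⟨ assoc c x c ⟨
      c ∙ x ∙ c         ≡⟨ conjugate x∉ ⟩
      x                 ≡⟨ identityˡ x ⟨
      ε ∙ x             ≡⟨ cong (_∙ x) z²≡ε ⟨
      z ∙ z ∙ x         ≡⟨ assoc z z x ⟩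
      c ∙ c ∙ (z ∙ x)   ≡⟨ assoc c c (z ∙ x) ⟩
      c ∙ (c ∙ (z ∙ x)) ≡⟨ cong (λ t → c ∙ t) (trans (sym (assoc c z x)) (trans (cong (_∙ x) (sym (assoc c c c))) (assoc z c x))) ⟩
      c ∙ (z ∙ (c ∙ x)) ∎)
      where open ≡-Reasoning

    xz≡zx : ∀ {x} → ¬ C.Gen x → x ∙ z ≡ z ∙ x
    xz≡zx {x} x∉ = trans (cong (x ∙_) (sym (outside x x∉))) (trans (sym (assoc x x x)) (cong (_∙ x) (outside x x∉)))

    zc≡cz : z ∙ c ≡ c ∙ z
    zc≡cz = assoc c c c

    -- Both `b` and `x` invert `c`, so their product centralises it. If `b ∙ x` were outside `⟨ c ⟩`
    -- it would invert `c` as well, and `c ∙ c` would be trivial. Hence `⟨ c ⟩` has index two.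
    cosets-two : ∀ {x} → ¬ C.Gen x → C.Gen (b ∙ x)
    cosets-two {x} x∉ = decidable-stable (C.Gen? (b ∙ x)) λ bx∉ → c²≢ε (sym (∙-cancelʳ (c ∙ (b ∙ x)) _ _ (begin
      ε ∙ (c ∙ (b ∙ x))       ≡⟨ identityˡ _ ⟩
      c ∙ (b ∙ x)             ≡⟨ identityˡ _ ⟨
      ε ∙ (c ∙ (b ∙ x))       ≡⟨ cong (_∙ (c ∙ (b ∙ x))) z²≡ε ⟨
      z ∙ z ∙ (c ∙ (b ∙ x))   ≡⟨ assoc z z _ ⟩
      z ∙ (z ∙ (c ∙ (b ∙ x))) ≡⟨ cong (z ∙_) (begin
        z ∙ (c ∙ (b ∙ x))       ≡⟨ cong (z ∙_) (assoc c b x) ⟨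
        z ∙ (c ∙ b ∙ x)         ≡⟨ assoc z (c ∙ b) x ⟨
        z ∙ (c ∙ b) ∙ x         ≡⟨ cong (_∙ x) (xc≡zcx b∉) ⟨
        b ∙ c ∙ x               ≡⟨ assoc b c x ⟩
        b ∙ (c ∙ x)             ≡⟨ cong (b ∙_) cx ⟩
        b ∙ (z ∙ (x ∙ c))       ≡⟨ assoc b z (x ∙ c) ⟨
        b ∙ z ∙ (x ∙ c)         ≡⟨ cong (_∙ (x ∙ c)) (xz≡zx b∉) ⟩
        z ∙ b ∙ (x ∙ c)         ≡⟨ assoc z b (x ∙ c) ⟩
        z ∙ (b ∙ (x ∙ c))       ≡⟨ cong (z ∙_) (assoc b x c) ⟨
        z ∙ (b ∙ x ∙ c)         ≡⟨ cong (z ∙_) (xc≡zcx bx∉) ⟩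
        z ∙ (z ∙ (c ∙ (b ∙ x))) ≡⟨ assoc z z _ ⟨
        z ∙ z ∙ (c ∙ (b ∙ x))   ≡⟨ cong (_∙ (c ∙ (b ∙ x))) z²≡ε ⟩
        ε ∙ (c ∙ (b ∙ x))       ≡⟨ identityˡ _ ⟩
        c ∙ (b ∙ x)             ∎) ⟩
      z ∙ (c ∙ (b ∙ x))       ∎)))
      where
      open ≡-Reasoning
      cx : c ∙ x ≡ z ∙ (x ∙ c)
      cx = sym (trans (cong (z ∙_) (xc≡zcx x∉)) (trans (sym (assoc z z (c ∙ x))) (trans (cong (_∙ (c ∙ x)) z²≡ε) (identityˡ _))))

    sign : Bool → Carrier
    sign false = ε
    sign true  = z

    unit : Unit4 → Carrier
    unit 𝟏 = ε
    unit 𝐢 = c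
    unit 𝐣 = b
    unit 𝐤 = c ∙ b

    φ : Bool × Unit4 → Carrier
    φ (s , u) = sign s ∙ unit u

    sign-∙ : ∀ s t → sign s ∙ sign t ≡ sign (s xor t)
    sign-∙ false t     = identityˡ _
    sign-∙ true  false = identityʳ z
    sign-∙ true  true  = z²≡ε

    sign-central : ∀ t u → unit u ∙ sign t ≡ sign t ∙ unit u
    sign-central false u = trans (identityʳ _) (sym (identityˡ _))
    sign-central true  𝟏 = trans (identityˡ z) (sym (identityʳ z))
    sign-central true  𝐢 = sym zc≡cz
    sign-central true  𝐣 = xz≡zx b∉
    sign-central true  𝐤 = trans (assoc c b z) (trans (cong (c ∙_) (xz≡zx b∉)) (trans (sym (assoc c z b))
      (trans (cong (_∙ b) (sym zc≡cz)) (assoc z c b))))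

    cb∉ : ¬ C.Gen (c ∙ b)
    cb∉ = b∉ ∘ C.∙∈ʳ C.c∈

    bcb≡c : b ∙ (c ∙ b) ≡ c
    bcb≡c = ∙-cancelˡ c _ _ (trans (sym (assoc c b (c ∙ b))) (outside (c ∙ b) cb∉))

    unit-∙ : ∀ u v → unit u ∙ unit v ≡ φ (mulU u v)
    unit-∙ 𝟏 v = refl
    unit-∙ 𝐢 𝟏 = trans (identityʳ c) (sym (identityˡ c))
    unit-∙ 𝐢 𝐢 = sym (identityʳ z)
    unit-∙ 𝐢 𝐣 = sym (identityˡ _)
    unit-∙ 𝐢 𝐤 = sym (assoc c c b)
    unit-∙ 𝐣 𝟏 = trans (identityʳ b) (sym (identityˡ b))
    unit-∙ 𝐣 𝐢 = xc≡zcx b∉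
    unit-∙ 𝐣 𝐣 = trans (outside b b∉) (sym (identityʳ z))
    unit-∙ 𝐣 𝐤 = trans bcb≡c (sym (identityˡ c))
    unit-∙ 𝐤 𝟏 = trans (identityʳ _) (sym (identityˡ _))
    unit-∙ 𝐤 𝐢 = trans (conjugate b∉) (sym (identityˡ b))
    unit-∙ 𝐤 𝐣 = trans (assoc c b b) (trans (cong (c ∙_) (outside b b∉)) (sym zc≡cz))
    unit-∙ 𝐤 𝐤 = trans (outside (c ∙ b) cb∉) (sym (identityʳ z))

    φ-∙ : ∀ p q → φ (mulQ p q) ≡ φ p ∙ φ q
    φ-∙ (s , u) (t , v) = sym (begin
      sign s ∙ unit u ∙ (sign t ∙ unit v)   ≡⟨ assoc (sign s) (unit u) _ ⟩
      sign s ∙ (unit u ∙ (sign t ∙ unit v)) ≡⟨ cong (sign s ∙_) (assoc (unit u) (sign t) (unit v)) ⟨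
      sign s ∙ (unit u ∙ sign t ∙ unit v)   ≡⟨ cong (λ x → sign s ∙ (x ∙ unit v)) (sign-central t u) ⟩
      sign s ∙ (sign t ∙ unit u ∙ unit v)   ≡⟨ cong (sign s ∙_) (assoc (sign t) (unit u) (unit v)) ⟩
      sign s ∙ (sign t ∙ (unit u ∙ unit v)) ≡⟨ assoc (sign s) (sign t) _ ⟨
      sign s ∙ sign t ∙ (unit u ∙ unit v)   ≡⟨ cong₂ _∙_ (sign-∙ s t) (unit-∙ u v) ⟩
      sign (s xor t) ∙ φ (mulU u v)         ≡⟨ assoc (sign (s xor t)) _ _ ⟨
      sign (s xor t) ∙ sign (proj₁ (mulU u v)) ∙ unit (proj₂ (mulU u v)) ≡⟨ cong (_∙ unit (proj₂ (mulU u v))) (sign-∙ (s xor t) (proj₁ (mulU u v))) ⟩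
      φ (mulQ (s , u) (t , v))              ∎)
      where open ≡-Reasoning

    sign∈ : ∀ s → C.Gen (sign s)
    sign∈ false = C.gen-ε
    sign∈ true  = C.powers∈ 2

    sign-inj : ∀ s t → sign s ≡ sign t → s ≡ t
    sign-inj false false _ = refl
    sign-inj false true  e = contradiction (sym e) c²≢ε
    sign-inj true  false e = contradiction e c²≢ε
    sign-inj true  true  _ = refl

    sign≢sign-c : ∀ s t → sign s ≢ sign t ∙ c
    sign≢sign-c false false e = c≢ε (trans (sym (identityˡ c)) (sym e))
    sign≢sign-c false true  e = zc≢ε (sym e)
    sign≢sign-c true  false e = c≢ε (∙-cancelˡ c _ _ (trans (trans e (identityˡ c)) (sym (identityʳ c))))
    sign≢sign-c true  true  e = c≢ε (identityʳ-unique z c (sym e))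

    apart : ∀ {x y} → C.Gen x → ¬ C.Gen y → x ≢ y
    apart x∈ y∉ e = y∉ (subst C.Gen e x∈)

    sign-b∉ : ∀ s → ¬ C.Gen (sign s ∙ b)
    sign-b∉ s = b∉ ∘ C.∙∈ʳ (sign∈ s)

    sign-cb∉ : ∀ s → ¬ C.Gen (sign s ∙ (c ∙ b))
    sign-cb∉ s = cb∉ ∘ C.∙∈ʳ (sign∈ s)

    sign-ε∈ : ∀ s → C.Gen (sign s ∙ ε)
    sign-ε∈ s = C.gen-product (sign∈ s) C.gen-ε

    sign-c∈ : ∀ s → C.Gen (sign s ∙ c)
    sign-c∈ s = C.gen-product (sign∈ s) C.c∈

    φ-inj : ∀ p q → φ p ≡ φ q → p ≡ q
    φ-inj (s , 𝟏) (t , 𝟏) e = cong (_, 𝟏) (sign-inj s t (∙-cancelʳ ε _ _ e))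
    φ-inj (s , 𝟏) (t , 𝐢) e = contradiction (trans (sym (identityʳ _)) e) (sign≢sign-c s t)
    φ-inj (s , 𝟏) (t , 𝐣) e = contradiction e (apart (sign-ε∈ s) (sign-b∉ t))
    φ-inj (s , 𝟏) (t , 𝐤) e = contradiction e (apart (sign-ε∈ s) (sign-cb∉ t))
    φ-inj (s , 𝐢) (t , 𝟏) e = contradiction (trans (sym (identityʳ _)) (sym e)) (sign≢sign-c t s)
    φ-inj (s , 𝐢) (t , 𝐢) e = cong (_, 𝐢) (sign-inj s t (∙-cancelʳ c _ _ e))
    φ-inj (s , 𝐢) (t , 𝐣) e = contradiction e (apart (sign-c∈ s) (sign-b∉ t))
    φ-inj (s , 𝐢) (t , 𝐤) e = contradiction e (apart (sign-c∈ s) (sign-cb∉ t))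
    φ-inj (s , 𝐣) (t , 𝟏) e = contradiction (sym e) (apart (sign-ε∈ t) (sign-b∉ s))
    φ-inj (s , 𝐣) (t , 𝐢) e = contradiction (sym e) (apart (sign-c∈ t) (sign-b∉ s))
    φ-inj (s , 𝐣) (t , 𝐣) e = cong (_, 𝐣) (sign-inj s t (∙-cancelʳ b _ _ e))
    φ-inj (s , 𝐣) (t , 𝐤) e = contradiction (∙-cancelʳ b _ _ (trans e (sym (assoc (sign t) c b)))) (sign≢sign-c s t)
    φ-inj (s , 𝐤) (t , 𝟏) e = contradiction (sym e) (apart (sign-ε∈ t) (sign-cb∉ s))
    φ-inj (s , 𝐤) (t , 𝐢) e = contradiction (sym e) (apart (sign-c∈ t) (sign-cb∉ s))
    φ-inj (s , 𝐤) (t , 𝐣) e = contradiction (∙-cancelʳ b _ _ (trans (sym e) (sym (assoc (sign s) c b)))) (sign≢sign-c t s)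
    φ-inj (s , 𝐤) (t , 𝐤) e = cong (_, 𝐤) (sign-inj s t (∙-cancelʳ (c ∙ b) _ _ e))

    Image : Carrier → Set
    Image x = ∃ λ p → φ p ≡ x

    image-∙ : ∀ {x y} → Image x → Image y → Image (x ∙ y)
    image-∙ (p , refl) (q , refl) = mulQ p q , φ-∙ p q

    on-powers : ∀ {x} → (∃ λ (i : Fin 4) → toℕ i ⋆ c ≡ x) → Image x
    on-powers (zero , refl)                   = (false , 𝟏) , identityˡ ε
    on-powers (suc zero , refl)               = (false , 𝐢) , identityˡ c
    on-powers (suc (suc zero) , refl)         = (true , 𝟏) , identityʳ z
    on-powers (suc (suc (suc zero)) , refl)   = (true , 𝐢) , refl

    onto : ∀ x → Image x
    onto x with C.Gen? x
    ... | yes x∈ = on-powers (finite-powers c⁴≡ε x∈)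
    -- `b ∙ x` lies in `⟨ c ⟩`, and `z ∙ b` is the inverse of `b`.
    ... | no x∉ = subst Image (begin
          z ∙ (b ∙ (b ∙ x)) ≡⟨ cong (z ∙_) (assoc b b x) ⟨
          z ∙ (b ∙ b ∙ x)   ≡⟨ cong (λ y → z ∙ (y ∙ x)) (outside b b∉) ⟩
          z ∙ (z ∙ x)       ≡⟨ assoc z z x ⟨
          z ∙ z ∙ x         ≡⟨ cong (_∙ x) z²≡ε ⟩
          ε ∙ x             ≡⟨ identityˡ x ⟩
          x                 ∎)
        (image-∙ ((true , 𝟏) , identityʳ z) (image-∙ ((false , 𝐣) , identityˡ b) (on-powers (finite-powers c⁴≡ε (cosets-two x∉)))))
      where
      open ≡-Reasoning

    ≅Q₈ : G ≅ Q₈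
    ≅Q₈ = mk↔ₛ′ (proj₁ ∘ onto) φ (λ p → φ-inj _ _ (proj₂ (onto (φ p)))) (proj₂ ∘ onto) ,
      λ x y → φ-inj _ _ (trans (proj₂ (onto (x ∙ y))) (trans (sym (cong₂ _∙_ (proj₂ (onto x)) (proj₂ (onto y))))
        (sym (φ-∙ (proj₁ (onto x)) (proj₁ (onto y))))))

-- One orbit

module OneOrbit (G : FinGroup) where
  open GroupTheory G
  open Cyclic G
  open CayleyDigraphs G
  open Representations G 1
  open Elements G
  open Embeddings G

  Exceptional : Set
  Exceptional = G ≅ Q₈ ⊎ G ≅ ℤ₂² ⊎ G ≅ ℤ₂³ ⊎ G ≅ ℤ₂⁴ ⊎ G ≅ ℤ₃²

  Result : Set
  Result = HasDRR 1 G ⊎ Exceptional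

  good : Good → Result
  good = inj₁ ∘ good⇒DRR zero

  outside? : ∀ c → (∃ λ b → ¬ ⟨_⟩.Gen c b) ⊎ (∀ x → ⟨_⟩.Gen c x)
  outside? c = Sum.map₂ (λ h x → decidable-stable (⟨_⟩.Gen? c x) (h x)) (∃-or-∀¬ λ b → ¬? (⟨_⟩.Gen? c b))

  missed : ∀ {A} (emb : Embedding A) → (∃ λ x → ¬ Embedding.Image emb x) ⊎ (∀ x → Embedding.Image emb x)
  missed emb = Sum.map₂ (λ h x → decidable-stable (Embedding.image? emb x) (h x)) (∃-or-∀¬ λ x → ¬? (Embedding.image? emb x))

  OrderAtLeast5 OrderAtLeast4 : Carrier → Set
  OrderAtLeast4 c = c ≢ ε × 2 ⋆ c ≢ ε × 3 ⋆ c ≢ ε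
  OrderAtLeast5 c = OrderAtLeast4 c × 4 ⋆ c ≢ ε

  orderAtLeast4? : ∀ c → Dec (OrderAtLeast4 c)
  orderAtLeast4? c = ¬? (c ≟ ε) ×-dec ¬? (2 ⋆ c ≟ ε) ×-dec ¬? (3 ⋆ c ≟ ε)

  orderAtLeast5? : ∀ c → Dec (OrderAtLeast5 c)
  orderAtLeast5? c = orderAtLeast4? c ×-dec ¬? (4 ⋆ c ≟ ε)

  module _ {c b : Carrier} (order : OrderAtLeast5 c) (b∉ : ¬ ⟨_⟩.Gen c b) where
    large-order : b ∙ b ≢ c → b ∙ b ≢ c ∙ c → Good
    large-order b²≢c b²≢c² = Square.good c≢ε c²≢ε c³≢ε b∉ b²≢c b²≢c² cosets cosets-inj
      (cosets∈ ⟨X⟩ (S∈ zero) (S∈ (suc (suc zero)))) (from-yes (8 ℕ.<? 10))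
      where
      c≢ε = proj₁ (proj₁ order)
      c²≢ε = proj₁ (proj₂ (proj₁ order))
      c³≢ε = proj₂ (proj₂ (proj₁ order))
      open Square c≢ε c²≢ε c³≢ε b∉ b²≢c b²≢c² using (⟨X⟩; S∈)
      open Cosets {4} b∉ (below₄ c≢ε c²≢ε c³≢ε (proj₂ order))

  ⋆-⁻¹ : ∀ n c → n ⋆ (c ⁻¹) ≡ (n ⋆ c) ⁻¹
  ⋆-⁻¹ zero c = sym ε⁻¹≈ε
  ⋆-⁻¹ (suc n) c = trans (1+× n (c ⁻¹)) (trans (cong (c ⁻¹ ∙_) (⋆-⁻¹ n c)) (trans (sym (⁻¹-anti-homo-∙ (n ⋆ c) c))
    (cong _⁻¹ (sym (trans (cong (_⋆ c) (ℕ.+-comm 1 n)) (×-homo-+ c n 1))))))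

  ⋆-⁻¹-≢ε : ∀ n {c} → n ⋆ c ≢ ε → n ⋆ (c ⁻¹) ≢ ε
  ⋆-⁻¹-≢ε n {c} ne e = ne (⁻¹-injective (trans (sym (⋆-⁻¹ n c)) (trans e (sym ε⁻¹≈ε))))

  module _ {c b : Carrier} (order : OrderAtLeast5 c) (b∉ : ¬ ⟨_⟩.Gen c b) where
    private module C = ⟨_⟩ c

    -- `Square` is applied to `c ⁻¹`, which forbids `c ⁻¹` and its square as values of `b ∙ b`
    -- instead of `c` and `c ∙ c`. A value forbidden both times would make the second, third or
    -- fourth power of `c` trivial, so in order at least 5 one choice always works.
    large-order⁻¹ : b ∙ b ∙ c ≢ ε → b ∙ b ∙ c ∙ c ≢ ε → Good
    large-order⁻¹ b²c≢ε b²c²≢ε = large-order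
      ((⋆-⁻¹-≢ε 1 (proj₁ (proj₁ order)) , ⋆-⁻¹-≢ε 2 (proj₁ (proj₂ (proj₁ order))) , ⋆-⁻¹-≢ε 3 (proj₂ (proj₂ (proj₁ order)))) , ⋆-⁻¹-≢ε 4 (proj₂ order))
      (b∉ ∘ ⟨_⟩.gen-elim (c ⁻¹) C.Gen? C.gen-ε (λ { x _ refl x∈ → C.gen-product x∈ (C.gen-inverse C.c∈) })
        (λ { x _ refl x∈ → C.gen-product x∈ (C.gen-inverse (C.gen-inverse C.c∈)) }))
      (λ e → b²c≢ε (trans (cong (_∙ c) e) (inverseˡ c)))
      (λ e → b²c²≢ε (trans (cong (λ y → y ∙ c ∙ c) e) (trans (cong (_∙ c) (//-rightDividesˡ c (c ⁻¹))) (inverseˡ c))))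

  order≥5 : ∀ c → OrderAtLeast5 c → Result
  order≥5 c order@((c≢ε , c²≢ε , c³≢ε) , c⁴≢ε) with outside? c
  ... | inj₂ full = inj₁ (cyclic-DRR c≢ε full)
  ... | inj₁ (b , b∉) with b ∙ b ≟ c | b ∙ b ≟ c ∙ c
  ...   | no b²≢c  | no b²≢c² = good (large-order order b∉ b²≢c b²≢c²)
  ...   | yes b²≡c | _        = good (large-order⁻¹ order b∉
            (λ e → c²≢ε (trans (cong (_∙ c) (sym b²≡c)) e)) (λ e → c³≢ε (trans (cong (λ y → y ∙ c ∙ c) (sym b²≡c)) e)))
  ...   | no _ | yes b²≡c² = good (large-order⁻¹ order b∉
            (λ e → c³≢ε (trans (cong (_∙ c) (sym b²≡c²)) e)) (λ e → c⁴≢ε (trans (cong (λ y → y ∙ c ∙ c) (sym b²≡c²)) e)))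

  -- If all elements outside `⟨ c ⟩` have square `c ∙ c`, the group is Q₈. Otherwise there is a `b`
  -- violating this: an involution gives eight elements against the bound six, and in the remaining
  -- case `b ∙ b` is a ninth element against the bound eight.
  order-4 : (∀ x → ¬ OrderAtLeast5 x) → ∀ c → OrderAtLeast4 c → Result
  order-4 bounded c order@(c≢ε , c²≢ε , c³≢ε) with outside? c
  ... | inj₂ full = inj₁ (cyclic-DRR c≢ε full)
  ... | inj₁ (b , b∉) = split (∃-or-∀¬ λ x → ¬? (C.Gen? x) ×-dec ¬? (x ∙ x ≟ c ∙ c))
    where
    module C = ⟨_⟩ c

    c⁴≡ε : 4 ⋆ c ≡ ε
    c⁴≡ε = decidable-stable (4 ⋆ c ≟ ε) λ ne → bounded c (order , ne)

    involution-in : ∀ {y} → C.Gen y → y ∙ y ≡ ε → y ≢ ε → y ≡ c ∙ c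
    involution-in y∈ y²≡ε y≢ε with finite-powers {3} c⁴≡ε y∈
    ... | zero , refl                 = contradiction refl y≢ε
    ... | suc zero , refl             = contradiction y²≡ε c²≢ε
    ... | suc (suc zero) , refl       = refl
    ... | suc (suc (suc zero)) , refl = contradiction (begin
        c ∙ c                           ≡⟨ identityˡ (c ∙ c) ⟨
        ε ∙ (c ∙ c)                     ≡⟨ cong (_∙ (c ∙ c)) c⁴≡ε ⟨
        4 ⋆ c ∙ 2 ⋆ c                   ≡⟨ ×-homo-+ c 4 2 ⟨
        6 ⋆ c                           ≡⟨ ×-homo-+ c 3 3 ⟩
        3 ⋆ c ∙ 3 ⋆ c                   ≡⟨ y²≡ε ⟩
        ε                               ∎) c²≢ε
      where open ≡-Reasoning

    split : (∃ λ x → ¬ C.Gen x × x ∙ x ≢ c ∙ c) ⊎ (∀ x → ¬ (¬ C.Gen x × x ∙ x ≢ c ∙ c)) → Result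
    split (inj₂ none) = inj₂ (inj₁ (Quaternion.≅Q₈ G c²≢ε c⁴≡ε b∉
      λ x x∉ → decidable-stable (x ∙ x ≟ c ∙ c) λ ne → none x (x∉ , ne)))
    split (inj₁ (b , b∉ , b²≢c²)) with b ∙ b ≟ ε
    ... | yes b²≡ε = good (Involution.good c²≢ε b²≡ε b∉ cosets cosets-inj (cosets∈ ⟨X⟩ (S∈ zero) (S∈ (suc zero))) (from-yes (6 ℕ.<? 8)))
      where
      open Involution c²≢ε b²≡ε b∉ using (⟨X⟩; S∈)
      open Cosets {3} b∉ (below₃ c≢ε c²≢ε c³≢ε)
    ... | no b²≢ε = good (Square.good c≢ε c²≢ε c³≢ε b∉ b²≢c b²≢c²
          cosets⁺ cosets⁺-inj (cosets⁺∈ ⟨X⟩ (S∈ zero) (S∈ (suc (suc zero))) (Subgroup.∙∈ ⟨X⟩ (S∈ (suc (suc zero))) (S∈ (suc (suc zero)))))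
          (from-yes (8 ℕ.<? 9)))
      where
      -- Otherwise `b` has order four, as `3 ⋆ b ≡ ε` would put `b` itself into `⟨ c ⟩`; then
      -- `b ∙ b` is an involution of `⟨ c ⟩`, and the only one is `c ∙ c`.
      b²∉ : ¬ C.Gen (b ∙ b)
      b²∉ b²∈ = b²≢c² (involution-in b²∈ (trans (sym (assoc (b ∙ b) b b)) b⁴≡ε) b²≢ε)
        where
        b⁴≡ε : 4 ⋆ b ≡ ε
        b⁴≡ε = decidable-stable (4 ⋆ b ≟ ε) λ b⁴≢ε → bounded b
          (((λ { refl → b∉ C.gen-ε }) , b²≢ε , (λ b³≡ε → b∉ (C.∙∈ʳ b²∈ (subst C.Gen (sym b³≡ε) C.gen-ε)))) , b⁴≢ε)
      b²≢c : b ∙ b ≢ c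
      b²≢c e = b²∉ (subst C.Gen (sym e) C.c∈)
      powers≢b² : ∀ (i : Fin 4) → toℕ i ⋆ c ≢ b ∙ b
      powers≢b² i e = b²∉ (subst C.Gen e (C.powers∈ (toℕ i)))
      coset≢b² : ∀ (i : Fin 4) → b ∙ toℕ i ⋆ c ≢ b ∙ b
      coset≢b² i e = b∉ (subst C.Gen (∙-cancelˡ b _ _ e) (C.powers∈ (toℕ i)))
      open Square c≢ε c²≢ε c³≢ε b∉ b²≢c b²≢c² using (⟨X⟩; S∈)
      open Cosets {3} b∉ (below₃ c≢ε c²≢ε c³≢ε)
      open Extra powers≢b² coset≢b²

  module _ (bounded : ∀ x → ¬ OrderAtLeast4 x) where
    cube : ∀ x → x ∙ x ≢ ε → 3 ⋆ x ≡ ε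
    cube x x²≢ε = decidable-stable (3 ⋆ x ≟ ε) λ x³≢ε → bounded x ((λ { refl → x²≢ε (identityˡ ε) }) , x²≢ε , x³≢ε)

    module _ {b c : Carrier} (b≢ε : b ≢ ε) (b²≡ε : b ∙ b ≡ ε) (c²≢ε : c ∙ c ≢ ε) where
      private module C = ⟨_⟩ c

      c≢ε : c ≢ ε
      c≢ε refl = c²≢ε (identityˡ ε)

      c³≡ε : 3 ⋆ c ≡ ε
      c³≡ε = cube c c²≢ε

      b∉ : ¬ C.Gen b
      b∉ b∈ with finite-powers {2} c³≡ε b∈
      ... | zero , refl           = b≢ε refl
      ... | suc zero , refl       = c²≢ε b²≡ε
      ... | suc (suc zero) , refl = c≢ε (trans (sym (cube-square c³≡ε)) b²≡ε)

      -- Otherwise `c ∙ b` has square `c ∙ c` and cube `b`, hence order six, against the bound on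
      -- element orders.
      cb≢bc : c ∙ b ≢ b ∙ c
      cb≢bc cb≡bc = bounded (c ∙ b)
        ( (λ e → b∉ (C.∙∈ʳ C.c∈ (subst C.Gen (sym e) C.gen-ε)))
        , (λ e → c²≢ε (trans (sym square) e))
        , (λ e → b≢ε (trans (sym third) e)))
        where
        open ≡-Reasoning
        square : c ∙ b ∙ (c ∙ b) ≡ c ∙ c
        square = begin
          c ∙ b ∙ (c ∙ b) ≡⟨ cong (_∙ (c ∙ b)) cb≡bc ⟩
          b ∙ c ∙ (c ∙ b) ≡⟨ assoc (b ∙ c) c b ⟨
          b ∙ c ∙ c ∙ b   ≡⟨ cong (λ y → y ∙ c ∙ b) cb≡bc ⟨
          c ∙ b ∙ c ∙ b   ≡⟨ cong (_∙ b) (assoc c b c) ⟩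
          c ∙ (b ∙ c) ∙ b ≡⟨ cong (λ y → c ∙ y ∙ b) cb≡bc ⟨
          c ∙ (c ∙ b) ∙ b ≡⟨ cong (_∙ b) (assoc c c b) ⟨
          c ∙ c ∙ b ∙ b   ≡⟨ assoc (c ∙ c) b b ⟩
          c ∙ c ∙ (b ∙ b) ≡⟨ cong (c ∙ c ∙_) b²≡ε ⟩
          c ∙ c ∙ ε       ≡⟨ identityʳ (c ∙ c) ⟩
          c ∙ c           ∎
        third : 3 ⋆ (c ∙ b) ≡ b
        third = begin
          c ∙ b ∙ (c ∙ b) ∙ (c ∙ b) ≡⟨ cong (_∙ (c ∙ b)) square ⟩
          c ∙ c ∙ (c ∙ b)           ≡⟨ assoc (c ∙ c) c b ⟨
          c ∙ c ∙ c ∙ b             ≡⟨ cong (_∙ b) c³≡ε ⟩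
          ε ∙ b                     ≡⟨ identityˡ b ⟩
          b                         ∎

      -- As `c ∙ b` differs from `b` and `b ∙ c`, it is a seventh element beside the two cosets
      -- unless it equals `b ∙ (c ∙ c)`. That exception is the group of order six, where the
      -- counting fails.
      mixed-orders : Good
      mixed-orders with c ∙ b ≟ b ∙ (c ∙ c)
      ... | yes cb≡bc² = Involution.Dihedral.dihedral-good c²≢ε b²≡ε b∉ c³≡ε cb≡bc²
      ... | no cb≢bc²  = Involution.good c²≢ε b²≡ε b∉ cosets⁺ cosets⁺-inj
          (cosets⁺∈ ⟨X⟩ (S∈ zero) (S∈ (suc zero)) (Subgroup.∙∈ ⟨X⟩ (S∈ zero) (S∈ (suc zero)))) (from-yes (6 ℕ.<? 7))
        where
        open Involution c²≢ε b²≡ε b∉ using (⟨X⟩; S∈)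
        powers≢cb : ∀ (i : Fin 3) → toℕ i ⋆ c ≢ c ∙ b
        powers≢cb i e = b∉ (C.∙∈ʳ C.c∈ (subst C.Gen e (C.powers∈ (toℕ i))))
        coset≢cb : ∀ (i : Fin 3) → b ∙ toℕ i ⋆ c ≢ c ∙ b
        coset≢cb zero e             = c≢ε (identityˡ-unique c b (trans (sym e) (identityʳ b)))
        coset≢cb (suc zero) e       = cb≢bc (sym e)
        coset≢cb (suc (suc zero)) e = cb≢bc² (sym e)
        open Cosets {2} b∉ (below₂ c≢ε c²≢ε)
        open Extra powers≢cb coset≢cb

    module _ (cubes : ∀ x → 3 ⋆ x ≡ ε) (comm : ∀ x y → x ∙ y ≡ y ∙ x) where
      open Cubes cubes comm

      exponent-3 : ∀ {c} → c ≢ ε → Result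
      exponent-3 {c} c≢ε with missed (cyclic c≢ε)
      ... | inj₂ onto = inj₁ (cyclic-DRR c≢ε λ x → subst (⟨_⟩.Gen c) (proj₂ (onto x)) (⟨_⟩.powers∈ c (toℕ (proj₁ (onto x)))))
      ... | inj₁ (_ , x∉) with extend (cyclic c≢ε) x∉
      ...   | emb₂ with missed emb₂
      ...     | inj₂ onto = inj₂ (inj₂ (inj₂ (inj₂ (inj₂ (Embedding.surjective⇒≅ emb₂ onto)))))
      ...     | inj₁ (_ , y∉) = good (Cube.explicit-good G (extend emb₂ y∉) cube-certificate)

    all-cubes : (∀ x → ¬ (x ≢ ε × x ∙ x ≡ ε)) → ∀ x → 3 ⋆ x ≡ ε
    all-cubes no-involution x with x ≟ ε
    ... | yes refl = trans (identityʳ _) (identityʳ _)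
    ... | no x≢ε   = cube x λ e → no-involution x (x≢ε , e)

    order-3 : ∀ c → c ∙ c ≢ ε → Result
    order-3 c c²≢ε with ∃-or-∀¬ (λ b → ¬? (b ≟ ε) ×-dec (b ∙ b ≟ ε))
    ... | inj₁ (b , b≢ε , b²≡ε) = good (mixed-orders b≢ε b²≡ε c²≢ε)
    ... | inj₂ no-involution with ∃-or-∀¬ (λ x → search λ y → ¬? (x ∙ y ≟ y ∙ x))
    ...   | inj₁ (x , y , xy≢yx) = good (Twisted.good (all-cubes no-involution x) (all-cubes no-involution y) xy≢yx)
    ...   | inj₂ commute = exponent-3 (all-cubes no-involution)
              (λ x y → decidable-stable (x ∙ y ≟ y ∙ x) λ ne → commute x (y , ne))
              {c} λ e → c²≢ε (trans (cong₂ _∙_ e e) (identityˡ ε))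

  module _ (squares : ∀ x → x ∙ x ≡ ε) where
    open Squares squares

    -- Each embedding is either onto, which settles the group, or misses an element that raises the
    -- rank by one. At rank five the explicit set takes over for the subgroup reached, however large
    -- the group is.
    exponent-2 : ∀ {a} → a ≢ ε → Result
    exponent-2 {a} a≢ε with missed (cyclic a≢ε)
    ... | inj₂ onto = inj₁ (cyclic-DRR a≢ε λ x → subst (⟨_⟩.Gen a) (proj₂ (onto x)) (⟨_⟩.powers∈ a (toℕ (proj₁ (onto x)))))
    ... | inj₁ (_ , b∉) with extend (cyclic a≢ε) b∉
    ...   | emb₂ with missed emb₂
    ...     | inj₂ onto = inj₂ (inj₂ (inj₁ (Embedding.surjective⇒≅ emb₂ onto)))
    ...     | inj₁ (_ , c∉) with extend emb₂ c∉
    ...       | emb₃ with missed emb₃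
    ...         | inj₂ onto = inj₂ (inj₂ (inj₂ (inj₁ (Embedding.surjective⇒≅ emb₃ onto))))
    ...         | inj₁ (_ , d∉) with extend emb₃ d∉
    ...           | emb₄ with missed emb₄
    ...             | inj₂ onto = inj₂ (inj₂ (inj₂ (inj₂ (inj₁ (Embedding.surjective⇒≅ emb₄ onto)))))
    ...             | inj₁ (_ , e∉) = good (Penteract.explicit-good G (extend emb₄ e∉) penteract-certificate)

  one-orbit : Result
  one-orbit with nontrivial-or-trivial
  ... | inj₂ trivial = inj₁ (trivial-DRR₁ trivial)
  ... | inj₁ (a , a≢ε) with ∃-or-∀¬ orderAtLeast5?
  ...   | inj₁ (c , order) = order≥5 c order
  ...   | inj₂ bounded₅ with ∃-or-∀¬ orderAtLeast4?
  ...     | inj₁ (c , order) = order-4 bounded₅ c order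
  ...     | inj₂ bounded₄ with ∃-or-∀¬ (λ c → ¬? (c ∙ c ≟ ε))
  ...       | inj₁ (c , c²≢ε) = order-3 bounded₄ c c²≢ε
  ...       | inj₂ squares = exponent-2 (λ x → decidable-stable (x ∙ x ≟ ε) (squares x)) a≢ε

theorem1p2 : (m : ℕ) → 1 ≤ m → (G : FinGroup) →
    HasDRR m G
    ⊎ (m ≡ 1 × (G ≅ Q₈ ⊎ G ≅ ℤ₂² ⊎ G ≅ ℤ₂³ ⊎ G ≅ ℤ₂⁴ ⊎ G ≅ ℤ₃²))
    ⊎ (m ≡ 2 × (G ≅ ℤ₁ ⊎ G ≅ ℤ₂))
    ⊎ (3 ≤ m × m ≤ 5 × G ≅ ℤ₁)
theorem1p2 1 _ G = Sum.map₂ (λ e → inj₁ (refl , e)) (OneOrbit.one-orbit G)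
theorem1p2 2 _ G = Sum.map₂ (λ e → inj₂ (inj₁ (refl , e))) (SeveralOrbits.two-orbits G)
theorem1p2 (suc (suc (suc N))) _ G = Sum.map₂ (λ (le , e) → inj₂ (inj₂ (s≤s (s≤s (s≤s z≤n)) , le , e)))
  (SeveralOrbits.at-least-three-orbits G N)
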